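{- The monochromatic complete symmetric functions $S_n^{(i)}$ ($n\ge1$, $0\le i\le l-1$) generate a Hopf subalgebra $\mathrm{MR}^{(l)}$ of $\mathbf{Sym}^{(l)}$, which is isomorphic to the Mantaci–Reutenauer descent algebra of the wreath products $\mathfrak S_n^{(l)}=(\mathbb Z/l\mathbb Z)\wr\mathfrak S_n$: for every $n$, under the identification $\mathbf G_h\mapsto h$ ($h\in\mathfrak S_n^{(l)}$), the degree $n$ component of $\mathrm{MR}^{(l)}$ is identified with the Mantaci–Reutenauer descent algebra in $\mathbb C[\mathfrak S_n^{(l)}]$.
   Context: Here $\mathbb N=\{0,1,2,\dots\}$, $l\ge1$, and the set of colors is $C=\mathbb Z/l\mathbb Z=\{0,\dots,l-1\}$. A colored permutation of size $n\ge0$ is a pair $(\sigma,u)$ with $\sigma\in\mathfrak S_n$, $u\in C^n$ (permutations are written as words). $\mathrm{Std}$ of a word with distinct integer letters is the permutation whose letters are in the same relative order. $\mathbf{FQSym}^{(l)}$ is the graded Hopf algebra over $\mathbb C$ with basis $(\mathbf G_{\sigma,u})$ indexed by colored permutations (degree = size), product $\mathbf G_{\sigma',u'}\mathbf G_{\sigma'',u''}=\sum_{\sigma}\mathbf G_{\sigma,u'\cdot u''}$, the sum over permutations $\sigma$ of size $|\sigma'|+|\sigma''|$ whose first $|\sigma'|$ letters standardize to $\sigma'$ and whose remaining letters standardize to $\sigma''$, and coproduct $\Delta\mathbf G_{\sigma,u}=\sum_{i=0}^n\mathbf G_{(\sigma,u)_{[1,i]}}\otimes\mathbf G_{(\sigma,u)_{[i+1,n]}}$,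 where $(\sigma,u)_{[a,b]}=(\mathrm{Std}(\sigma'),u')$ with $\sigma'$ the subword of $\sigma$ of letters in $[a,b]$ and $u'$ the subword of $u$ at the same positions. For $\mathbf n=(n_0,\dots,n_{l-1})\in\mathbb N^l$ with $\sum_i n_i=n$, $S_{\mathbf n}=\sum_u\mathbf G_{12\cdots n,u}$, the sum over $u\in C^n$ with exactly $n_i$ occurrences of the color $i$ for each $i$ ($S_{\mathbf 0}=1$). $\mathbf{Sym}^{(l)}$ is the Hopf subalgebra of $\mathbf{FQSym}^{(l)}$ generated by the $S_{\mathbf n}$. For $n\ge1$ and $0\le i\le l-1$, $S_n^{(i)}=S_{n\mathbf e_i}=\mathbf G_{12\cdots n,\,i^n}$, where $\mathbf e_i$ is the $i$-th canonical basis vector of $\mathbb N^l$ (indexed from $0$). The group $\mathfrak S_n^{(l)}=(\mathbb Z/l\mathbb Z)\wr\mathfrak S_n$ is the set of colored permutations of size $n$ with multiplication $(\sigma;c_1,\dots,c_n)(\tau;d_1,\dots,d_n)=(\sigma\tau;c_{\tau(1)}+d_1,\dots,c_{\tau(n)}+d_n)$, where $(\sigma\tau)(i)=\sigma(\tau(i))$. The Mantaci–Reutenauer descent algebra of $\mathfrak S_n^{(l)}$ is the subalgebra of $\mathbb C[\mathfrak S_n^{(l)}]$ spanned by the following elements, indexed by pairs $(I,v)$ with $I=(i_1,\dots,i_m)$ a composition of $n$ and $v\in C^m$: the sum of all $(\sigma,u)\in\mathfrak S_n^{(l)}$ such that $u=v_1^{i_1}v_2^{i_2}\cdots v_m^{i_m}$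 (the first $i_1$ positions have color $v_1$, the next $i_2$ positions have color $v_2$, etc.) and $\sigma$ is increasing on each of the $m$ successive blocks of positions of lengths $i_1,\dots,i_m$. Equivalently, it is spanned by the sums of all $(\sigma,u)$ having a given color word $u$ and a given set of descents, where $k$ is a descent of $(\sigma,u)$ if $u_k\ne u_{k+1}$, or $u_k=u_{k+1}$ and $\sigma(k)>\sigma(k+1)$. -}

module Defs where

open import Algebra.Bundles using (CommutativeRing)
open import Data.Fin.Base using (Fin; zero; suc; toℕ; fromℕ<)
import Data.Fin.Properties as Fin
open import Data.List.Base as List using (List; []; _∷_)
import Data.List.Properties as Listₚ
import Data.List.Relation.Unary.All as ListAll
import Data.List.Relation.Unary.AllPairs as ListPairs
open import Data.List.Relation.Unary.Linked using (Linked; linked?)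
import Data.List.Relation.Unary.Unique.Propositional as ListUnique
import Data.List.Relation.Unary.Unique.Propositional.Properties as ListUniqueₚ
open import Data.Maybe.Base using (Maybe; just; nothing)
open import Data.Nat.Base using (ℕ; zero; suc; _+_; _≤_; _<_; s≤s; NonZero)
open import Data.Nat.DivMod using (_mod_)
open import Data.Nat.ListAction using (sum)
import Data.Nat.Properties as ℕ
open import Data.Product.Base using (∃; ∃₂; _×_; _,_; proj₁; proj₂)
import Data.Product.Properties as Product
open import Data.Vec.Base as Vec using (Vec; []; _∷_; lookup)
import Data.Vec.Properties as Vec
import Data.Vec.Relation.Unary.All.Properties as VecAllₚ
open import Data.Vec.Relation.Unary.AllPairs using (allPairs?; []; _∷_)
open import Data.Vec.Relation.Unary.Unique.Propositional using (Unique)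
import Data.Vec.Relation.Unary.Unique.Propositional.Properties as Uniqueₚ
open import Level using (Level; _⊔_) renaming (suc to lsuc)
open import Relation.Binary.Definitions using (DecidableEquality; tri<; tri≈; tri>)
open import Relation.Binary.PropositionalEquality
  using (_≡_; refl; sym; cong)
open import Relation.Nullary using (¬_; yes; no; does; contradiction)
open import Relation.Nullary.Decidable using (_×-dec_; ¬?; map′)
open import Relation.Unary using (Pred; Decidable; _∈_; _⊆_; _∩_)
open import Data.Bool.Base using (if_then_else_)

private
  variable
    a p : Level
    A B : Set a
    k m n : ℕ

-- The one-line word of an element of 𝔖ₙ. Letters are 0-based: the letter j of
-- the usual alphabet {1,…,n} is the element of Fin n with toℕ equal to j ∸ 1.
record Perm (n : ℕ) : Set where
  constructor perm
  field
    letters   : Vec (Fin n) n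
    .distinct : Unique letters

open Perm public

unique? : Decidable (Unique {A = Fin m} {n = n})
unique? = allPairs? λ x y → ¬? (x Fin.≟ y)

infix 4 _≟ₚ_
_≟ₚ_ : DecidableEquality (Perm n)
perm v _ ≟ₚ perm w _ = map′ (λ { refl → refl }) (cong letters) (Vec.≡-dec Fin._≟_ v w)

words : List A → (n : ℕ) → List (Vec A n)
words xs zero    = [] ∷ []
words xs (suc n) = List.cartesianProductWith _∷_ xs (words xs n)

toPerm : Vec (Fin n) n → Maybe (Perm n)
toPerm w with unique? w
... | yes d = just (perm w d)
... | no  _ = nothing

permutations : (n : ℕ) → List (Perm n)
permutations n = List.mapMaybe toPerm (words (List.allFin n) n)

idPerm : (n : ℕ) → Perm n
idPerm n = perm (Vec.allFin n) (Uniqueₚ.tabulate⁺ λ eq → eq)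

count< : {P : Pred A p} (P? : Decidable P) (w : Vec A n) (i : Fin n) →
         ¬ P (lookup w i) → Vec.count P? w < n
count< P? (x ∷ w) zero ¬Px with P? x
... | yes Px = contradiction Px ¬Px
... | no  _  = s≤s (Vec.count≤n P? w)
count< P? (x ∷ w) (suc i) ¬P with P? x
... | yes _ = s≤s (count< P? w i ¬P)
... | no  _ = ℕ.m<n⇒m<1+n (count< P? w i ¬P)

count-mono : {P Q : Pred A p} (P? : Decidable P) (Q? : Decidable Q) → P ⊆ Q →
             (w : Vec A n) → Vec.count P? w ≤ Vec.count Q? w
count-mono P? Q? P⊆Q [] = ℕ.≤-refl
count-mono P? Q? P⊆Q (x ∷ w) with P? x | Q? x
... | yes _  | yes _  = s≤s (count-mono P? Q? P⊆Q w)
... | yes Px | no ¬Qx = contradiction (P⊆Q Px) ¬Qx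
... | no _   | yes _  = ℕ.m≤n⇒m≤1+n (count-mono P? Q? P⊆Q w)
... | no _   | no _   = count-mono P? Q? P⊆Q w

count-mono-< : {P Q : Pred A p} (P? : Decidable P) (Q? : Decidable Q) → P ⊆ Q →
               (w : Vec A n) (i : Fin n) → Q (lookup w i) → ¬ P (lookup w i) →
               Vec.count P? w < Vec.count Q? w
count-mono-< P? Q? P⊆Q (x ∷ w) zero Qx ¬Px with P? x | Q? x
... | yes Px | _      = contradiction Px ¬Px
... | no _   | yes _  = s≤s (count-mono P? Q? P⊆Q w)
... | no _   | no ¬Qx = contradiction Qx ¬Qx
count-mono-< P? Q? P⊆Q (x ∷ w) (suc i) Qi ¬Pi with P? x | Q? x
... | yes _  | yes _  = s≤s (count-mono-< P? Q? P⊆Q w i Qi ¬Pi)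
... | yes Px | no ¬Qx = contradiction (P⊆Q Px) ¬Qx
... | no _   | yes _  = ℕ.m<n⇒m<1+n (count-mono-< P? Q? P⊆Q w i Qi ¬Pi)
... | no _   | no _   = count-mono-< P? Q? P⊆Q w i Qi ¬Pi

-- The (0-based) letter of Std w at a position is the number of letters of w that
-- are strictly smaller than the letter of w at that position.
rank : Vec (Fin m) k → Fin k → ℕ
rank w i = Vec.count (Fin._<? lookup w i) w

stdWord : Vec (Fin m) k → Vec (Fin k) k
stdWord w = Vec.tabulate λ i → fromℕ< {rank w i} (count< (Fin._<? lookup w i) w i (ℕ.<-irrefl refl))

rank-mono : (w : Vec (Fin m) k) (i j : Fin k) →
            toℕ (lookup w i) < toℕ (lookup w j) → rank w i < rank w j
rank-mono w i j wi<wj =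
  count-mono-< (Fin._<? lookup w i) (Fin._<? lookup w j)
    (λ x<wi → ℕ.<-trans x<wi wi<wj) w i wi<wj (ℕ.<-irrefl refl)

rank-injective : (w : Vec (Fin m) k) → Unique w →
                 (i j : Fin k) → rank w i ≡ rank w j → i ≡ j
rank-injective w d i j eq with Fin.<-cmp (lookup w i) (lookup w j)
... | tri< lt _ _ = contradiction eq (ℕ.<⇒≢ (rank-mono w i j lt))
... | tri≈ _ e _  = Uniqueₚ.lookup-injective d i j e
... | tri> _ _ gt = contradiction (sym eq) (ℕ.<⇒≢ (rank-mono w j i gt))

stdWord-unique : (w : Vec (Fin m) k) → Unique w → Unique (stdWord w)
stdWord-unique w d =
  Uniqueₚ.tabulate⁺ λ {i} {j} eq → rank-injective w d i j (Fin.fromℕ<-injective _ _ _ _ eq)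

Std : (w : Vec (Fin m) k) → .(Unique w) → Perm k
Std w d = perm (stdWord w) (stdWord-unique w d)

-- The positions of w carrying a letter of the (1-based) interval [a , b].
positions : Vec (Fin m) n → (a b : ℕ) → List (Fin n)
positions {n = n} w a b =
  List.filter (λ p → (a ℕ.≤? suc (toℕ (lookup w p))) ×-dec
                     (suc (toℕ (lookup w p)) ℕ.≤? b))
              (List.allFin n)

subword : Vec A n → (ps : List (Fin n)) → Vec A (List.length ps)
subword w ps = Vec.map (lookup w) (Vec.fromList ps)

fromList-unique : {xs : List A} → ListUnique.Unique xs → Unique (Vec.fromList xs)
fromList-unique ListPairs.[]       = []
fromList-unique (p ListPairs.∷ ps) = VecAllₚ.fromList⁺ p ∷ fromList-unique ps

positions-unique : (w : Vec (Fin m) n) (a b : ℕ) → ListUnique.Unique (positions w a b)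
positions-unique {n = n} w a b =
  ListUniqueₚ.filter⁺ (λ p → (a ℕ.≤? suc (toℕ (lookup w p))) ×-dec
                             (suc (toℕ (lookup w p)) ℕ.≤? b))
                      (ListUniqueₚ.allFin⁺ n)

subword-unique : {w : Vec A n} → Unique w → {ps : List (Fin n)} →
                 ListUnique.Unique ps → Unique (subword w ps)
subword-unique d u = Uniqueₚ.map⁺ (Uniqueₚ.lookup-injective d _ _) (fromList-unique u)

record Composition (n : ℕ) : Set where
  field
    parts    : List ℕ
    positive : ListAll.All (0 <_) parts
    sums     : sum parts ≡ n

  len : ℕ
  len = List.length parts

blocks : List ℕ → List A → List (List A)
blocks []      w = []
blocks (i ∷ I) w = List.take i w ∷ blocks I (List.drop i w)

IncreasingOnBlocks : List ℕ → Perm n → Set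
IncreasingOnBlocks I σ =
  ListAll.All (Linked (λ x y → toℕ x < toℕ y)) (blocks I (Vec.toList (letters σ)))

increasingOnBlocks? : (I : List ℕ) → Decidable (IncreasingOnBlocks {n} I)
increasingOnBlocks? I σ =
  ListAll.all? (linked? Fin._<?_) (blocks I (Vec.toList (letters σ)))

module ColoredPermutations (l : ℕ) .{{l≢0 : NonZero l}} where

  Color : Set
  Color = Fin l

  _+ᶜ_ : Color → Color → Color
  c +ᶜ d = (toℕ c + toℕ d) mod l

  ColPerm : ℕ → Set
  ColPerm n = Perm n × Vec Color n

  _≟ₙ_ : DecidableEquality (ColPerm n)
  _≟ₙ_ = Product.≡-dec _≟ₚ_ (Vec.≡-dec Fin._≟_)

  coloredPermutations : (n : ℕ) → List (ColPerm n)
  coloredPermutations n =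
    List.cartesianProduct (permutations n) (words (List.allFin l) n)

  -- (σ ; c) (τ ; d) = (στ ; c_{τ(1)} + d₁, …, c_{τ(n)} + dₙ) with (στ)(i) = σ(τ(i)).
  infixl 7 _∙_
  _∙_ : ColPerm n → ColPerm n → ColPerm n
  (perm σ dσ , c) ∙ (perm τ dτ , d) =
    perm (Vec.map (lookup σ) τ) (Uniqueₚ.map⁺ (Uniqueₚ.lookup-injective dσ _ _) dτ) ,
    Vec.zipWith _+ᶜ_ (Vec.map (lookup c) τ) d

  Basis : Set
  Basis = ∃ ColPerm

  size : Basis → ℕ
  size = proj₁

  infix 4 _≟_
  _≟_ : DecidableEquality Basis
  _≟_ = Product.≡-dec ℕ._≟_ _≟ₙ_

  -- (σ , u)_[a,b]
  restrict : Basis → (a b : ℕ) → Basis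
  restrict (n , perm w d , u) a b =
    List.length ps ,
    Std (subword w ps) (subword-unique d (positions-unique w a b)) ,
    subword u ps
    where ps = positions w a b

  colorWord : (I : Composition n) → Vec Color (Composition.len I) → List Color
  colorWord I v =
    List.concat (List.zipWith List.replicate (Composition.parts I) (Vec.toList v))

module FreeModules {c ℓ} (K : CommutativeRing c ℓ) where

  private
    module K = CommutativeRing K

  -- Formal linear combinations; two of them are equal when all their
  -- coefficients agree.
  Free : Set a → Set (a ⊔ c)
  Free B = List (K.Carrier × B)

  coeff : DecidableEquality B → Free B → B → K.Carrier
  coeff _≟_ []            b = K.0#
  coeff _≟_ ((k , x) ∷ f) b = (if does (x ≟ b) then k else K.0#) K.+ coeff _≟_ f b

  Equal : {B : Set a} → DecidableEquality B → Free B → Free B → Set (a ⊔ ℓ)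
  Equal _≟_ f g = ∀ b → coeff _≟_ f b K.≈ coeff _≟_ g b

  0ᶠ : Free B
  0ᶠ = []

  infixl 6 _+ᶠ_
  _+ᶠ_ : Free B → Free B → Free B
  _+ᶠ_ = List._++_

  infixr 7 _·_
  _·_ : K.Carrier → Free B → Free B
  k · f = List.map (λ { (k′ , x) → k K.* k′ , x }) f

  -ᶠ_ : Free B → Free B
  -ᶠ f = (K.- K.1#) · f

  [_] : B → Free B
  [ x ] = (K.1# , x) ∷ []

  Σ[_] : List B → Free B
  Σ[ xs ] = List.map (K.1# ,_) xs

  linear : (A → Free B) → Free A → Free B
  linear φ = List.concatMap λ { (k , x) → k · φ x }

  infixr 8 _⊗_
  _⊗_ : Free A → Free B → Free (A × B)
  _⊗_ = List.cartesianProductWith λ { (k , x) (k′ , y) → k K.* k′ , x , y }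

  data Span {B : Set a} (_≟_ : DecidableEquality B) {p} (G : Pred (Free B) p) :
            Pred (Free B) (a ⊔ c ⊔ ℓ ⊔ p) where
    gen  : ∀ {x} → x ∈ G → x ∈ Span _≟_ G
    0∈   : 0ᶠ ∈ Span _≟_ G
    +∈   : ∀ {x y} → x ∈ Span _≟_ G → y ∈ Span _≟_ G → x +ᶠ y ∈ Span _≟_ G
    ·∈   : ∀ k {x} → x ∈ Span _≟_ G → k · x ∈ Span _≟_ G
    resp : ∀ {x y} → Equal _≟_ x y → x ∈ Span _≟_ G → y ∈ Span _≟_ G

module FreeQuasiSymmetric {c ℓ} (K : CommutativeRing c ℓ) (l : ℕ) .{{l≢0 : NonZero l}} where

  open ColoredPermutations l
  open FreeModules K

  FQSym : Set c
  FQSym = Free Basis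

  FQSym² : Set c
  FQSym² = Free (Basis × Basis)

  infix 4 _≈_ _≈²_
  _≈_ : FQSym → FQSym → Set ℓ
  _≈_ = Equal _≟_

  _≈²_ : FQSym² → FQSym² → Set ℓ
  _≈²_ = Equal (Product.≡-dec _≟_ _≟_)

  G : ColPerm n → FQSym
  G h = [ _ , h ]

  𝟙 : FQSym
  𝟙 = G (idPerm 0 , [])

  convolution : Perm m → Perm n → List (Perm (m + n))
  convolution {m} {n} σ′ σ″ =
    List.filter (λ σ → Vec.≡-dec Fin._≟_ (stdWord (Vec.take m (letters σ))) (letters σ′) ×-dec
                       Vec.≡-dec Fin._≟_ (stdWord (Vec.drop m (letters σ))) (letters σ″))
                (permutations (m + n))

  product : Basis × Basis → FQSym
  product ((m , σ′ , u′) , (n , σ″ , u″)) =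
    Σ[ List.map (λ σ → m + n , σ , u′ Vec.++ u″) (convolution σ′ σ″) ]

  μ : FQSym² → FQSym
  μ = linear product

  infixl 8 _*_
  _*_ : FQSym → FQSym → FQSym
  x * y = μ (x ⊗ y)

  Δ : FQSym → FQSym²
  Δ = linear λ h → Σ[ List.map (λ i → restrict h 1 i , restrict h (suc i) (size h))
                               (List.upTo (suc (size h))) ]

  -- FQSym⁽ˡ⁾ is graded and connected, so that the antipode is determined by
  -- S(1) = 1 and, in degree n ≥ 1, by the identity μ ∘ (S ⊗ id) ∘ Δ = 0:
  --   S(G_h) = - Σ_{0 ≤ i < n} S(G_{h_[1,i]}) G_{h_[i+1,n]}.
  -- The first argument bounds the size; h_[1,i] has size i, so the clause
  -- returning 0ᶠ is never reached from antipode.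
  antipodeᵇ : ℕ → Basis → FQSym
  antipodeᵇ _       (zero    , _) = 𝟙
  antipodeᵇ zero    (suc _   , _) = 0ᶠ
  antipodeᵇ (suc f) h@(suc n , _) =
    -ᶠ List.concatMap (λ i → antipodeᵇ f (restrict h 1 i) * [ restrict h (suc i) (suc n) ])
                      (List.upTo (suc n))

  antipode : FQSym → FQSym
  antipode = linear λ h → antipodeᵇ (size h) h

  component : ℕ → FQSym → FQSym
  component n = List.filter λ { (_ , h) → size h ℕ.≟ n }

  -- The image of U ⊗ U in FQSym ⊗ FQSym.
  TensorSquare : Pred FQSym p → Pred FQSym² (c ⊔ ℓ ⊔ p)
  TensorSquare U =
    Span (Product.≡-dec _≟_ _≟_) λ t → ∃₂ λ x y → x ∈ U × y ∈ U × t ≡ x ⊗ y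

  record IsSubalgebra (U : Pred FQSym p) : Set (c ⊔ ℓ ⊔ p) where
    field
      ≈-closed : ∀ {x y} → x ≈ y → x ∈ U → y ∈ U
      0-closed : 0ᶠ ∈ U
      +-closed : ∀ {x y} → x ∈ U → y ∈ U → x +ᶠ y ∈ U
      ·-closed : ∀ k {x} → x ∈ U → k · x ∈ U
      1-closed : 𝟙 ∈ U
      *-closed : ∀ {x y} → x ∈ U → y ∈ U → x * y ∈ U

  record IsHopfSubalgebra (U : Pred FQSym p) : Set (c ⊔ ℓ ⊔ p) where
    field
      isSubalgebra    : IsSubalgebra U
      Δ-closed        : ∀ {x} → x ∈ U → Δ x ∈ TensorSquare U
      antipode-closed : ∀ {x} → x ∈ U → antipode x ∈ U

  IsGraded : Pred FQSym p → Set (c ⊔ p)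
  IsGraded U = ∀ n {x} → x ∈ U → component n x ∈ U

  degree : ℕ → Pred FQSym p → Pred FQSym (ℓ ⊔ p)
  degree n U = U ∩ λ x → component n x ≈ x

  data Algebra⟨_⟩ (X : Pred FQSym p) : Pred FQSym (c ⊔ ℓ ⊔ p) where
    gen  : ∀ {x} → x ∈ X → x ∈ Algebra⟨ X ⟩
    resp : ∀ {x y} → x ≈ y → x ∈ Algebra⟨ X ⟩ → y ∈ Algebra⟨ X ⟩
    0∈   : 0ᶠ ∈ Algebra⟨ X ⟩
    +∈   : ∀ {x y} → x ∈ Algebra⟨ X ⟩ → y ∈ Algebra⟨ X ⟩ → x +ᶠ y ∈ Algebra⟨ X ⟩
    ·∈   : ∀ k {x} → x ∈ Algebra⟨ X ⟩ → k · x ∈ Algebra⟨ X ⟩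
    1∈   : 𝟙 ∈ Algebra⟨ X ⟩
    *∈   : ∀ {x y} → x ∈ Algebra⟨ X ⟩ → y ∈ Algebra⟨ X ⟩ → x * y ∈ Algebra⟨ X ⟩

  -- The Hopf subalgebra generated by X: the smallest one containing X.
  HopfAlgebra⟨_⟩ : Pred FQSym c → Pred FQSym (lsuc (c ⊔ ℓ))
  HopfAlgebra⟨ X ⟩ x =
    (U : Pred FQSym (c ⊔ ℓ)) → IsHopfSubalgebra U → X ⊆ U → x ∈ U

  occurrences : Vec Color n → Vec ℕ l
  occurrences u = Vec.tabulate λ i → Vec.count (i Fin.≟_) u

  S : Vec ℕ l → FQSym
  S 𝐧 = Σ[ List.map (λ u → Vec.sum 𝐧 , idPerm (Vec.sum 𝐧) , u)
                    (List.filter (λ u → Vec.≡-dec ℕ._≟_ (occurrences u) 𝐧)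
                                 (words (List.allFin l) (Vec.sum 𝐧))) ]

  Sym : Pred FQSym (lsuc (c ⊔ ℓ))
  Sym = HopfAlgebra⟨ (λ x → ∃ λ 𝐧 → x ≡ S 𝐧) ⟩

  S⟨_⟩ : Color → ℕ → FQSym
  S⟨ i ⟩ n = S (Vec.replicate l 0 Vec.[ i ]≔ n)

  MR : Pred FQSym (c ⊔ ℓ)
  MR = Algebra⟨ (λ x → ∃₂ λ n i → 1 ≤ n × x ≡ S⟨ i ⟩ n) ⟩

  GroupAlgebra : ℕ → Set c
  GroupAlgebra n = Free (ColPerm n)

  _⋆_ : GroupAlgebra n → GroupAlgebra n → GroupAlgebra n
  x ⋆ y = linear (λ { (g , h) → [ g ∙ h ] }) (x ⊗ y)

  D : (I : Composition n) → Vec Color (Composition.len I) → GroupAlgebra n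
  D {n} I v =
    Σ[ List.filter (λ { (σ , u) →
         Listₚ.≡-dec Fin._≟_ (Vec.toList u) (colorWord I v) ×-dec
         increasingOnBlocks? (Composition.parts I) σ })
       (coloredPermutations n) ]

  -- The linear span of the D I v in the group algebra of (ℤ/lℤ) ≀ 𝔖ₙ. It is closed
  -- under _⋆_ by the theorem of Mantaci and Reutenauer; as a subset, it is
  -- determined by the span alone.
  DescentAlgebra : (n : ℕ) → Pred (GroupAlgebra n) (c ⊔ ℓ)
  DescentAlgebra n = Span _≟ₙ_ λ x → ∃₂ λ (I : Composition n) v → x ≡ D I v

  -- The inverse h ↦ G_h of the identification, extended linearly.
  embed : (n : ℕ) → GroupAlgebra n → FQSym
  embed n = linear G

  embed⟨_⟩ : {n : ℕ} → Pred (GroupAlgebra n) p → Pred FQSym (c ⊔ ℓ ⊔ p)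
  embed⟨_⟩ {n = n} U y = ∃ λ x → x ∈ U × y ≈ embed n x

-- For a weak composition I with a color for each part, let 𝔻 I cs be the sum of the
-- colored permutations with the prescribed color word that increase on the blocks of I.
-- Concatenating (I , cs) and (J , ds) multiplies the 𝔻's, because a word σ increases on
-- the blocks of I followed by those of J if and only if the standardizations of its two
-- factors do. As S_n⁽ⁱ⁾ = 𝔻 (n) (i), the algebra MR is the span of the 𝔻's, and this
-- span is graded and equal to the descent algebra in each degree. Cutting every block of a
-- word at the letter i gives the components of the coproduct: the terms of 𝔻 I are in
-- bijection with those of 𝔻 J ⊗ 𝔻 K for the splittings I = J + K with |J| = i.
-- Closure under the antipode follows from its recursion by induction on the degree.

module Submission where

open import Defs
open import Algebra.Bundles using (CommutativeRing)
import Algebra.Properties.CommutativeSemigroup as CommutativeSemigroup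
import Algebra.Properties.Ring as Ring
open import Data.Bool.Base using (true; false; if_then_else_)
open import Data.Fin.Base as Fin using (Fin; toℕ; fromℕ<)
import Data.Fin.Properties as Fin
open import Data.List.Base as List
  using (List; []; _∷_; _++_; length; filter; map; mapMaybe; concat; concatMap; cartesianProduct;
         cartesianProductWith; replicate; take; drop; upTo; applyUpTo; zip; zipWith)
open import Data.List.Membership.Propositional using () renaming (_∈_ to _∈ₗ_)
import Data.List.Membership.Propositional.Properties as ∈
open import Data.List.Membership.Propositional.Properties.WithK using (unique∧set⇒bag)
import Data.List.Properties as List
open import Data.List.Relation.Binary.BagAndSetEquality using (∼bag⇒↭)
open import Data.List.Relation.Binary.Permutation.Propositional as ↭
  using (_↭_; ↭-refl; ↭-sym; ↭-trans; ↭-reflexive; prep)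
import Data.List.Relation.Binary.Permutation.Propositional.Properties as ↭
import Data.List.Relation.Binary.Permutation.Setoid.Properties as ↭ₛ
import Data.List.Relation.Binary.Pointwise as Pointwise
open import Data.List.Relation.Unary.All as All using (All; []; _∷_)
import Data.List.Relation.Unary.All.Properties as All
open import Data.List.Relation.Unary.AllPairs as AllPairs using (AllPairs; []; _∷_)
import Data.List.Relation.Unary.AllPairs.Properties as AllPairs
open import Data.List.Relation.Unary.Any using (here; there)
open import Data.List.Relation.Unary.Linked as Linked using (Linked; []; [-]; _∷_)
import Data.List.Relation.Unary.Linked.Properties as Linked
open import Data.List.Relation.Unary.Sorted.TotalOrder.Properties using (↗↭↗⇒≋)
open import Data.List.Relation.Unary.Unique.Propositional using (Unique)
import Data.List.Relation.Unary.Unique.Propositional.Properties as Unique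
open import Data.Maybe.Base using (Maybe; just; nothing)
open import Data.Nat.Base using (ℕ; zero; suc; _+_; _∸_; _⊓_; _≤_; _<_; z≤n; s≤s; NonZero)
open import Data.Nat.ListAction using (sum)
import Data.Nat.ListAction.Properties as Sum
import Data.Nat.Properties as ℕ
open import Data.Product.Base using (∃; ∃₂; _×_; _,_; proj₁; proj₂)
import Data.Product.Properties as Product
open import Data.Vec.Base as Vec using (Vec; []; _∷_; lookup; toList)
import Data.Vec.Properties as Vec
import Data.Vec.Relation.Unary.All.Properties as VecAll
import Data.Vec.Relation.Unary.AllPairs as VecAllPairs
import Data.Vec.Relation.Unary.Unique.Propositional as VecUnique
import Data.Vec.Relation.Unary.Unique.Propositional.Properties as VecUnique
open import Function.Base using (_∘_; id; case_of_)
open import Function.Bundles using (mk⇔)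
open import Level using (Level; _⊔_)
open import Relation.Binary.Definitions using (DecidableEquality)
open import Relation.Binary.PropositionalEquality
  using (_≡_; _≢_; refl; sym; trans; cong; cong₂; subst; subst₂; module ≡-Reasoning)
import Relation.Binary.PropositionalEquality.Properties as ≡
import Relation.Binary.Reasoning.Setoid as SetoidReasoning
open import Relation.Nullary using (¬_; yes; no; does; contradiction; recompute)
open import Relation.Nullary.Decidable using (_×-dec_; dec-true)
open import Relation.Unary using (Pred; Decidable; _∈_; _⊆_; _≐_)

-- Every formal sum that matters has all its coefficients equal to 1, so an identity between two of
-- them amounts to a rearrangement of lists of basis elements, and each such rearrangement comes
-- from a bijection. Multiplicities have to be tracked: with blocks (1,1) of one color, the words 12
-- and 21 have the same two halves when cut at 1, so the bijection for the coproduct must remember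
-- the shapes of the halves as well as the halves. Weak compositions are forced by cutting: a block
-- whose letters all lie on one side leaves an empty block on the other. Keeping it leaves both
-- shapes aligned with the one color list `cs`; zero parts are deleted only where positive parts are
-- demanded, by the generators of `MR` and by `Composition`. The type of a colored permutation
-- depends on its size, and the halves and factors of a word have sizes that are only
-- propositionally what they should be. The combinatorics is therefore done on plain lists of
-- letters paired with colors, and vectors occur only at the interface with the definitions.

private
  variable
    a b p p′ : Level
    A B C T : Set a
    k m n : ℕ

-- Formal linear combinations as functionals

module FreeModuleProperties {c ℓ} (K : CommutativeRing c ℓ) where

  open FreeModules K
  private module K = CommutativeRing K
  open K using (_≈_; 0#; 1#; Carrier) renaming (_+_ to _⊹_; _*_ to _∙_)
  open CommutativeSemigroup K.+-commutativeSemigroup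
    using () renaming (interchange to +-interchange)
  open CommutativeSemigroup K.*-commutativeSemigroup
    using () renaming (x∙yz≈y∙xz to *-leftSwap)
  open Ring K.ring using (-1*x≈-x)
  open SetoidReasoning K.setoid

  -- The linear extension of ψ, applied to a formal sum. Testing equality against
  -- all ψ turns linear, _⊗_ and _*_ into iterated sums that can be interchanged.
  ⟦_⟧ : Free B → (B → Carrier) → Carrier
  ⟦ []          ⟧ ψ = 0#
  ⟦ (k , x) ∷ f ⟧ ψ = k ∙ ψ x ⊹ ⟦ f ⟧ ψ

  infix 4 _≋_
  -- A record rather than a function type, so that `f` and `g` can be recovered by unification.
  -- `Equal` unfolds to a function type, and its uses have to name both sides.
  record _≋_ {B : Set b} (f g : Free B) : Set (b ⊔ c ⊔ ℓ) where
    constructor ≋-intro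
    field
      at : ∀ ψ → ⟦ f ⟧ ψ ≈ ⟦ g ⟧ ψ

  open _≋_ public

  ≋-sym : {f g : Free B} → f ≋ g → g ≋ f
  ≋-sym f≋g = ≋-intro λ ψ → K.sym (at f≋g ψ)

  ≋-trans : {f g h : Free B} → f ≋ g → g ≋ h → f ≋ h
  ≋-trans f≋g g≋h = ≋-intro λ ψ → K.trans (at f≋g ψ) (at g≋h ψ)

  ≋-reflexive : {f g : Free B} → f ≡ g → f ≋ g
  ≋-reflexive refl = ≋-intro λ ψ → K.refl

  ⟦⟧-cong : (f : Free B) {φ ψ : B → Carrier} → (∀ x → φ x ≈ ψ x) → ⟦ f ⟧ φ ≈ ⟦ f ⟧ ψ
  ⟦⟧-cong []            φ≈ψ = K.refl
  ⟦⟧-cong ((k , x) ∷ f) φ≈ψ = K.+-cong (K.*-congˡ (φ≈ψ x)) (⟦⟧-cong f φ≈ψ)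

  ⟦⟧-++ : (f g : Free B) (ψ : B → Carrier) → ⟦ f ++ g ⟧ ψ ≈ ⟦ f ⟧ ψ ⊹ ⟦ g ⟧ ψ
  ⟦⟧-++ []            g ψ = K.sym (K.+-identityˡ _)
  ⟦⟧-++ ((k , x) ∷ f) g ψ = K.trans (K.+-congˡ (⟦⟧-++ f g ψ)) (K.sym (K.+-assoc _ _ _))

  ⟦⟧-· : ∀ k (f : Free B) (ψ : B → Carrier) → ⟦ k · f ⟧ ψ ≈ k ∙ ⟦ f ⟧ ψ
  ⟦⟧-· k []             ψ = K.sym (K.zeroʳ k)
  ⟦⟧-· k ((k′ , x) ∷ f) ψ =
    K.trans (K.+-cong (K.*-assoc _ _ _) (⟦⟧-· k f ψ)) (K.sym (K.distribˡ _ _ _))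

  ⟦⟧-linear : (φ : A → Free B) (f : Free A) (ψ : B → Carrier) →
              ⟦ linear φ f ⟧ ψ ≈ ⟦ f ⟧ (λ x → ⟦ φ x ⟧ ψ)
  ⟦⟧-linear φ []            ψ = K.refl
  ⟦⟧-linear φ ((k , x) ∷ f) ψ = begin
    ⟦ k · φ x ++ linear φ f ⟧ ψ            ≈⟨ ⟦⟧-++ (k · φ x) _ ψ ⟩
    ⟦ k · φ x ⟧ ψ ⊹ ⟦ linear φ f ⟧ ψ       ≈⟨ K.+-cong (⟦⟧-· k (φ x) ψ) (⟦⟧-linear φ f ψ) ⟩
    k ∙ ⟦ φ x ⟧ ψ ⊹ ⟦ f ⟧ (λ x → ⟦ φ x ⟧ ψ) ∎

  ⟦⟧-map : (k : Carrier) (h : A → B) (f : Free A) (ψ : B → Carrier) →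
           ⟦ map (λ { (k′ , y) → k ∙ k′ , h y }) f ⟧ ψ ≈ k ∙ ⟦ f ⟧ (λ y → ψ (h y))
  ⟦⟧-map k h []             ψ = K.sym (K.zeroʳ k)
  ⟦⟧-map k h ((k′ , x) ∷ f) ψ =
    K.trans (K.+-cong (K.*-assoc _ _ _) (⟦⟧-map k h f ψ)) (K.sym (K.distribˡ _ _ _))

  ⟦⟧-⊗ : (f : Free A) (g : Free B) (ψ : A × B → Carrier) →
         ⟦ f ⊗ g ⟧ ψ ≈ ⟦ f ⟧ (λ x → ⟦ g ⟧ (λ y → ψ (x , y)))
  ⟦⟧-⊗ []            g ψ = K.refl
  ⟦⟧-⊗ ((k , x) ∷ f) g ψ =
    K.trans (⟦⟧-++ (map (λ { (k′ , y) → k ∙ k′ , x , y }) g) _ ψ)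
            (K.+-cong (⟦⟧-map k (x ,_) g ψ) (⟦⟧-⊗ f g ψ))

  ⟦⟧-0 : (f : Free B) → ⟦ f ⟧ (λ _ → 0#) ≈ 0#
  ⟦⟧-0 []            = K.refl
  ⟦⟧-0 ((k , x) ∷ f) = K.trans (K.+-cong (K.zeroʳ k) (⟦⟧-0 f)) (K.+-identityˡ 0#)

  ⟦⟧-+ : (f : Free B) (φ ψ : B → Carrier) → ⟦ f ⟧ (λ x → φ x ⊹ ψ x) ≈ ⟦ f ⟧ φ ⊹ ⟦ f ⟧ ψ
  ⟦⟧-+ []            φ ψ = K.sym (K.+-identityˡ 0#)
  ⟦⟧-+ ((k , x) ∷ f) φ ψ =
    K.trans (K.+-cong (K.distribˡ _ _ _) (⟦⟧-+ f φ ψ)) (+-interchange _ _ _ _)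

  ⟦⟧-* : ∀ k (f : Free B) (ψ : B → Carrier) → ⟦ f ⟧ (λ x → k ∙ ψ x) ≈ k ∙ ⟦ f ⟧ ψ
  ⟦⟧-* k []             ψ = K.sym (K.zeroʳ k)
  ⟦⟧-* k ((k′ , x) ∷ f) ψ =
    K.trans (K.+-cong (*-leftSwap k′ k (ψ x)) (⟦⟧-* k f ψ)) (K.sym (K.distribˡ _ _ _))

  -- Fubini for finite sums. It moves the argument that is being expanded to the outside, for
  -- products and in the recursion of the antipode.
  ⟦⟧-swap : (f : Free A) (g : Free B) (ψ : A → B → Carrier) →
            ⟦ f ⟧ (λ x → ⟦ g ⟧ (ψ x)) ≈ ⟦ g ⟧ (λ y → ⟦ f ⟧ (λ x → ψ x y))
  ⟦⟧-swap []            g ψ = K.sym (⟦⟧-0 g)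
  ⟦⟧-swap ((k , x) ∷ f) g ψ = begin
    k ∙ ⟦ g ⟧ (ψ x) ⊹ ⟦ f ⟧ (λ x → ⟦ g ⟧ (ψ x))
      ≈⟨ K.+-cong (K.sym (⟦⟧-* k g (ψ x))) (⟦⟧-swap f g ψ) ⟩
    ⟦ g ⟧ (λ y → k ∙ ψ x y) ⊹ ⟦ g ⟧ (λ y → ⟦ f ⟧ (λ x → ψ x y))
      ≈⟨ ⟦⟧-+ g _ _ ⟨
    ⟦ g ⟧ (λ y → k ∙ ψ x y ⊹ ⟦ f ⟧ (λ x → ψ x y)) ∎

  -- The passage from combinatorics to linear algebra: a bijection between index lists becomes an
  -- identity between sums.
  ⟦Σ⟧-↭ : {xs ys : List B} → xs ↭ ys → ∀ ψ → ⟦ Σ[ xs ] ⟧ ψ ≈ ⟦ Σ[ ys ] ⟧ ψ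
  ⟦Σ⟧-↭ ↭.refl          ψ = K.refl
  ⟦Σ⟧-↭ (↭.prep x p)    ψ = K.+-congˡ (⟦Σ⟧-↭ p ψ)
  ⟦Σ⟧-↭ (↭.swap {xs} {ys} x y p) ψ = begin
    s ⊹ (t ⊹ ⟦ Σ[ xs ] ⟧ ψ) ≈⟨ K.+-assoc s t _ ⟨
    (s ⊹ t) ⊹ ⟦ Σ[ xs ] ⟧ ψ ≈⟨ K.+-cong (K.+-comm s t) (⟦Σ⟧-↭ p ψ) ⟩
    (t ⊹ s) ⊹ ⟦ Σ[ ys ] ⟧ ψ ≈⟨ K.+-assoc t s _ ⟩
    t ⊹ (s ⊹ ⟦ Σ[ ys ] ⟧ ψ) ∎
    where s = 1# ∙ ψ x
          t = 1# ∙ ψ y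
  ⟦Σ⟧-↭ (↭.trans p q)   ψ = K.trans (⟦Σ⟧-↭ p ψ) (⟦Σ⟧-↭ q ψ)

  Σ-↭ : {xs ys : List B} → xs ↭ ys → Σ[ xs ] ≋ Σ[ ys ]
  Σ-↭ p = ≋-intro (⟦Σ⟧-↭ p)

  Σ-map : (h : A → B) (xs : List A) (ψ : B → Carrier) →
          ⟦ Σ[ map h xs ] ⟧ ψ ≈ ⟦ Σ[ xs ] ⟧ (λ x → ψ (h x))
  Σ-map h []       ψ = K.refl
  Σ-map h (x ∷ xs) ψ = K.+-congˡ (Σ-map h xs ψ)

  Σ-++ : (xs ys : List B) (ψ : B → Carrier) →
         ⟦ Σ[ xs ++ ys ] ⟧ ψ ≈ ⟦ Σ[ xs ] ⟧ ψ ⊹ ⟦ Σ[ ys ] ⟧ ψ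
  Σ-++ []       ys ψ = K.sym (K.+-identityˡ _)
  Σ-++ (x ∷ xs) ys ψ = K.trans (K.+-congˡ (Σ-++ xs ys ψ)) (K.sym (K.+-assoc _ _ _))

  Σ-concatMap : (F : A → List B) (xs : List A) (ψ : B → Carrier) →
                ⟦ Σ[ concatMap F xs ] ⟧ ψ ≈ ⟦ Σ[ xs ] ⟧ (λ x → ⟦ Σ[ F x ] ⟧ ψ)
  Σ-concatMap F []       ψ = K.refl
  Σ-concatMap F (x ∷ xs) ψ =
    K.trans (Σ-++ (F x) _ ψ) (K.+-cong (K.sym (K.*-identityˡ _)) (Σ-concatMap F xs ψ))

  Σ-cartesianProduct : (xs : List A) (ys : List B) (ψ : A × B → Carrier) →
                       ⟦ Σ[ cartesianProduct xs ys ] ⟧ ψ ≈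
                       ⟦ Σ[ xs ] ⟧ (λ x → ⟦ Σ[ ys ] ⟧ (λ y → ψ (x , y)))
  Σ-cartesianProduct []       ys ψ = K.refl
  Σ-cartesianProduct (x ∷ xs) ys ψ =
    K.trans (Σ-++ (map (x ,_) ys) _ ψ)
            (K.+-cong (K.trans (Σ-map (x ,_) ys ψ) (K.sym (K.*-identityˡ _)))
                      (Σ-cartesianProduct xs ys ψ))

  ⟦⟧-[] : (x : B) (ψ : B → Carrier) → ⟦ [ x ] ⟧ ψ ≈ ψ x
  ⟦⟧-[] x ψ = K.trans (K.+-identityʳ _) (K.*-identityˡ _)

  ⟦⟧-concatMap : (F : A → Free B) (xs : List A) (ψ : B → Carrier) →
                 ⟦ concatMap F xs ⟧ ψ ≈ ⟦ Σ[ xs ] ⟧ (λ x → ⟦ F x ⟧ ψ)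
  ⟦⟧-concatMap F []       ψ = K.refl
  ⟦⟧-concatMap F (x ∷ xs) ψ =
    K.trans (⟦⟧-++ (F x) _ ψ) (K.+-cong (K.sym (K.*-identityˡ _)) (⟦⟧-concatMap F xs ψ))

  Σ-cong-∈ : (xs : List B) {φ ψ : B → Carrier} →
             (∀ x → x ∈ₗ xs → φ x ≈ ψ x) → ⟦ Σ[ xs ] ⟧ φ ≈ ⟦ Σ[ xs ] ⟧ ψ
  Σ-cong-∈ []       eq = K.refl
  Σ-cong-∈ (x ∷ xs) eq =
    K.+-cong (K.*-congˡ (eq x (here refl))) (Σ-cong-∈ xs λ y y∈ → eq y (there y∈))

  module _ {B : Set b} (_≟_ : DecidableEquality B) where

    -- The coordinate functional of `y`. `Equal` tests formal sums against these functionals, `_≋_`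
    -- against all of them.
    δ : B → B → Carrier
    δ y x = if does (x ≟ y) then 1# else 0#

    coeff≈⟦⟧ : (f : Free B) (y : B) → coeff _≟_ f y ≈ ⟦ f ⟧ (δ y)
    coeff≈⟦⟧ []            y = K.refl
    coeff≈⟦⟧ ((k , x) ∷ f) y = K.+-cong (if-* (does (x ≟ y))) (coeff≈⟦⟧ f y)
      where
      if-* : ∀ b → (if b then k else 0#) ≈ k ∙ (if b then 1# else 0#)
      if-* true  = K.sym (K.*-identityʳ k)
      if-* false = K.sym (K.zeroʳ k)

    ≋⇒Equal : {f g : Free B} → f ≋ g → Equal _≟_ f g
    ≋⇒Equal {f} {g} f≋g y =
      K.trans (coeff≈⟦⟧ f y) (K.trans (at f≋g (δ y)) (K.sym (coeff≈⟦⟧ g y)))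

    without : B → Free B → Free B
    without y []            = []
    without y ((k , x) ∷ f) with x ≟ y
    ... | yes _ = without y f
    ... | no  _ = (k , x) ∷ without y f

    without-length : ∀ y (f : Free B) → length (without y f) ≤ length f
    without-length y []            = z≤n
    without-length y ((k , x) ∷ f) with x ≟ y
    ... | yes _ = ℕ.m≤n⇒m≤1+n (without-length y f)
    ... | no  _ = s≤s (without-length y f)

    ⟦⟧-without : ∀ y (f : Free B) ψ → ⟦ f ⟧ ψ ≈ coeff _≟_ f y ∙ ψ y ⊹ ⟦ without y f ⟧ ψ
    ⟦⟧-without y []            ψ = K.sym (K.trans (K.+-identityʳ _) (K.zeroˡ _))
    ⟦⟧-without y ((k , x) ∷ f) ψ with x ≟ y
    ... | yes refl = begin
      k ∙ ψ x ⊹ ⟦ f ⟧ ψ             ≈⟨ K.+-congˡ (⟦⟧-without y f ψ) ⟩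
      k ∙ ψ x ⊹ (q ∙ ψ x ⊹ r)       ≈⟨ K.+-assoc _ _ _ ⟨
      (k ∙ ψ x ⊹ q ∙ ψ x) ⊹ r       ≈⟨ K.+-congʳ (K.sym (K.distribʳ _ _ _)) ⟩
      (k ⊹ q) ∙ ψ x ⊹ r             ∎
      where q = coeff _≟_ f y
            r = ⟦ without y f ⟧ ψ
    ... | no _ = begin
      k ∙ ψ x ⊹ ⟦ f ⟧ ψ             ≈⟨ K.+-congˡ (⟦⟧-without y f ψ) ⟩
      k ∙ ψ x ⊹ (q ∙ ψ y ⊹ r)       ≈⟨ x∙yz≈y∙xz (k ∙ ψ x) (q ∙ ψ y) r ⟩
      q ∙ ψ y ⊹ (k ∙ ψ x ⊹ r)       ≈⟨ K.+-congʳ (K.*-congʳ (K.+-identityˡ q)) ⟨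
      (0# ⊹ q) ∙ ψ y ⊹ (k ∙ ψ x ⊹ r) ∎
      where open CommutativeSemigroup K.+-commutativeSemigroup using (x∙yz≈y∙xz)
            q = coeff _≟_ f y
            r = ⟦ without y f ⟧ ψ

    coeff-without : ∀ y (f : Free B) z → coeff _≟_ f z ≈ 0# → coeff _≟_ (without y f) z ≈ 0#
    coeff-without y f z eq with y ≟ z
    ... | yes refl = vanishes f
      where
      vanishes : ∀ f → coeff _≟_ (without y f) y ≈ 0#
      vanishes []            = K.refl
      vanishes ((k , x) ∷ f) with x ≟ y in e
      ... | yes _ = vanishes f
      ... | no _ rewrite e = K.trans (K.+-identityˡ _) (vanishes f)
    ... | no y≢z = K.trans (unchanged f) eq
      where
      unchanged : ∀ f → coeff _≟_ (without y f) z ≈ coeff _≟_ f z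
      unchanged []            = K.refl
      unchanged ((k , x) ∷ f) with x ≟ y
      ... | no _ = K.+-congˡ (unchanged f)
      ... | yes refl with x ≟ z
      ...   | yes y≡z = contradiction y≡z y≢z
      ...   | no _    = K.trans (unchanged f) (K.sym (K.+-identityˡ _))

    -- A formal sum may repeat basis elements, so a list with vanishing coefficients can be
    -- nonempty. All terms at the head's basis element are collected at once and contribute its
    -- total coefficient, which is zero. What remains is `without x f`, shorter but not a subterm,
    -- hence the bound `n` on the length.
    null⇒⟦⟧≈0 : ∀ n (f : Free B) → length f ≤ n → (∀ y → coeff _≟_ f y ≈ 0#) → ∀ ψ → ⟦ f ⟧ ψ ≈ 0#
    null⇒⟦⟧≈0 _       []                _        null ψ = K.refl
    null⇒⟦⟧≈0 (suc n) f@((k , x) ∷ f′) (s≤s le) null ψ = begin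
      ⟦ f ⟧ ψ                                    ≈⟨ ⟦⟧-without x f ψ ⟩
      coeff _≟_ f x ∙ ψ x ⊹ ⟦ without x f ⟧ ψ
        ≈⟨ K.+-cong (K.trans (K.*-congʳ (null x)) (K.zeroˡ _))
                   (null⇒⟦⟧≈0 n (without x f) shorter (λ y → coeff-without x f y (null y)) ψ) ⟩
      0# ⊹ 0#                                    ≈⟨ K.+-identityˡ 0# ⟩
      0#                                         ∎
      where
      shorter : length (without x f) ≤ n
      shorter with x ≟ x
      ... | yes _  = ℕ.≤-trans (without-length x f′) le
      ... | no x≢x = contradiction refl x≢x

    -- The difference `f ++ -ᶠ g` has vanishing coefficients, so every functional kills it. This
    -- makes hypotheses stated with `Equal` usable under any linear map.
    Equal⇒≋ : {f g : Free B} → Equal _≟_ f g → f ≋ g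
    Equal⇒≋ {f} {g} f≈g = ≋-intro λ ψ → let u = ⟦ g ⟧ ψ in begin
      ⟦ f ⟧ ψ                       ≈⟨ K.+-identityʳ _ ⟨
      ⟦ f ⟧ ψ ⊹ 0#                  ≈⟨ K.+-congˡ (K.-‿inverseˡ _) ⟨
      ⟦ f ⟧ ψ ⊹ (K.- u ⊹ u)         ≈⟨ K.+-assoc _ _ _ ⟨
      (⟦ f ⟧ ψ ⊹ K.- u) ⊹ u         ≈⟨ K.+-congʳ (minus ψ) ⟨
      ⟦ f ++ -ᶠ g ⟧ ψ ⊹ u           ≈⟨ K.+-congʳ (null⇒⟦⟧≈0 _ (f ++ -ᶠ g) ℕ.≤-refl null ψ) ⟩
      0# ⊹ u                        ≈⟨ K.+-identityˡ _ ⟩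
      u                             ∎
      where
      minus : ∀ φ → ⟦ f ++ -ᶠ g ⟧ φ ≈ ⟦ f ⟧ φ ⊹ K.- ⟦ g ⟧ φ
      minus φ = K.trans (⟦⟧-++ f (-ᶠ g) φ) (K.+-congˡ (K.trans (⟦⟧-· (K.- 1#) g φ) (-1*x≈-x _)))
      null : ∀ y → coeff _≟_ (f ++ -ᶠ g) y ≈ 0#
      null y = begin
        coeff _≟_ (f ++ -ᶠ g) y            ≈⟨ coeff≈⟦⟧ (f ++ -ᶠ g) y ⟩
        ⟦ f ++ -ᶠ g ⟧ (δ y)                ≈⟨ minus (δ y) ⟩
        ⟦ f ⟧ (δ y) ⊹ K.- ⟦ g ⟧ (δ y)      ≈⟨ K.+-cong (coeff≈⟦⟧ f y) (K.-‿cong (coeff≈⟦⟧ g y)) ⟨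
        coeff _≟_ f y ⊹ K.- coeff _≟_ g y  ≈⟨ K.+-congʳ (f≈g y) ⟩
        coeff _≟_ g y ⊹ K.- coeff _≟_ g y  ≈⟨ K.-‿inverseʳ _ ⟩
        0#                                 ∎

-- Spans and linear maps

module SpanProperties {c ℓ} (K : CommutativeRing c ℓ) where

  open FreeModules K
  open FreeModuleProperties K
  private module K = CommutativeRing K

  module _ {B : Set b} (_≟_ : DecidableEquality B) {p} {G : Pred (Free B) p} where

    span-resp : ∀ {x y} → x ≋ y → x ∈ Span _≟_ G → y ∈ Span _≟_ G
    span-resp {x} {y} x≋y = resp {x = x} {y} (≋⇒Equal _≟_ x≋y)

    span-concatMap : {A : Set a} (F : A → Free B) (xs : List A) →
                     (∀ {x} → x ∈ₗ xs → F x ∈ Span _≟_ G) →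
                     concatMap F xs ∈ Span _≟_ G
    span-concatMap F []       F∈ = 0∈
    span-concatMap F (x ∷ xs) F∈ = +∈ (F∈ (here refl)) (span-concatMap F xs (F∈ ∘ there))

  linear-· : {A : Set a} {B : Set b} (φ : A → Free B) (k : K.Carrier) (x : Free A) →
             k · linear φ x ≋ linear φ (k · x)
  linear-· φ k x =
    ≋-intro λ ψ → K.trans (⟦⟧-· k (linear φ x) ψ) (K.trans (K.*-congˡ (⟦⟧-linear φ x ψ))
    (K.sym (K.trans (⟦⟧-linear φ (k · x) ψ) (⟦⟧-· k x _))))

  -- Reduces closure of a span under products, coproduct, projections, antipode and `embed` to its
  -- generators. The `resp` case asks that `linear φ` respect equality of coefficients, which is
  -- what `Equal⇒≋` provides.
  span-linear : {A : Set a} {B : Set b} (_≟ᴬ_ : DecidableEquality A) (_≟ᴮ_ : DecidableEquality B)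
                {G : Pred (Free A) p} {H : Pred (Free B) p′} (φ : A → Free B) →
                (∀ {x} → x ∈ G → linear φ x ∈ Span _≟ᴮ_ H) →
                ∀ {x} → x ∈ Span _≟ᴬ_ G → linear φ x ∈ Span _≟ᴮ_ H
  span-linear _≟ᴬ_ _≟ᴮ_ φ G∈ (gen x∈)  = G∈ x∈
  span-linear _≟ᴬ_ _≟ᴮ_ φ G∈ 0∈        = 0∈
  span-linear _≟ᴬ_ _≟ᴮ_ φ G∈ (+∈ {x} {y} x∈ y∈) =
    subst (_∈ Span _≟ᴮ_ _) (sym (List.concatMap-++ _ x y))
      (+∈ (span-linear _≟ᴬ_ _≟ᴮ_ φ G∈ x∈) (span-linear _≟ᴬ_ _≟ᴮ_ φ G∈ y∈))
  span-linear _≟ᴬ_ _≟ᴮ_ φ G∈ (·∈ k {x} x∈) =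
    span-resp _≟ᴮ_ (linear-· φ k x) (·∈ k (span-linear _≟ᴬ_ _≟ᴮ_ φ G∈ x∈))
  span-linear _≟ᴬ_ _≟ᴮ_ φ G∈ (resp {x} {y} x≈y x∈) =
    span-resp _≟ᴮ_
      (≋-intro λ ψ → K.trans (⟦⟧-linear φ x ψ)
        (K.trans (at (Equal⇒≋ _≟ᴬ_ {x} {y} x≈y) _) (K.sym (⟦⟧-linear φ y ψ))))
      (span-linear _≟ᴬ_ _≟ᴮ_ φ G∈ x∈)

-- Duplicate-free lists up to rearrangement

unique-↭ : {xs ys : List A} → Unique xs → Unique ys →
           (∀ {x} → x ∈ₗ xs → x ∈ₗ ys) → (∀ {x} → x ∈ₗ ys → x ∈ₗ xs) → xs ↭ ys
unique-↭ u v xs⊆ys ys⊆xs = ∼bag⇒↭ (unique∧set⇒bag u v (mk⇔ xs⊆ys ys⊆xs))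

map-unique : (f : A → B) {xs : List A} → (∀ {x y} → x ∈ₗ xs → y ∈ₗ xs → f x ≡ f y → x ≡ y) →
             Unique xs → Unique (map f xs)
map-unique f inj []       = []
map-unique f inj (x∉ ∷ u) =
  All.map⁺ (All.tabulate λ y∈ eq → All.lookup x∉ y∈ (inj (here refl) (there y∈) eq)) ∷
  map-unique f (λ x∈ y∈ → inj (there x∈) (there y∈)) u

map-cong-keys : (f : A → C) (g : B → C) (key : A → T) (key′ : B → T) (xs : List A) (ys : List B) →
                (∀ {x y} → x ∈ₗ xs → y ∈ₗ ys → key x ≡ key′ y → f x ≡ g y) →
                map key xs ≡ map key′ ys → map f xs ≡ map g ys
map-cong-keys f g key key′ []       []       compat eq = refl
map-cong-keys f g key key′ (x ∷ xs) (y ∷ ys) compat eq =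
  cong₂ _∷_ (compat (here refl) (here refl) (List.∷-injectiveˡ eq))
            (map-cong-keys f g key key′ xs ys (λ x∈ y∈ → compat (there x∈) (there y∈))
                           (List.∷-injectiveʳ eq))

-- The keys match xs bijectively with ys.
bijection-↭ : {xs : List A} {ys : List B} (f : A → C) (g : B → C) (key : A → T) (key′ : B → T) →
              Unique xs → Unique ys →
              (∀ {x x′} → x ∈ₗ xs → x′ ∈ₗ xs → key x ≡ key x′ → x ≡ x′) →
              (∀ {y y′} → y ∈ₗ ys → y′ ∈ₗ ys → key′ y ≡ key′ y′ → y ≡ y′) →
              (∀ {x} → x ∈ₗ xs → ∃ λ y → y ∈ₗ ys × key x ≡ key′ y) →
              (∀ {y} → y ∈ₗ ys → ∃ λ x → x ∈ₗ xs × key x ≡ key′ y) →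
              (∀ {x y} → x ∈ₗ xs → y ∈ₗ ys → key x ≡ key′ y → f x ≡ g y) →
              map f xs ↭ map g ys
bijection-↭ {xs = xs} {ys} f g key key′ uxs uys inj inj′ to from compat =
  ↭-trans (↭.map⁺ f xs↭zs)
          (↭-reflexive (map-cong-keys f g key key′ zs ys
            (λ x∈ → compat (↭.∈-resp-↭ (↭-sym xs↭zs) x∈)) (sym keys≡)))
  where
  keys : map key xs ↭ map key′ ys
  keys = unique-↭ (map-unique key inj uxs) (map-unique key′ inj′ uys)
    (λ k∈ → case ∈.∈-map⁻ key k∈ of λ { (_ , x∈ , refl) → case to x∈ of λ { (_ , y∈ , eq) →
      subst (_∈ₗ map key′ ys) (sym eq) (∈.∈-map⁺ key′ y∈) } })
    (λ k∈ → case ∈.∈-map⁻ key′ k∈ of λ { (_ , y∈ , refl) → case from y∈ of λ { (_ , x∈ , eq) →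
      subst (_∈ₗ map key xs) eq (∈.∈-map⁺ key x∈) } })
  -- The elements of `xs` and `ys` have different types, so only their keys can be compared. The
  -- rearrangement of the keys is lifted to a rearrangement `zs` of `xs` whose keys agree with those
  -- of `ys` entry by entry.
  inv = ↭.↭-map-inv key keys
  zs = proj₁ inv
  keys≡ = proj₁ (proj₂ inv)
  xs↭zs = proj₂ (proj₂ inv)

∈-concatMap-∃⁺ : (F : A → List B) {xs : List A} {x : A} {y : B} → x ∈ₗ xs → y ∈ₗ F x →
             y ∈ₗ concatMap F xs
∈-concatMap-∃⁺ F x∈ y∈ = ∈.∈-concat⁺′ y∈ (∈.∈-map⁺ F x∈)

∈-concatMap-∃⁻ : (F : A → List B) (xs : List A) {y : B} → y ∈ₗ concatMap F xs →
                 ∃ λ x → x ∈ₗ xs × y ∈ₗ F x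
∈-concatMap-∃⁻ F xs y∈ with ∈.∈-concat⁻′ (map F xs) y∈
... | _ , y∈F , F∈ with ∈.∈-map⁻ F F∈
...   | x , x∈ , refl = x , x∈ , y∈F

concatMap-unique : (F : A → List B) {xs : List A} → Unique xs → (∀ {x} → x ∈ₗ xs → Unique (F x)) →
                   (∀ {x x′ y} → x ∈ₗ xs → x′ ∈ₗ xs → y ∈ₗ F x → y ∈ₗ F x′ → x ≡ x′) →
                   Unique (concatMap F xs)
concatMap-unique F []       uF disjoint = []
concatMap-unique F {x ∷ xs} (x∉ ∷ u) uF disjoint =
  Unique.++⁺ (uF (here refl))
             (concatMap-unique F u (uF ∘ there) λ x∈ y∈ → disjoint (there x∈) (there y∈))
             λ { (y∈ , y∈′) → case ∈-concatMap-∃⁻ F xs y∈′ of λ { (z , z∈ , y∈Fz) →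
               All.lookup x∉ z∈ (disjoint (here refl) (there z∈) y∈ y∈Fz) } }

∈-mapMaybe⁺ : (f : A → Maybe B) (xs : List A) {x : A} {y : B} → x ∈ₗ xs → f x ≡ just y →
              y ∈ₗ mapMaybe f xs
∈-mapMaybe⁺ f (x ∷ xs) (here refl) eq rewrite eq = here refl
∈-mapMaybe⁺ f (x ∷ xs) (there x∈)  eq with f x
... | just _  = there (∈-mapMaybe⁺ f xs x∈ eq)
... | nothing = ∈-mapMaybe⁺ f xs x∈ eq

∈-mapMaybe⁻ : (f : A → Maybe B) (xs : List A) {y : B} → y ∈ₗ mapMaybe f xs →
              ∃ λ x → x ∈ₗ xs × f x ≡ just y
∈-mapMaybe⁻ f (x ∷ xs) y∈ with f x in eq
∈-mapMaybe⁻ f (x ∷ xs) y∈          | nothing with ∈-mapMaybe⁻ f xs y∈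
... | z , z∈ , eq′ = z , there z∈ , eq′
∈-mapMaybe⁻ f (x ∷ xs) (here refl) | just _ = x , here refl , eq
∈-mapMaybe⁻ f (x ∷ xs) (there y∈)  | just _ with ∈-mapMaybe⁻ f xs y∈
... | z , z∈ , eq′ = z , there z∈ , eq′

mapMaybe-unique : (f : A → Maybe B) → (∀ {x x′ y} → f x ≡ just y → f x′ ≡ just y → x ≡ x′) →
                  {xs : List A} → Unique xs → Unique (mapMaybe f xs)
mapMaybe-unique f inj [] = []
mapMaybe-unique f inj {x ∷ xs} (x∉ ∷ u) with f x in eq
... | nothing = mapMaybe-unique f inj u
... | just y  = All.tabulate (λ { z∈ refl → case ∈-mapMaybe⁻ f xs z∈ of λ { (x′ , x′∈ , eq′) →
                  All.lookup x∉ x′∈ (inj eq eq′) } }) ∷ mapMaybe-unique f inj u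

filter-map : {P : Pred B p} (P? : Decidable P) (f : A → B) (xs : List A) →
             filter P? (map f xs) ≡ map f (filter (P? ∘ f) xs)
filter-map P? f []       = refl
filter-map P? f (x ∷ xs) with does (P? (f x))
... | true  = cong (f x ∷_) (filter-map P? f xs)
... | false = filter-map P? f xs

++-leftSwap : (us vs ws : List A) → us ++ vs ++ ws ↭ vs ++ us ++ ws
++-leftSwap us vs ws =
  ↭-trans (↭-reflexive (sym (List.++-assoc us vs ws)))
          (↭-trans (↭.++⁺ʳ ws (↭.++-comm us vs)) (↭-reflexive (List.++-assoc vs us ws)))

concatMap-swap : (f : A → B → C) (xs : List A) (ys : List B) →
                 concatMap (λ x → map (f x) ys) xs ↭ concatMap (λ y → map (λ x → f x y) xs) ys
concatMap-swap f xs []       = ↭-reflexive (empty xs)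
  where
  empty : ∀ (xs : List _) → concatMap (λ x → map (f x) []) xs ≡ []
  empty []       = refl
  empty (x ∷ xs) = empty xs
concatMap-swap f xs (y ∷ ys) =
  ↭-trans (peel xs) (↭.++⁺ˡ (map (λ x → f x y) xs) (concatMap-swap f xs ys))
  where
  peel : ∀ xs → concatMap (λ x → f x y ∷ map (f x) ys) xs ↭
                map (λ x → f x y) xs ++ concatMap (λ x → map (f x) ys) xs
  peel []       = ↭-refl
  peel (x ∷ xs) =
    prep (f x y) (↭-trans (↭.++⁺ˡ (map (f x) ys) (peel xs))
                         (++-leftSwap (map (f x) ys) (map (λ x → f x y) xs) _))

-- Blocks of a word and their colors

++-cancel-length : {xs xs′ ys ys′ : List A} → length xs ≡ length xs′ → xs ++ ys ≡ xs′ ++ ys′ →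
                   xs ≡ xs′ × ys ≡ ys′
++-cancel-length {xs = []}     {[]}      len eq = refl , eq
++-cancel-length {xs = x ∷ xs} {y ∷ xs′} len eq
  with ++-cancel-length (ℕ.suc-injective len) (List.∷-injectiveʳ eq)
... | e , e′ = cong₂ _∷_ (List.∷-injectiveˡ eq) e , e′

take-length-++ : (xs ys : List A) → take (length xs) (xs ++ ys) ≡ xs
take-length-++ []       ys = refl
take-length-++ (x ∷ xs) ys = cong (x ∷_) (take-length-++ xs ys)

drop-length-++ : (xs ys : List A) → drop (length xs) (xs ++ ys) ≡ ys
drop-length-++ []       ys = refl
drop-length-++ (x ∷ xs) ys = drop-length-++ xs ys

blocks-concat : (Bs : List (List A)) → blocks (map length Bs) (concat Bs) ≡ Bs
blocks-concat []       = refl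
blocks-concat (b ∷ Bs) =
  cong₂ _∷_ (take-length-++ b _)
            (trans (cong (blocks (map length Bs)) (drop-length-++ b _)) (blocks-concat Bs))

concat-blocks : (I : List ℕ) (xs : List A) → length xs ≡ sum I → concat (blocks I xs) ≡ xs
concat-blocks []      []       eq = refl
concat-blocks (k ∷ I) xs       eq =
  trans (cong (take k xs ++_) (concat-blocks I (drop k xs)
          (trans (List.length-drop k xs) (trans (cong (_∸ k) eq) (ℕ.m+n∸m≡n k (sum I))))))
        (List.take++drop≡id k xs)

length-blocks : (I : List ℕ) (xs : List A) → length xs ≡ sum I → map length (blocks I xs) ≡ I
length-blocks []      xs eq = refl
length-blocks (k ∷ I) xs eq =
  cong₂ _∷_ (trans (List.length-take k xs) (ℕ.m≤n⇒m⊓n≡m (subst (k ≤_) (sym eq) (ℕ.m≤m+n k (sum I)))))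
            (length-blocks I (drop k xs)
              (trans (List.length-drop k xs) (trans (cong (_∸ k) eq) (ℕ.m+n∸m≡n k (sum I)))))

blocks-concat-++ : (Bs : List (List A)) (J : List ℕ) (ys : List A) →
                   blocks (map length Bs ++ J) (concat Bs ++ ys) ≡ Bs ++ blocks J ys
blocks-concat-++ []       J ys = refl
blocks-concat-++ (b ∷ Bs) J ys rewrite List.++-assoc b (concat Bs) ys =
  cong₂ _∷_ (take-length-++ b _)
            (trans (cong (blocks (map length Bs ++ J)) (drop-length-++ b _)) (blocks-concat-++ Bs J ys))

-- Once `I` and `xs` are rewritten as the lengths and the concatenation of the blocks of `xs`, every
-- `take` ends exactly at a block boundary and `blocks-concat-++` applies.
blocks-++ : (I J : List ℕ) (xs ys : List A) → length xs ≡ sum I →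
            blocks (I ++ J) (xs ++ ys) ≡ blocks I xs ++ blocks J ys
blocks-++ I J xs ys eq =
  trans (cong₂ (λ I′ xs′ → blocks (I′ ++ J) (xs′ ++ ys))
               (sym (length-blocks I xs eq)) (sym (concat-blocks I xs eq)))
        (blocks-concat-++ (blocks I xs) J ys)

blocks-map : (f : A → B) (I : List ℕ) (xs : List A) →
             blocks I (map f xs) ≡ map (map f) (blocks I xs)
blocks-map f []      xs = refl
blocks-map f (k ∷ I) xs =
  cong₂ _∷_ (List.take-map k xs)
            (trans (cong (blocks I) (List.drop-map k xs)) (blocks-map f I (drop k xs)))

spread : List ℕ → List A → List A
spread I cs = concat (zipWith replicate I cs)

length-spread : (I : List ℕ) (cs : List A) → length I ≡ length cs → length (spread I cs) ≡ sum I
length-spread []      []       eq = refl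
length-spread (k ∷ I) (c ∷ cs) eq =
  trans (List.length-++ (replicate k c))
        (cong₂ _+_ (List.length-replicate k) (length-spread I cs (ℕ.suc-injective eq)))

spread-++ : (I J : List ℕ) (cs ds : List A) → length I ≡ length cs →
            spread (I ++ J) (cs ++ ds) ≡ spread I cs ++ spread J ds
spread-++ []      J []       ds eq = refl
spread-++ (k ∷ I) J (c ∷ cs) ds eq =
  trans (cong (replicate k c ++_) (spread-++ I J cs ds (ℕ.suc-injective eq)))
        (sym (List.++-assoc (replicate k c) _ _))

-- The block form of a colored word. Selecting letters acts on each block separately and keeps its
-- color, which is invisible on the flat lists of letters and colors.
paint : List A → List (List B) → List (B × A)
paint cs Bs = concat (zipWith (λ b c → map (_, c) b) Bs cs)

zip-concat : (Bs : List (List B)) (cs : List A) → length Bs ≡ length cs →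
             zip (concat Bs) (spread (map length Bs) cs) ≡ paint cs Bs
zip-concat []       []       eq = refl
zip-concat (b ∷ Bs) (c ∷ cs) eq =
  trans (prefix b) (cong (map (_, c) b ++_) (zip-concat Bs cs (ℕ.suc-injective eq)))
  where
  prefix : ∀ b → zip (b ++ concat Bs) (replicate (length b) c ++ spread (map length Bs) cs) ≡
                 map (_, c) b ++ zip (concat Bs) (spread (map length Bs) cs)
  prefix []      = refl
  prefix (x ∷ b) = cong ((x , c) ∷_) (prefix b)

letters-paint : (cs : List A) (Bs : List (List B)) → length Bs ≡ length cs →
                map proj₁ (paint cs Bs) ≡ concat Bs
letters-paint []       []       eq = refl
letters-paint (c ∷ cs) (b ∷ Bs) eq =
  trans (List.map-++ proj₁ (map (_, c) b) _)
        (cong₂ _++_ (trans (sym (List.map-∘ b)) (List.map-id b)) (letters-paint cs Bs (ℕ.suc-injective eq)))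

colors-paint : (cs : List A) (Bs : List (List B)) → length Bs ≡ length cs →
               map proj₂ (paint cs Bs) ≡ spread (map length Bs) cs
colors-paint []       []       eq = refl
colors-paint (c ∷ cs) (b ∷ Bs) eq =
  trans (List.map-++ proj₂ (map (_, c) b) _)
        (cong₂ _++_ (trans (sym (List.map-∘ b)) (map-const b)) (colors-paint cs Bs (ℕ.suc-injective eq)))
  where
  map-const : ∀ b → map (λ _ → c) b ≡ replicate (length b) c
  map-const []      = refl
  map-const (_ ∷ b) = cong (c ∷_) (map-const b)

-- Cutting the letters at a threshold

low : ℕ → List ℕ → List ℕ
low i = filter (ℕ._<? i)

-- Lowering by `i` is what standardization does to the large letters of a permutation; see
-- `std-high`.
high : ℕ → List ℕ → List ℕ
high i xs = map (_∸ i) (filter (i ℕ.≤?_) xs)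

lows highs : ℕ → List (List ℕ) → List (List ℕ)
lows  i = map (low i)
highs i = map (high i)

low× high× : ℕ → List (ℕ × A) → List (ℕ × A)
low×  i P = filter ((ℕ._<? i) ∘ proj₁) P
high× i P = map (λ { (x , c) → x ∸ i , c }) (filter ((i ℕ.≤?_) ∘ proj₁) P)

low×-paint : ∀ i (cs : List A) Bs → low× i (paint cs Bs) ≡ paint cs (lows i Bs)
low×-paint i []       []       = refl
low×-paint i []       (b ∷ Bs) = refl
low×-paint i (c ∷ cs) []       = refl
low×-paint i (c ∷ cs) (b ∷ Bs) =
  trans (List.filter-++ _ (map (_, c) b) _)
        (cong₂ _++_ (filter-map ((ℕ._<? i) ∘ proj₁) (_, c) b) (low×-paint i cs Bs))

high×-paint : ∀ i (cs : List A) Bs → high× i (paint cs Bs) ≡ paint cs (highs i Bs)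
high×-paint i []       []       = refl
high×-paint i []       (b ∷ Bs) = refl
high×-paint i (c ∷ cs) []       = refl
high×-paint i (c ∷ cs) (b ∷ Bs) =
  trans (cong (map _) (List.filter-++ _ (map (_, c) b) _))
  (trans (List.map-++ _ (filter _ (map (_, c) b)) _)
         (cong₂ _++_ block (high×-paint i cs Bs)))
  where
  block : high× i (map (_, c) b) ≡ map (_, c) (high i b)
  block = trans (cong (map _) (filter-map ((i ℕ.≤?_) ∘ proj₁) (_, c) b))
                (trans (sym (List.map-∘ (filter (i ℕ.≤?_) b))) (List.map-∘ (filter (i ℕ.≤?_) b)))

low-map-proj₁ : ∀ i (P : List (ℕ × A)) → map proj₁ (low× i P) ≡ low i (map proj₁ P)
low-map-proj₁ i P = sym (filter-map (ℕ._<? i) proj₁ P)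

high-map-proj₁ : ∀ i (P : List (ℕ × A)) → map proj₁ (high× i P) ≡ high i (map proj₁ P)
high-map-proj₁ i P =
  trans (trans (sym (List.map-∘ Q)) (List.map-∘ Q)) (cong (map (_∸ i)) (sym (filter-map (i ℕ.≤?_) proj₁ P)))
  where Q = filter ((i ℕ.≤?_) ∘ proj₁) P

-- Inverse to cutting: in an increasing block the letters below `i` precede the others, so the block
-- is its low half followed by its high half raised again by `i`.
merge : ℕ → List (List ℕ) → List (List ℕ) → List (List ℕ)
merge i = zipWith λ a c → a ++ map (i +_) c

Sorted : List ℕ → Set
Sorted = Linked _<_

Sorted⇒AllPairs : ∀ {xs} → Sorted xs → AllPairs _<_ xs
Sorted⇒AllPairs = Linked.Linked⇒AllPairs ℕ.<-trans

low-++-high : ∀ i {b} → Sorted b → low i b ++ map (i +_) (high i b) ≡ b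
low-++-high i {b} s = trans (cong (low i b ++_) (shift-high b)) (partition (Sorted⇒AllPairs s))
  where
  shift-high : ∀ b → map (i +_) (high i b) ≡ filter (i ℕ.≤?_) b
  shift-high b = trans (sym (List.map-∘ (filter (i ℕ.≤?_) b)))
    (List.map-id-local (All.map ℕ.m+[n∸m]≡n (All.all-filter (i ℕ.≤?_) b)))
  partition : ∀ {b} → AllPairs _<_ b → low i b ++ filter (i ℕ.≤?_) b ≡ b
  partition [] = refl
  partition {x ∷ b} (x< ∷ s) with x ℕ.<? i
  ... | yes x<i = trans
    (cong₂ _++_ (List.filter-accept (ℕ._<? i) {xs = b} x<i)
                (List.filter-reject (i ℕ.≤?_) {xs = b} (ℕ.<⇒≱ x<i)))
    (cong (x ∷_) (partition s))
  ... | no  x≮i = cong₂ _++_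
    (List.filter-none (ℕ._<? i) {x ∷ b} (x≮i ∷ All.map (λ x<y y<i → x≮i (ℕ.<-trans x<y y<i)) x<))
    (List.filter-all (i ℕ.≤?_) {x ∷ b} (i≤x ∷ All.map (λ x<y → ℕ.≤-trans i≤x (ℕ.<⇒≤ x<y)) x<))
    where i≤x = ℕ.≮⇒≥ x≮i

merge-lows-highs : ∀ i {Bs} → All Sorted Bs → merge i (lows i Bs) (highs i Bs) ≡ Bs
merge-lows-highs i []       = refl
merge-lows-highs i (s ∷ ss) = cong₂ _∷_ (low-++-high i s) (merge-lows-highs i ss)

low-join : ∀ i {a} c → All (_< i) a → low i (a ++ map (i +_) c) ≡ a
low-join i {a} c a<i = trans (List.filter-++ (ℕ._<? i) a _)
  (trans (cong₂ _++_ (List.filter-all (ℕ._<? i) a<i)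
                     (List.filter-none (ℕ._<? i) (All.map⁺ (All.universal (λ x → ℕ.m+n≮m i x) c))))
         (List.++-identityʳ a))

high-join : ∀ i {a} c → All (_< i) a → high i (a ++ map (i +_) c) ≡ c
high-join i {a} c a<i = trans (cong (map (_∸ i)) (trans (List.filter-++ (i ℕ.≤?_) a _)
  (cong₂ _++_ (List.filter-none (i ℕ.≤?_) (All.map ℕ.<⇒≱ a<i))
              (List.filter-all (i ℕ.≤?_) (All.map⁺ (All.universal (ℕ.m≤m+n i) c))))))
  (trans (sym (List.map-∘ c)) (List.map-id-local (All.universal (ℕ.m+n∸m≡n i) c)))

lows-merge : ∀ i {As} Cs → All (All (_< i)) As → length As ≡ length Cs → lows i (merge i As Cs) ≡ As
lows-merge i {[]}    []       []         eq = refl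
lows-merge i         (c ∷ Cs) (a<i ∷ As) eq =
  cong₂ _∷_ (low-join i c a<i) (lows-merge i Cs As (ℕ.suc-injective eq))

highs-merge : ∀ i {As} Cs → All (All (_< i)) As → length As ≡ length Cs →
              highs i (merge i As Cs) ≡ Cs
highs-merge i {[]}    []       []         eq = refl
highs-merge i         (c ∷ Cs) (a<i ∷ As) eq =
  cong₂ _∷_ (high-join i c a<i) (highs-merge i Cs As (ℕ.suc-injective eq))

-- Merging alternates low and high halves block by block, so the two sides agree only up to
-- rearrangement. That is enough to see that a glued word is a permutation.
concat-merge : ∀ i As Cs → length As ≡ length Cs →
               concat (merge i As Cs) ↭ concat As ++ map (i +_) (concat Cs)
concat-merge i []       []       eq = ↭-refl
concat-merge i (a ∷ As) (c ∷ Cs) eq = begin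
  (a ++ c′) ++ concat (merge i As Cs)
    ↭⟨ ↭.++⁺ˡ (a ++ c′) (concat-merge i As Cs (ℕ.suc-injective eq)) ⟩
  (a ++ c′) ++ concat As ++ Cs′             ≡⟨ List.++-assoc a c′ _ ⟩
  a ++ c′ ++ concat As ++ Cs′               ↭⟨ ↭.++⁺ˡ a (++-leftSwap c′ (concat As) Cs′) ⟩
  a ++ concat As ++ c′ ++ Cs′               ≡⟨ List.++-assoc a (concat As) _ ⟨
  (a ++ concat As) ++ c′ ++ Cs′
    ≡⟨ cong ((a ++ concat As) ++_) (List.map-++ (i +_) c (concat Cs)) ⟨
  (a ++ concat As) ++ map (i +_) (c ++ concat Cs) ∎
  where open ↭.PermutationReasoning
        c′ = map (i +_) c
        Cs′ = map (i +_) (concat Cs)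

length-merge : ∀ i As Cs → map length (merge i As Cs) ≡ zipWith _+_ (map length As) (map length Cs)
length-merge i []       Cs       = refl
length-merge i (a ∷ As) []       = refl
length-merge i (a ∷ As) (c ∷ Cs) =
  cong₂ _∷_ (trans (List.length-++ a) (cong (length a +_) (List.length-map (i +_) c))) (length-merge i As Cs)

low-sorted : ∀ i {b} → Sorted b → Sorted (low i b)
low-sorted i = Linked.filter⁺ (ℕ._<? i) ℕ.<-trans

high-sorted : ∀ i {b} → Sorted b → Sorted (high i b)
high-sorted i {b} s = lower (All.all-filter (i ℕ.≤?_) b) (Linked.filter⁺ (i ℕ.≤?_) ℕ.<-trans s)
  where
  lower : ∀ {b} → All (i ≤_) b → Sorted b → Sorted (map (_∸ i) b)
  lower _              []        = []
  lower _              [-]       = [-]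
  lower (i≤x ∷ i≤) (x<y ∷ s) = ℕ.∸-monoˡ-< x<y i≤x ∷ lower i≤ s

join-sorted : ∀ i {a c} → All (_< i) a → Sorted a → Sorted c → Sorted (a ++ map (i +_) c)
join-sorted i {a} {c} a<i sa sc = Linked.AllPairs⇒Linked (AllPairs.++⁺ (Sorted⇒AllPairs sa)
  (AllPairs.map⁺ (AllPairs.map (ℕ.+-monoʳ-< i) (Sorted⇒AllPairs sc)))
  (All.map (λ x<i → All.map⁺ (All.universal (λ y → ℕ.<-≤-trans x<i (ℕ.m≤m+n i y)) c)) a<i))

merge-sorted : ∀ i {As Cs} → All (All (_< i)) As → All Sorted As → All Sorted Cs →
               All Sorted (merge i As Cs)
merge-sorted i _          []        _         = []
merge-sorted i (_ ∷ _)    (_ ∷ _)   []        = []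
merge-sorted i (a<i ∷ As<i) (sa ∷ sas) (sc ∷ scs) =
  join-sorted i a<i sa sc ∷ merge-sorted i As<i sas scs

upTo-+ : ∀ i k → upTo (i + k) ≡ upTo i ++ map (i +_) (upTo k)
upTo-+ zero    k = sym (List.map-id (upTo k))
upTo-+ (suc i) k = cong (0 ∷_) (begin
  applyUpTo suc (i + k)                          ≡⟨ List.map-upTo suc (i + k) ⟨
  map suc (upTo (i + k))                         ≡⟨ cong (map suc) (upTo-+ i k) ⟩
  map suc (upTo i ++ map (i +_) (upTo k))        ≡⟨ List.map-++ suc (upTo i) _ ⟩
  map suc (upTo i) ++ map suc (map (i +_) (upTo k))
    ≡⟨ cong₂ _++_ (List.map-upTo suc i) (sym (List.map-∘ (upTo k))) ⟩
  applyUpTo suc i ++ map (suc i +_) (upTo k)     ∎)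
  where open ≡-Reasoning

upTo-< : ∀ i → All (_< i) (upTo i)
upTo-< i = All.applyUpTo⁺₁ id i id

low-upTo : ∀ i k → low i (upTo (i + k)) ≡ upTo i
low-upTo i k = trans (cong (low i) (upTo-+ i k)) (low-join i (upTo k) (upTo-< i))

high-upTo : ∀ i k → high i (upTo (i + k)) ≡ upTo k
high-upTo i k = trans (cong (high i) (upTo-+ i k)) (high-join i (upTo k) (upTo-< i))

low-↭ : ∀ i k {xs} → xs ↭ upTo (i + k) → low i xs ↭ upTo i
low-↭ i k p = ↭-trans (↭.filter-↭ (ℕ._<? i) p) (↭-reflexive (low-upTo i k))

high-↭ : ∀ i k {xs} → xs ↭ upTo (i + k) → high i xs ↭ upTo k
high-↭ i k p = ↭-trans (↭.map⁺ (_∸ i) (↭.filter-↭ (i ℕ.≤?_) p)) (↭-reflexive (high-upTo i k))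

-- Standardization

rankᴸ : List ℕ → ℕ → ℕ
rankᴸ xs x = length (filter (ℕ._<? x) xs)

std : List (ℕ × A) → List (ℕ × A)
std P = map (λ { (x , c) → rankᴸ (map proj₁ P) x , c }) P

rank-↭ : ∀ {xs ys} → xs ↭ ys → ∀ x → rankᴸ xs x ≡ rankᴸ ys x
rank-↭ p x = ↭.↭-length (↭.filter-↭ (ℕ._<? x) p)

rank-upTo : ∀ {n x} → x < n → rankᴸ (upTo n) x ≡ x
rank-upTo {n} {x} x<n = begin
  rankᴸ (upTo n) x             ≡⟨ cong (λ m → rankᴸ (upTo m) x) (ℕ.m+[n∸m]≡n (ℕ.<⇒≤ x<n)) ⟨
  rankᴸ (upTo (x + (n ∸ x))) x ≡⟨ cong length (low-upTo x (n ∸ x)) ⟩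
  length (upTo x)              ≡⟨ List.length-upTo x ⟩
  x                            ∎
  where open ≡-Reasoning

-- Among the letters below `n`, each occurring once, exactly `x` are smaller than `x`: rank and
-- letter coincide.
std-fixed : ∀ {n} (P : List (ℕ × A)) → map proj₁ P ↭ upTo n → std P ≡ P
std-fixed {n = n} P p = List.map-id-local (All.map
  (λ { {x , c} x<n → cong (_, c) (trans (rank-↭ p x) (rank-upTo x<n)) })
  (All.map⁻ (↭.All-resp-↭ (↭-sym p) (upTo-< n))))

rank-shift : ∀ i xs x → rankᴸ (map (i +_) xs) (i + x) ≡ rankᴸ xs x
rank-shift i xs x = trans (cong length (filter-map (ℕ._<? (i + x)) (i +_) xs))
  (trans (List.length-map (i +_) (filter (λ y → i + y ℕ.<? i + x) xs)) (cong length
    (List.filter-≐ (λ y → i + y ℕ.<? i + x) (ℕ._<? x) (ℕ.+-cancelˡ-< i _ _ , ℕ.+-monoʳ-< i) xs)))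

std-shift : ∀ i (P : List (ℕ × A)) → std (map (λ { (x , c) → i + x , c }) P) ≡ std P
std-shift i P = trans (sym (List.map-∘ P)) (List.map-cong
  (λ { (x , c) → cong (_, c) (trans (cong (λ xs → rankᴸ xs (i + x)) shifted) (rank-shift i (map proj₁ P) x)) }) P)
  where
  shifted : map proj₁ (map (λ { (x , c) → i + x , c }) P) ≡ map (i +_) (map proj₁ P)
  shifted = trans (sym (List.map-∘ P)) (List.map-∘ P)

std-low : ∀ i k (P : List (ℕ × A)) → map proj₁ P ↭ upTo (i + k) → std (low× i P) ≡ low× i P
std-low i k P p = std-fixed (low× i P) (↭-trans (↭-reflexive (low-map-proj₁ i P)) (low-↭ i k p))

-- The letters from `i` on are a translate by `i` of a permutation of `upTo k`. Ranks ignore the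
-- translation and fix the permutation.
std-high : ∀ i k (P : List (ℕ × A)) → map proj₁ P ↭ upTo (i + k) →
           std (filter ((i ℕ.≤?_) ∘ proj₁) P) ≡ high× i P
std-high i k P p = begin
  std Q                  ≡⟨ cong std unlower ⟨
  std (map _ (high× i P)) ≡⟨ std-shift i (high× i P) ⟩
  std (high× i P)
    ≡⟨ std-fixed (high× i P) (↭-trans (↭-reflexive (high-map-proj₁ i P)) (high-↭ i k p)) ⟩
  high× i P              ∎
  where
  open ≡-Reasoning
  Q = filter ((i ℕ.≤?_) ∘ proj₁) P
  unlower : map (λ { (x , c) → i + x , c }) (high× i P) ≡ Q
  unlower = trans (sym (List.map-∘ Q)) (List.map-id-local (All.map
    (λ { {x , c} i≤x → cong (_, c) (ℕ.m+[n∸m]≡n i≤x) }) (All.all-filter ((i ℕ.≤?_) ∘ proj₁) P)))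

rank-∷-< : ∀ {z x} xs → z < x → rankᴸ (z ∷ xs) x ≡ suc (rankᴸ xs x)
rank-∷-< {x = x} xs z<x = cong length (List.filter-accept (ℕ._<? x) {xs = xs} z<x)

rank-∷-≮ : ∀ {z x} xs → ¬ z < x → rankᴸ (z ∷ xs) x ≡ rankᴸ xs x
rank-∷-≮ {x = x} xs z≮x = cong length (List.filter-reject (ℕ._<? x) {xs = xs} z≮x)

rank-mono-≤ : ∀ xs {x y} → x ≤ y → rankᴸ xs x ≤ rankᴸ xs y
rank-mono-≤ []       x≤y = z≤n
rank-mono-≤ (z ∷ xs) {x} {y} x≤y with z ℕ.<? x | z ℕ.<? y
... | yes z<x | yes z<y =
  subst₂ _≤_ (sym (rank-∷-< xs z<x)) (sym (rank-∷-< xs z<y)) (s≤s (rank-mono-≤ xs x≤y))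
... | yes z<x | no  z≮y = contradiction (ℕ.<-≤-trans z<x x≤y) z≮y
... | no  z≮x | yes z<y =
  subst₂ _≤_ (sym (rank-∷-≮ xs z≮x)) (sym (rank-∷-< xs z<y)) (ℕ.m≤n⇒m≤1+n (rank-mono-≤ xs x≤y))
... | no  z≮x | no  z≮y =
  subst₂ _≤_ (sym (rank-∷-≮ xs z≮x)) (sym (rank-∷-≮ xs z≮y)) (rank-mono-≤ xs x≤y)

rank-cancel-< : ∀ xs {x y} → rankᴸ xs x < rankᴸ xs y → x < y
rank-cancel-< xs {x} {y} r with x ℕ.<? y
... | yes x<y = x<y
... | no  x≮y = contradiction (rank-mono-≤ xs (ℕ.≮⇒≥ x≮y)) (ℕ.<⇒≱ r)

-- Strictness comes from the letter `x` itself, which is counted in the rank of `y` but not in its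
-- own; hence the membership hypothesis. The converse `rank-cancel-<` rests on weak monotonicity
-- alone.
rank-mono-<ᴸ : ∀ {xs x y} → x ∈ₗ xs → x < y → rankᴸ xs x < rankᴸ xs y
rank-mono-<ᴸ {x ∷ xs} (here refl) x<y =
  subst₂ _<_ (sym (rank-∷-≮ xs (ℕ.n≮n x))) (sym (rank-∷-< xs x<y)) (s≤s (rank-mono-≤ xs (ℕ.<⇒≤ x<y)))
rank-mono-<ᴸ {z ∷ xs} {x} {y} (there x∈) x<y with z ℕ.<? x | z ℕ.<? y
... | yes z<x | yes z<y =
  subst₂ _<_ (sym (rank-∷-< xs z<x)) (sym (rank-∷-< xs z<y)) (s≤s (rank-mono-<ᴸ x∈ x<y))
... | yes z<x | no  z≮y = contradiction (ℕ.<-trans z<x x<y) z≮y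
... | no  z≮x | yes z<y =
  subst₂ _<_ (sym (rank-∷-≮ xs z≮x)) (sym (rank-∷-< xs z<y)) (ℕ.m<n⇒m<1+n (rank-mono-<ᴸ x∈ x<y))
... | no  z≮x | no  z≮y =
  subst₂ _<_ (sym (rank-∷-≮ xs z≮x)) (sym (rank-∷-≮ xs z≮y)) (rank-mono-<ᴸ x∈ x<y)

rank-sorted⁺ : ∀ {xs b} → All (_∈ₗ xs) b → Sorted b → Sorted (map (rankᴸ xs) b)
rank-sorted⁺ _          []        = []
rank-sorted⁺ _          [-]       = [-]
rank-sorted⁺ (x∈ ∷ b∈) (x<y ∷ s) = rank-mono-<ᴸ x∈ x<y ∷ rank-sorted⁺ b∈ s

rank-sorted⁻ : ∀ xs {b} → Sorted (map (rankᴸ xs) b) → Sorted b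
rank-sorted⁻ xs s = Linked.map (rank-cancel-< xs) (Linked.map⁻ s)

-- Splittings of a weak composition

splits : List ℕ → List (List ℕ × List ℕ)
splits []      = ([] , []) ∷ []
splits (k ∷ I) =
  cartesianProductWith (λ { a (J , K) → a ∷ J , (k ∸ a) ∷ K }) (upTo (suc k)) (splits I)

splits-unique : ∀ I → Unique (splits I)
splits-unique []      = [] ∷ []
splits-unique (k ∷ I) = Unique.cartesianProductWith⁺ _
  (λ eq → List.∷-injectiveˡ (cong proj₁ eq) ,
          cong₂ _,_ (List.∷-injectiveʳ (cong proj₁ eq)) (List.∷-injectiveʳ (cong proj₂ eq)))
  (Unique.upTo⁺ (suc k)) (splits-unique I)

∈-splits⁻ : ∀ I {J K} → (J , K) ∈ₗ splits I →
            I ≡ zipWith _+_ J K × length J ≡ length I × length K ≡ length I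
∈-splits⁻ []      (here refl) = refl , refl , refl
∈-splits⁻ (k ∷ I) JK∈ with ∈.∈-cartesianProductWith⁻ _ (upTo (suc k)) (splits I) JK∈
... | a , (J , K) , a∈ , JK∈′ , refl with ∈-splits⁻ I JK∈′
...   | eq , lenJ , lenK =
  cong₂ _∷_ (sym (ℕ.m+[n∸m]≡n (ℕ.≤-pred (∈.∈-upTo⁻ a∈)))) eq , cong suc lenJ , cong suc lenK

∈-splits⁺ : ∀ J K → length J ≡ length K → (J , K) ∈ₗ splits (zipWith _+_ J K)
∈-splits⁺ []      []      eq = here refl
∈-splits⁺ (a ∷ J) (c ∷ K) eq =
  subst (λ c′ → (a ∷ J , c′ ∷ K) ∈ₗ splits (a + c ∷ zipWith _+_ J K)) (ℕ.m+n∸m≡n a c)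
    (∈.∈-cartesianProductWith⁺ _ (∈.∈-upTo⁺ (s≤s (ℕ.m≤m+n a c))) (∈-splits⁺ J K (ℕ.suc-injective eq)))

-- Pigeonhole for lists, and permutations as words of natural numbers

filter-cong-All : {P : Pred A p} {Q : Pred A p′} (P? : Decidable P) (Q? : Decidable Q) {xs : List A} →
                  All (λ x → (P x → Q x) × (Q x → P x)) xs → filter P? xs ≡ filter Q? xs
filter-cong-All P? Q? [] = refl
filter-cong-All P? Q? {x ∷ xs} ((P⇒Q , Q⇒P) ∷ eqs) with P? x
... | yes Px = trans (cong (x ∷_) (filter-cong-All P? Q? eqs)) (sym (List.filter-accept Q? (P⇒Q Px)))
... | no ¬Px = trans (filter-cong-All P? Q? eqs) (sym (List.filter-reject Q? (¬Px ∘ Q⇒P)))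

-- Pigeonhole principle: removing the head of `xs` from both lists preserves the inclusion and the
-- length bound. It shows that `n` distinct letters below `n` exhaust `upTo n`.
unique⊆⇒↭ : {xs ys : List A} → Unique xs → (∀ {x} → x ∈ₗ xs → x ∈ₗ ys) → length ys ≤ length xs →
            xs ↭ ys
unique⊆⇒↭ {xs = []}     {[]} u xs⊆ys le = ↭-refl
unique⊆⇒↭ {xs = x ∷ xs} {ys} (x∉ ∷ u) xs⊆ys le with ∈.∈-∃++ (xs⊆ys (here refl))
... | as , bs , refl = ↭-trans (prep x (unique⊆⇒↭ u inside shorter)) (↭-sym (↭.shift x as bs))
  where
  inside : ∀ {y} → y ∈ₗ xs → y ∈ₗ as ++ bs
  inside y∈ with ↭.∈-resp-↭ (↭.shift x as bs) (xs⊆ys (there y∈))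
  ... | here refl = contradiction refl (All.lookup x∉ y∈)
  ... | there y∈′ = y∈′
  shorter : length (as ++ bs) ≤ length xs
  shorter = ℕ.≤-pred (subst (_≤ suc (length xs)) (↭.↭-length (↭.shift x as bs)) le)

wordᴺ : Vec (Fin m) n → List ℕ
wordᴺ w = map toℕ (toList w)

length-wordᴺ : (w : Vec (Fin m) n) → length (wordᴺ w) ≡ n
length-wordᴺ w = trans (List.length-map toℕ (toList w)) (Vec.length-toList w)

wordᴺ-injective : (v w : Vec (Fin m) n) → wordᴺ v ≡ wordᴺ w → v ≡ w
wordᴺ-injective v w eq =
  trans (sym (Vec.cast-is-id refl v)) (Vec.toList-injective refl v w (List.map-injective Fin.toℕ-injective eq))

toList-unique : {v : Vec A n} → VecUnique.Unique v → Unique (toList v)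
toList-unique VecAllPairs.[]      = []
toList-unique (x∉ VecAllPairs.∷ u) = VecAll.toList⁺ x∉ ∷ toList-unique u

toList-unique⁻ : (v : Vec A n) → Unique (toList v) → VecUnique.Unique v
toList-unique⁻ []      []       = VecAllPairs.[]
toList-unique⁻ (x ∷ v) (x∉ ∷ u) = VecAll.toList⁻ x∉ VecAllPairs.∷ toList-unique⁻ v u

wordᴺ-↭ : (σ : Perm n) → wordᴺ (letters σ) ↭ upTo n
wordᴺ-↭ {n} (perm w d) = unique⊆⇒↭
  -- The field `distinct` is irrelevant; since distinctness is decidable, a relevant proof of it can
  -- be recomputed.
  (Unique.map⁺ Fin.toℕ-injective (toList-unique (recompute (unique? w) d)))
  (λ x∈ → case ∈.∈-map⁻ toℕ x∈ of λ { (i , _ , refl) → ∈.∈-upTo⁺ (Fin.toℕ<n i) })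
  (ℕ.≤-reflexive (trans (List.length-upTo n) (sym (length-wordᴺ w))))

wordᴺ-surjective : (xs : List ℕ) → All (_< m) xs → length xs ≡ n →
                   ∃ λ (w : Vec (Fin m) n) → wordᴺ w ≡ xs
wordᴺ-surjective []       []         refl = [] , refl
wordᴺ-surjective (x ∷ xs) (x<m ∷ xs<m) refl with wordᴺ-surjective xs xs<m refl
... | w , eq = fromℕ< x<m ∷ w , cong₂ _∷_ (Fin.toℕ-fromℕ< x<m) eq

perm-surjective : (xs : List ℕ) → xs ↭ upTo n → ∃ λ (σ : Perm n) → wordᴺ (letters σ) ≡ xs
perm-surjective {n} xs p with wordᴺ-surjective xs (↭.All-resp-↭ (↭-sym p) (upTo-< n))
                                               (trans (↭.↭-length p) (List.length-upTo n))
... | w , eq = perm w (toList-unique⁻ w (Unique.map⁻ (subst Unique (sym eq) unique))) , eq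
  where
  unique : Unique xs
  unique = ↭ₛ.Unique-resp-↭ (≡.setoid ℕ) (↭.↭⇒↭ₛ (↭-sym p)) (Unique.upTo⁺ n)

∈-words : (xs : List A) → (∀ x → x ∈ₗ xs) → (v : Vec A n) → v ∈ₗ words xs n
∈-words xs all []      = here refl
∈-words xs all (x ∷ v) = ∈.∈-cartesianProductWith⁺ _∷_ (all x) (∈-words xs all v)

words-unique : {xs : List A} → Unique xs → ∀ n → Unique (words xs n)
words-unique u zero    = [] ∷ []
words-unique u (suc n) = Unique.cartesianProductWith⁺ _∷_ Vec.∷-injective u (words-unique u n)

toPerm-just : (σ : Perm n) → toPerm (letters σ) ≡ just σ
toPerm-just (perm w d) with unique? w
... | yes _ = refl
... | no ¬d = contradiction (recompute (unique? w) d) ¬d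

toPerm-letters : (w : Vec (Fin n) n) {σ : Perm n} → toPerm w ≡ just σ → letters σ ≡ w
toPerm-letters w eq with unique? w
toPerm-letters w refl | yes _ = refl

∈-permutations : (σ : Perm n) → σ ∈ₗ permutations n
∈-permutations σ = ∈-mapMaybe⁺ toPerm _ (∈-words _ ∈.∈-allFin (letters σ)) (toPerm-just σ)

permutations-unique : ∀ n → Unique (permutations n)
permutations-unique n = mapMaybe-unique toPerm
  (λ {w} {w′} eq eq′ → trans (sym (toPerm-letters w eq)) (toPerm-letters w′ eq′))
  (words-unique (Unique.allFin⁺ n) n)

-- Standardization of words

toList-tabulate : (f : Fin n → B) (h : B → C) (g : A → C) (w : Vec A n) →
                  (∀ i → h (f i) ≡ g (lookup w i)) → map h (toList (Vec.tabulate f)) ≡ map g (toList w)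
toList-tabulate f h g []      eq = refl
toList-tabulate f h g (x ∷ w) eq =
  cong₂ _∷_ (eq Fin.zero) (toList-tabulate (f ∘ Fin.suc) h g w (eq ∘ Fin.suc))

count-rankᴸ : (w : Vec (Fin m) n) (x : Fin m) → Vec.count (Fin._<? x) w ≡ rankᴸ (wordᴺ w) (toℕ x)
count-rankᴸ []      x = refl
count-rankᴸ (y ∷ w) x with does (toℕ y ℕ.<? toℕ x)
... | true  = cong suc (count-rankᴸ w x)
... | false = count-rankᴸ w x

wordᴺ-stdWord : (w : Vec (Fin m) n) → wordᴺ (stdWord w) ≡ map (rankᴸ (wordᴺ w)) (wordᴺ w)
wordᴺ-stdWord w = trans
  (toList-tabulate _ toℕ (λ x → rankᴸ (wordᴺ w) (toℕ x)) w
    (λ i → trans (Fin.toℕ-fromℕ< _) (count-rankᴸ w (lookup w i))))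
  (List.map-∘ (toList w))

map-proj₁-zip : (xs : List A) (ys : List B) → length xs ≡ length ys → map proj₁ (zip xs ys) ≡ xs
map-proj₁-zip []       []       eq = refl
map-proj₁-zip (x ∷ xs) (y ∷ ys) eq = cong (x ∷_) (map-proj₁-zip xs ys (ℕ.suc-injective eq))

map-proj₂-zip : (xs : List A) (ys : List B) → length xs ≡ length ys → map proj₂ (zip xs ys) ≡ ys
map-proj₂-zip []       []       eq = refl
map-proj₂-zip (x ∷ xs) (y ∷ ys) eq = cong (y ∷_) (map-proj₂-zip xs ys (ℕ.suc-injective eq))

zip-mapˡ : (f : A → B) (xs : List A) (ys : List C) →
           zip (map f xs) ys ≡ map (λ { (x , y) → f x , y }) (zip xs ys)
zip-mapˡ f []       ys       = refl
zip-mapˡ f (x ∷ xs) []       = refl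
zip-mapˡ f (x ∷ xs) (y ∷ ys) = cong (_ ∷_) (zip-mapˡ f xs ys)

zip-map-map : (f : A → B) (g : A → C) (xs : List A) →
              zip (map f xs) (map g xs) ≡ map (λ x → f x , g x) xs
zip-map-map f g []       = refl
zip-map-map f g (x ∷ xs) = cong (_ ∷_) (zip-map-map f g xs)

zip-tabulate : (w : Vec A n) (u : Vec B n) →
               zip (toList w) (toList u) ≡ map (λ i → lookup w i , lookup u i) (List.allFin n)
zip-tabulate w u = trans (entries w u) (sym (List.map-tabulate id _))
  where
  entries : (w : Vec A n) (u : Vec B n) → zip (toList w) (toList u) ≡ List.tabulate (λ i → lookup w i , lookup u i)
  entries []      []      = refl
  entries (x ∷ w) (y ∷ u) = cong (_ ∷_) (entries w u)

length-concat : (xss : List (List A)) → length (concat xss) ≡ sum (map length xss)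
length-concat []         = refl
length-concat (xs ∷ xss) = trans (List.length-++ xs) (cong (length xs +_) (length-concat xss))

toList-subword : (w : Vec A n) (ps : List (Fin n)) → toList (subword w ps) ≡ map (lookup w) ps
toList-subword w ps =
  trans (Vec.toList-map (lookup w) (Vec.fromList ps)) (cong (map (lookup w)) (Vec.toList∘fromList ps))

-- Colored permutations as lists of colored letters

module ColoredWords (l : ℕ) .{{l≢0 : NonZero l}} where

  open ColoredPermutations l

  word : Basis → List ℕ
  word (_ , σ , _) = wordᴺ (letters σ)

  colors : Basis → List Color
  colors (_ , _ , u) = toList u

  -- An encoding whose type does not mention the size: basis elements of propositionally equal sizes
  -- are compared without transport.
  code : Basis → List (ℕ × Color)
  code h = zip (word h) (colors h)

  length-word : ∀ h → length (word h) ≡ size h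
  length-word (_ , σ , _) = length-wordᴺ (letters σ)

  length-colors : ∀ h → length (colors h) ≡ size h
  length-colors (_ , _ , u) = Vec.length-toList u

  code-word : ∀ h → map proj₁ (code h) ≡ word h
  code-word h = map-proj₁-zip (word h) (colors h) (trans (length-word h) (sym (length-colors h)))

  code-colors : ∀ h → map proj₂ (code h) ≡ colors h
  code-colors h = map-proj₂-zip (word h) (colors h) (trans (length-word h) (sym (length-colors h)))

  code-↭ : ∀ h → map proj₁ (code h) ↭ upTo (size h)
  code-↭ h@(_ , σ , _) = ↭-trans (↭-reflexive (code-word h)) (wordᴺ-↭ σ)

  code-↭-+ : ∀ h {i} → i ≤ size h → map proj₁ (code h) ↭ upTo (i + (size h ∸ i))
  code-↭-+ h i≤n = subst (λ n → map proj₁ (code h) ↭ upTo n) (sym (ℕ.m+[n∸m]≡n i≤n)) (code-↭ h)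

  length-code : ∀ h → length (code h) ≡ size h
  length-code h =
    trans (sym (List.length-map proj₁ (code h))) (trans (cong length (code-word h)) (length-word h))

  basis-ext : ∀ h h′ → word h ≡ word h′ → colors h ≡ colors h′ → h ≡ h′
  basis-ext h@(_ , σ , u) h′@(_ , τ , v) w≡ c≡
    with trans (sym (length-word h)) (trans (cong length w≡) (length-word h′))
  basis-ext (_ , perm w _ , u) (_ , perm x _ , v) w≡ c≡ | refl
    with wordᴺ-injective w x w≡ | trans (sym (Vec.cast-is-id refl u)) (Vec.toList-injective refl u v c≡)
  ... | refl | refl = refl

  code-injective : ∀ {h h′} → code h ≡ code h′ → h ≡ h′
  code-injective {h} {h′} eq = basis-ext h h′
    (trans (sym (code-word h)) (trans (cong (map proj₁) eq) (code-word h′)))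
    (trans (sym (code-colors h)) (trans (cong (map proj₂) eq) (code-colors h′)))

  code-surjective : ∀ P → map proj₁ P ↭ upTo (length P) → ∃ λ h → code h ≡ P
  code-surjective P p with perm-surjective (map proj₁ P) p
  ... | σ , eq = (length P , σ , Vec.map proj₂ (Vec.fromList P)) , (begin
      zip (wordᴺ (letters σ)) (toList (Vec.map proj₂ (Vec.fromList P)))
        ≡⟨ cong₂ zip eq (trans (Vec.toList-map proj₂ (Vec.fromList P)) (cong (map proj₂) (Vec.toList∘fromList P))) ⟩
      zip (map proj₁ P) (map proj₂ P) ≡⟨ zip-map-map proj₁ proj₂ P ⟩
      map id P                        ≡⟨ List.map-id P ⟩
      P                               ∎)
    where open ≡-Reasoning

  ∈-coloredPermutations : (h : ColPerm n) → h ∈ₗ coloredPermutations n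
  ∈-coloredPermutations (σ , u) = ∈.∈-cartesianProduct⁺ (∈-permutations σ) (∈-words _ ∈.∈-allFin u)

  coloredPermutations-unique : ∀ n → Unique (coloredPermutations n)
  coloredPermutations-unique n =
    Unique.cartesianProduct⁺ (permutations-unique n) (words-unique (Unique.allFin⁺ l) n)

  -- `restrict` selects positions, while cutting selects letters. The code is the image of the list
  -- of positions under `at`, so `filter-map` turns one selection into the other.
  code-restrict : ∀ h a b → code (restrict h a b) ≡
    std (filter (λ { (x , _) → (a ℕ.≤? suc x) ×-dec (suc x ℕ.≤? b) }) (code h))
  code-restrict (n , perm w d , u) a b = begin
    zip (wordᴺ (stdWord (subword w ps))) (toList (subword u ps))
      ≡⟨ cong₂ zip (wordᴺ-stdWord (subword w ps)) (toList-subword u ps) ⟩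
    zip (map (rankᴸ xs) xs) us          ≡⟨ zip-mapˡ (rankᴸ xs) xs us ⟩
    map (λ { (x , c) → rankᴸ xs x , c }) (zip xs us)
      ≡⟨ cong (λ ys → map (λ { (x , c) → rankᴸ ys x , c }) (zip xs us)) (map-proj₁-zip xs us lengths) ⟨
    std (zip xs us)                     ≡⟨ cong std selected ⟩
    std (filter _ (code (n , perm w d , u))) ∎
    where
    open ≡-Reasoning
    ps = positions w a b
    xs = wordᴺ (subword w ps)
    us = map (lookup u) ps
    lengths : length xs ≡ length us
    lengths = trans (length-wordᴺ (subword w ps)) (sym (List.length-map (lookup u) ps))
    at : Fin n → ℕ × Color
    at i = toℕ (lookup w i) , lookup u i
    selected : zip xs us ≡ filter _ (code (n , perm w d , u))
    selected = begin
      zip (map toℕ (toList (subword w ps))) us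
        ≡⟨ cong (λ v → zip (map toℕ v) us) (toList-subword w ps) ⟩
      zip (map toℕ (map (lookup w) ps)) us           ≡⟨ cong (λ v → zip v us) (List.map-∘ ps) ⟨
      zip (map (toℕ ∘ lookup w) ps) us               ≡⟨ zip-map-map (toℕ ∘ lookup w) (lookup u) ps ⟩
      map at ps                                      ≡⟨ filter-map _ at (List.allFin n) ⟨
      filter _ (map at (List.allFin n))
        ≡⟨ cong (filter _) (List.map-∘ (List.allFin n)) ⟩
      filter _ (map (λ { (x , c) → toℕ x , c }) (map (λ i → lookup w i , lookup u i) (List.allFin n)))
        ≡⟨ cong (λ P → filter _ (map (λ { (x , c) → toℕ x , c }) P)) (zip-tabulate w u) ⟨
      filter _ (map (λ { (x , c) → toℕ x , c }) (zip (toList w) (toList u)))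
        ≡⟨ cong (filter _) (zip-mapˡ toℕ (toList w) (toList u)) ⟨
      filter _ (code (n , perm w d , u))             ∎

  lower upper : ℕ → Basis → Basis
  lower i h = restrict h 1 i
  upper i h = restrict h (suc i) (size h)

  code-lower : ∀ h {i} → i ≤ size h → code (lower i h) ≡ low× i (code h)
  code-lower h {i} i≤n = begin
    code (restrict h 1 i)  ≡⟨ code-restrict h 1 i ⟩
    std (filter _ (code h))
      ≡⟨ cong std (List.filter-≐ _ ((ℕ._<? i) ∘ proj₁) (proj₂ , λ x<i → s≤s z≤n , x<i) (code h)) ⟩
    std (low× i (code h))  ≡⟨ std-low i (size h ∸ i) (code h) (code-↭-+ h i≤n) ⟩
    low× i (code h)        ∎
    where open ≡-Reasoning

  code-upper : ∀ h {i} → i ≤ size h → code (upper i h) ≡ high× i (code h)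
  code-upper h {i} i≤n = begin
    code (restrict h (suc i) (size h)) ≡⟨ code-restrict h (suc i) (size h) ⟩
    std (filter _ (code h))            ≡⟨ cong std (filter-cong-All _ ((i ℕ.≤?_) ∘ proj₁) bounds) ⟩
    std (filter ((i ℕ.≤?_) ∘ proj₁) (code h))
      ≡⟨ std-high i (size h ∸ i) (code h) (code-↭-+ h i≤n) ⟩
    high× i (code h)                   ∎
    where
    open ≡-Reasoning
    -- Every letter of `h` is below `size h`, so the upper end of the interval excludes nothing. The
    -- two predicates agree on the letters that occur, though not on all of ℕ.
    bounds : All (λ { (x , _) → (suc i ≤ suc x × suc x ≤ size h → i ≤ x) ×
                                (i ≤ x → suc i ≤ suc x × suc x ≤ size h) }) (code h)
    bounds = All.map (λ x<n → (λ { (s≤s i≤x , _) → i≤x }) , λ i≤x → s≤s i≤x , x<n)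
                     (All.map⁻ (↭.All-resp-↭ (↭-sym (code-↭ h)) (upTo-< (size h))))

  size-lower : ∀ h {i} → i ≤ size h → size (lower i h) ≡ i
  size-lower h {i} i≤n = begin
    size (lower i h)                  ≡⟨ length-code (lower i h) ⟨
    length (code (lower i h))         ≡⟨ cong length (code-lower h i≤n) ⟩
    length (low× i (code h))          ≡⟨ List.length-map proj₁ (low× i (code h)) ⟨
    length (map proj₁ (low× i (code h))) ≡⟨ cong length (low-map-proj₁ i (code h)) ⟩
    length (low i (map proj₁ (code h)))  ≡⟨ ↭.↭-length (low-↭ i (size h ∸ i) (code-↭-+ h i≤n)) ⟩
    length (upTo i)                   ≡⟨ List.length-upTo i ⟩
    i                                 ∎
    where open ≡-Reasoning

  -- Descent classes

  record BlockIncreasing (I : List ℕ) (cs : List Color) (h : Basis) : Set where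
    constructor blockIncreasing
    field
      size≡   : size h ≡ sum I
      colors≡ : colors h ≡ spread I cs
      sorted  : All Sorted (blocks I (word h))

  open BlockIncreasing

  increasing⁺ : ∀ I (σ : Perm n) → All Sorted (blocks I (wordᴺ (letters σ))) →
                IncreasingOnBlocks I σ
  increasing⁺ I σ s =
    All.map Linked.map⁻ (All.map⁻ (subst (All Sorted) (blocks-map toℕ I (toList (letters σ))) s))

  increasing⁻ : ∀ I (σ : Perm n) → IncreasingOnBlocks I σ →
                All Sorted (blocks I (wordᴺ (letters σ)))
  increasing⁻ I σ s =
    subst (All Sorted) (sym (blocks-map toℕ I (toList (letters σ)))) (All.map⁺ (All.map Linked.map⁺ s))

  descentClass? : (I : List ℕ) (cs : List Color) →
                  Decidable {A = ColPerm n}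
                    λ { (σ , u) → toList u ≡ spread I cs × IncreasingOnBlocks I σ }
  descentClass? I cs (σ , u) =
    List.≡-dec Fin._≟_ (toList u) (spread I cs) ×-dec increasingOnBlocks? I σ

  descentClass : List ℕ → List Color → List Basis
  descentClass I cs = map (sum I ,_) (filter (descentClass? I cs) (coloredPermutations (sum I)))

  descentClass-unique : ∀ I cs → Unique (descentClass I cs)
  descentClass-unique I cs =
    Unique.map⁺ (λ { refl → refl }) (Unique.filter⁺ (descentClass? I cs) (coloredPermutations-unique (sum I)))

  ∈-descentClass⁺ : ∀ {I cs h} → BlockIncreasing I cs h → h ∈ₗ descentClass I cs
  ∈-descentClass⁺ {I} {cs} {n , σ , u} (blockIncreasing refl c s) =
    ∈.∈-map⁺ (sum I ,_) (∈.∈-filter⁺ (descentClass? I cs) (∈-coloredPermutations (σ , u)) (c , increasing⁺ I σ s))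

  ∈-descentClass⁻ : ∀ I cs {h} → h ∈ₗ descentClass I cs → BlockIncreasing I cs h
  ∈-descentClass⁻ I cs h∈ with ∈.∈-map⁻ (sum I ,_) h∈
  ... | (σ , u) , σu∈ , refl with ∈.∈-filter⁻ (descentClass? I cs) {xs = coloredPermutations (sum I)} σu∈
  ...   | _ , c , s = blockIncreasing refl c (increasing⁻ I σ s)

  blocksOf : List ℕ → Basis → List (List ℕ)
  blocksOf I h = blocks I (word h)

  module _ {I cs h} (b : BlockIncreasing I cs h) where

    length-word-sum : length (word h) ≡ sum I
    length-word-sum = trans (length-word h) (size≡ b)

    concat-blocksOf : concat (blocksOf I h) ≡ word h
    concat-blocksOf = concat-blocks I (word h) length-word-sum

    length-blocksOf : map length (blocksOf I h) ≡ I
    length-blocksOf = length-blocks I (word h) length-word-sum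

    count-blocksOf : length (blocksOf I h) ≡ length I
    count-blocksOf =
      trans (sym (List.length-map length (blocksOf I h))) (cong length length-blocksOf)

    code-paint : length I ≡ length cs → code h ≡ paint cs (blocksOf I h)
    code-paint len = trans
      (cong₂ zip (sym concat-blocksOf) (trans (colors≡ b) (cong (λ I → spread I cs) (sym length-blocksOf))))
      (zip-concat (blocksOf I h) cs (trans count-blocksOf len))

  module _ {cs h Bs} (eq : code h ≡ paint cs Bs) (len : length Bs ≡ length cs) where

    word-concat : word h ≡ concat Bs
    word-concat = trans (sym (code-word h)) (trans (cong (map proj₁) eq) (letters-paint cs Bs len))

    blocksOf-paint : blocksOf (map length Bs) h ≡ Bs
    blocksOf-paint = trans (cong (blocks (map length Bs)) word-concat) (blocks-concat Bs)

    -- Recognizes a member of a descent class by its code. It applies to both halves of a cut word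
    -- and to a word glued from two halves.
    paint-blockIncreasing : All Sorted Bs → BlockIncreasing (map length Bs) cs h
    paint-blockIncreasing s = blockIncreasing
      (trans (sym (length-word h)) (trans (cong length word-concat) (length-concat Bs)))
      (trans (sym (code-colors h)) (trans (cong (map proj₂) eq) (colors-paint cs Bs len)))
      (subst (All Sorted) (sym blocksOf-paint) s)

  -- Cutting a descent class at a letter

  splitsAt : List ℕ → ℕ → List (List ℕ × List ℕ)
  splitsAt I i = filter (λ { (J , _) → sum J ℕ.≟ i }) (splits I)

  -- A word of the descent class is cut at the letter i by cutting each of its
  -- blocks, and it is recovered from the two halves once their shapes J and K
  -- are known: J records how many letters of each block are small.
  module Cut (I : List ℕ) (cs : List Color) (len : length I ≡ length cs) {i : ℕ} (i≤n : i ≤ sum I) where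

    -- The shape is stored with the pair because one pair can arise from several shapes. This keeps
    -- `halves` free of duplicates, whereas `map proj₂ halves` has the multiplicities of the
    -- coproduct.
    Half : Set
    Half = (List ℕ × List ℕ) × (Basis × Basis)

    halves : List Half
    halves = concatMap
      (λ { (J , K) → map ((J , K) ,_) (cartesianProduct (descentClass J cs) (descentClass K cs)) })
      (splitsAt I i)

    -- The common invariant of a word and its halves: the low part and the high part of each block.
    -- `cut-↭` matches the two sides along it.
    key : Basis → List (List ℕ) × List (List ℕ)
    key h = lows i (blocksOf I h) , highs i (blocksOf I h)

    key′ : Half → List (List ℕ) × List (List ℕ)
    key′ ((J , K) , α , β) = blocksOf J α , blocksOf K β

    record IsHalf (x : Half) : Set where
      J = proj₁ (proj₁ x)
      K = proj₂ (proj₁ x)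
      α = proj₁ (proj₂ x)
      β = proj₂ (proj₂ x)
      field
        I≡     : I ≡ zipWith _+_ J K
        lenJ   : length J ≡ length cs
        lenK   : length K ≡ length cs
        sumJ   : sum J ≡ i
        left   : BlockIncreasing J cs α
        right  : BlockIncreasing K cs β

    ∈-halves⁻ : ∀ {x} → x ∈ₗ halves → IsHalf x
    ∈-halves⁻ x∈ with ∈-concatMap-∃⁻ _ (splitsAt I i) x∈
    ... | (J , K) , JK∈ , x∈′ with ∈.∈-map⁻ ((J , K) ,_) x∈′
    ...   | (α , β) , αβ∈ , refl
        with ∈.∈-filter⁻ _ {xs = splits I} JK∈ | ∈.∈-cartesianProduct⁻ (descentClass J cs) _ αβ∈
    ...     | JK∈splits , sumJ | α∈ , β∈ with ∈-splits⁻ I JK∈splits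
    ...       | I≡ , lenJ , lenK = record
      { I≡ = I≡ ; lenJ = trans lenJ len ; lenK = trans lenK len ; sumJ = sumJ
      ; left = ∈-descentClass⁻ J cs α∈ ; right = ∈-descentClass⁻ K cs β∈ }

    ∈-halves⁺ : ∀ {x} → IsHalf x → x ∈ₗ halves
    ∈-halves⁺ {x} half = ∈-concatMap-∃⁺ _
      (∈.∈-filter⁺ (λ { (J , _) → sum J ℕ.≟ i })
        (subst (λ I → (J , K) ∈ₗ splits I) (sym I≡) (∈-splits⁺ J K (trans lenJ (sym lenK)))) sumJ)
      (∈.∈-map⁺ ((J , K) ,_) (∈.∈-cartesianProduct⁺ (∈-descentClass⁺ left) (∈-descentClass⁺ right)))
      where open IsHalf half

    halves-unique : Unique halves
    halves-unique = concatMap-unique _ (Unique.filter⁺ _ (splits-unique I))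
      (λ { {J , K} _ → Unique.map⁺ (λ { refl → refl })
        (Unique.cartesianProduct⁺ (descentClass-unique J cs) (descentClass-unique K cs)) })
      (λ { {J , K} {J′ , K′} _ _ x∈ x∈′ → case ∈.∈-map⁻ ((J , K) ,_) x∈ , ∈.∈-map⁻ ((J′ , K′) ,_) x∈′ of
        λ { ((_ , _ , refl) , (_ , _ , refl)) → refl } })

    module _ {h} (b : BlockIncreasing I cs h) where

      private
        Bs = blocksOf I h
        i≤size : i ≤ size h
        i≤size = subst (i ≤_) (sym (size≡ b)) i≤n
        count : length Bs ≡ length cs
        count = trans (count-blocksOf b) len

      lower-paint : code (lower i h) ≡ paint cs (lows i Bs)
      lower-paint =
        trans (code-lower h i≤size) (trans (cong (low× i) (code-paint b len)) (low×-paint i cs Bs))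

      upper-paint : code (upper i h) ≡ paint cs (highs i Bs)
      upper-paint =
        trans (code-upper h i≤size) (trans (cong (high× i) (code-paint b len)) (high×-paint i cs Bs))

      private
        countˡ : length (lows i Bs) ≡ length cs
        countˡ = trans (List.length-map (low i) Bs) count
        countʰ : length (highs i Bs) ≡ length cs
        countʰ = trans (List.length-map (high i) Bs) count

      halve : Half
      halve = (map length (lows i Bs) , map length (highs i Bs)) , lower i h , upper i h

      halve-isHalf : IsHalf halve
      halve-isHalf = record
        { I≡   = trans (sym (length-blocksOf b))
            (trans (cong (map length) (sym (merge-lows-highs i (sorted b))))
                   (length-merge i (lows i Bs) (highs i Bs)))
        ; lenJ = trans (List.length-map length (lows i Bs)) countˡ
        ; lenK = trans (List.length-map length (highs i Bs)) countʰ
        ; sumJ = trans (sym (size≡ left)) (size-lower h i≤size)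
        ; left = left
        ; right = paint-blockIncreasing upper-paint countʰ
            (All.map⁺ (All.map (high-sorted i) (sorted b)))
        }
        where
        left : BlockIncreasing (map length (lows i Bs)) cs (lower i h)
        left =
          paint-blockIncreasing lower-paint countˡ (All.map⁺ (All.map (low-sorted i) (sorted b)))

      key-halve : key h ≡ key′ halve
      key-halve = sym (cong₂ _,_ (blocksOf-paint {h = lower i h} lower-paint countˡ)
                                 (blocksOf-paint {h = upper i h} upper-paint countʰ))

    module _ {x} (half : IsHalf x) where

      open IsHalf half
      private
        As = blocksOf J α
        Cs = blocksOf K β
        Bs = merge i As Cs

        size-α : size α ≡ i
        size-α = trans (size≡ left) sumJ

        countᴬ : length As ≡ length cs
        countᴬ = trans (count-blocksOf left) lenJ

        countᶜ : length Cs ≡ length cs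
        countᶜ = trans (count-blocksOf right) lenK

        count≡ : length As ≡ length Cs
        count≡ = trans countᴬ (sym countᶜ)

        count : length Bs ≡ length cs
        count =
          trans (List.length-zipWith _ As Cs)
            (trans (cong (_⊓ length Cs) count≡) (trans (ℕ.⊓-idem _) countᶜ))

        small : All (All (_< i)) As
        small = All.concat⁻ (subst (All (_< i)) (sym (concat-blocksOf left))
          (↭.All-resp-↭ (↭-sym (wordᴺ-↭ (proj₁ (proj₂ α))))
            (subst (λ n → All (_< i) (upTo n)) (sym size-α) (upTo-< i))))

        concat-↭ : concat Bs ↭ upTo (i + size β)
        concat-↭ = begin
          concat Bs                           ↭⟨ concat-merge i As Cs count≡ ⟩
          concat As ++ map (i +_) (concat Cs)
            ≡⟨ cong₂ (λ xs ys → xs ++ map (i +_) ys) (concat-blocksOf left) (concat-blocksOf right) ⟩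
          word α ++ map (i +_) (word β)
            ↭⟨ ↭.++⁺ (wordᴺ-↭ (proj₁ (proj₂ α))) (↭.map⁺ (i +_) (wordᴺ-↭ (proj₁ (proj₂ β)))) ⟩
          upTo (size α) ++ map (i +_) (upTo (size β))
            ≡⟨ cong (λ n → upTo n ++ map (i +_) (upTo (size β))) size-α ⟩
          upTo i ++ map (i +_) (upTo (size β)) ≡⟨ upTo-+ i (size β) ⟨
          upTo (i + size β)                   ∎
          where open ↭.PermutationReasoning

        length-paint : length (paint cs Bs) ≡ i + size β
        length-paint = begin
          length (paint cs Bs)             ≡⟨ List.length-map proj₁ (paint cs Bs) ⟨
          length (map proj₁ (paint cs Bs)) ≡⟨ cong length (letters-paint cs Bs count) ⟩
          length (concat Bs)               ≡⟨ ↭.↭-length concat-↭ ⟩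
          length (upTo (i + size β))       ≡⟨ List.length-upTo _ ⟩
          i + size β                       ∎
          where open ≡-Reasoning

        -- The merged blocks use each letter below `i + size β` exactly once, namely the letters of
        -- `α` and those of `β` raised by `i`, so the painted list is the code of a basis element.
        glued = code-surjective (paint cs Bs)
          (↭-trans (↭-reflexive (letters-paint cs Bs count))
                   (subst (λ n → concat Bs ↭ upTo n) (sym length-paint) concat-↭))

        shape : map length Bs ≡ I
        shape = trans (length-merge i As Cs)
          (trans (cong₂ (zipWith _+_) (length-blocksOf left) (length-blocksOf right)) (sym I≡))

      glue : Basis
      glue = proj₁ glued

      glue-blockIncreasing : BlockIncreasing I cs glue
      glue-blockIncreasing = subst (λ I → BlockIncreasing I cs glue) shape
        (paint-blockIncreasing (proj₂ glued) count (merge-sorted i small (sorted left) (sorted right)))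

      key-glue : key glue ≡ key′ x
      key-glue = trans (cong (λ Bs → lows i Bs , highs i Bs)
        (trans (cong (λ I → blocksOf I glue) (sym shape)) (blocksOf-paint {h = glue} (proj₂ glued) count)))
        (cong₂ _,_ (lows-merge i Cs small count≡) (highs-merge i Cs small count≡))

    key-injective : ∀ {h h′} → BlockIncreasing I cs h → BlockIncreasing I cs h′ → key h ≡ key h′ →
                    h ≡ h′
    key-injective {h} {h′} b b′ eq =
      code-injective (trans (code-paint b len) (trans (cong (paint cs) same) (sym (code-paint b′ len))))
      where
      same : blocksOf I h ≡ blocksOf I h′
      same = trans (sym (merge-lows-highs i (sorted b)))
        (trans (cong₂ (merge i) (cong proj₁ eq) (cong proj₂ eq)) (merge-lows-highs i (sorted b′)))

    -- The shapes are read off as block lengths, and the halves are then recovered by painting the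
    -- blocks with `cs`.
    key′-injective : ∀ {x y} → IsHalf x → IsHalf y → key′ x ≡ key′ y → x ≡ y
    key′-injective X Y eq = cong₂ _,_
      (cong₂ _,_
        (trans (sym (length-blocksOf X.left))
          (trans (cong (map length ∘ proj₁) eq) (length-blocksOf Y.left)))
        (trans (sym (length-blocksOf X.right))
          (trans (cong (map length ∘ proj₂) eq) (length-blocksOf Y.right))))
      (cong₂ _,_
        (code-injective (trans (code-paint X.left X.lenJ)
          (trans (cong (paint cs ∘ proj₁) eq) (sym (code-paint Y.left Y.lenJ)))))
        (code-injective (trans (code-paint X.right X.lenK)
          (trans (cong (paint cs ∘ proj₂) eq) (sym (code-paint Y.right Y.lenK))))))
      where module X = IsHalf X
            module Y = IsHalf Y

    halves-determined : ∀ {h x} → BlockIncreasing I cs h → IsHalf x → key h ≡ key′ x →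
                        (lower i h , upper i h) ≡ proj₂ x
    halves-determined b half eq = cong₂ _,_
      (code-injective (trans (lower-paint b)
        (trans (cong (paint cs ∘ proj₁) eq) (sym (code-paint left lenJ)))))
      (code-injective (trans (upper-paint b)
        (trans (cong (paint cs ∘ proj₂) eq) (sym (code-paint right lenK)))))
      where open IsHalf half

    cut-↭ : map (λ h → lower i h , upper i h) (descentClass I cs) ↭ map proj₂ halves
    cut-↭ = bijection-↭ (λ h → lower i h , upper i h) proj₂ key key′
      (descentClass-unique I cs) halves-unique
      (λ h∈ h′∈ → key-injective (∈-descentClass⁻ I cs h∈) (∈-descentClass⁻ I cs h′∈))
      (λ x∈ y∈ → key′-injective (∈-halves⁻ x∈) (∈-halves⁻ y∈))
      (λ h∈ → let b = ∈-descentClass⁻ I cs h∈ in halve b , ∈-halves⁺ (halve-isHalf b) , key-halve b)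
      (λ x∈ → let half = ∈-halves⁻ x∈ in glue half , ∈-descentClass⁺ (glue-blockIncreasing half) , key-glue half)
      (λ h∈ x∈ → halves-determined (∈-descentClass⁻ I cs h∈) (∈-halves⁻ x∈))

    halves-concatMap : map proj₂ halves ≡
      concatMap (λ { (J , K) → cartesianProduct (descentClass J cs) (descentClass K cs) }) (splitsAt I i)
    halves-concatMap = trans (List.map-concatMap proj₂ _ (splitsAt I i))
      (List.concatMap-cong (λ { (J , K) → trans (sym (List.map-∘ (pairs J K))) (List.map-id (pairs J K)) })
        (splitsAt I i))
      where
      pairs : List ℕ → List ℕ → List (Basis × Basis)
      pairs J K = cartesianProduct (descentClass J cs) (descentClass K cs)

-- Monochromatic words and deletion of empty blocks

toList-tabulate-toℕ : (f : Fin n → A) (h : A → B) (g : ℕ → B) → (∀ i → h (f i) ≡ g (toℕ i)) →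
                      map h (toList (Vec.tabulate f)) ≡ applyUpTo g n
toList-tabulate-toℕ {zero}  f h g eq = refl
toList-tabulate-toℕ {suc n} f h g eq =
  cong₂ _∷_ (eq Fin.zero) (toList-tabulate-toℕ (f ∘ Fin.suc) h (g ∘ suc) (eq ∘ Fin.suc))

wordᴺ-idPerm : ∀ n → wordᴺ (letters (idPerm n)) ≡ upTo n
wordᴺ-idPerm n = toList-tabulate-toℕ id toℕ id (λ _ → refl)

sorted-↭⇒≡ : ∀ {xs ys} → Sorted xs → Sorted ys → xs ↭ ys → xs ≡ ys
sorted-↭⇒≡ s t p = Pointwise.Pointwise-≡⇒≡
  (↗↭↗⇒≋ ℕ.≤-totalOrder (Linked.map ℕ.<⇒≤ s) (Linked.map ℕ.<⇒≤ t) (↭.↭⇒↭ₛ p))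

upTo-sorted : ∀ n → Sorted (upTo n)
upTo-sorted n = Linked.applyUpTo⁺₂ id n ℕ.n<1+n

count-full : (c : Fin m) (u : Vec (Fin m) n) → Vec.count (c Fin.≟_) u ≡ n → toList u ≡ replicate n c
count-full c []      eq = refl
count-full c (x ∷ u) eq with c Fin.≟ x
... | yes refl = cong (c ∷_) (count-full c u (ℕ.suc-injective eq))
... | no  _    = contradiction (Vec.count≤n (c Fin.≟_) u) (ℕ.<⇒≱ (ℕ.≤-reflexive (sym eq)))

count-replicate : (c : Fin m) (n : ℕ) → Vec.count (c Fin.≟_) (Vec.replicate n c) ≡ n
count-replicate c zero    = refl
count-replicate c (suc n) with c Fin.≟ c
... | yes _  = cong suc (count-replicate c n)
... | no c≢c = contradiction refl c≢c

count-replicate-≢ : {c d : Fin m} → c ≢ d → (n : ℕ) → Vec.count (c Fin.≟_) (Vec.replicate n d) ≡ 0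
count-replicate-≢ c≢d zero    = refl
count-replicate-≢ {c = c} {d} c≢d (suc n) with c Fin.≟ d
... | yes c≡d = contradiction c≡d c≢d
... | no  _   = count-replicate-≢ c≢d n

sum-single : (c : Fin m) (n : ℕ) → Vec.sum (Vec.replicate m 0 Vec.[ c ]≔ n) ≡ n
sum-single {suc m} Fin.zero    n = trans (cong (n +_) (sum-zeros m)) (ℕ.+-identityʳ n)
  where
  sum-zeros : ∀ m → Vec.sum (Vec.replicate m 0) ≡ 0
  sum-zeros zero    = refl
  sum-zeros (suc m) = sum-zeros m
sum-single {suc m} (Fin.suc c) n = sum-single c n

-- An empty block imposes no condition, so that the zero parts of a weak composition
-- can be deleted.
record Compressed {A : Set a} (I : List ℕ) (cs : List A) : Set a where
  field
    I⁺       : List ℕ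
    cs⁺      : List A
    positive : All (0 <_) I⁺
    aligned  : length I⁺ ≡ length cs⁺
    sum≡     : sum I⁺ ≡ sum I
    spread≡  : spread I⁺ cs⁺ ≡ spread I cs
    sorted⁺  : ∀ xs → All Sorted (blocks I xs) → All Sorted (blocks I⁺ xs)
    sorted⁻  : ∀ xs → All Sorted (blocks I⁺ xs) → All Sorted (blocks I xs)

compress : (I : List ℕ) (cs : List A) → length I ≡ length cs → Compressed I cs
compress []          []       eq = record
  { I⁺ = [] ; cs⁺ = [] ; positive = [] ; aligned = refl ; sum≡ = refl ; spread≡ = refl
  ; sorted⁺ = λ _ s → s ; sorted⁻ = λ _ s → s }
compress (zero  ∷ I) (c ∷ cs) eq = record
  { positive = positive ; aligned = aligned ; sum≡ = sum≡ ; spread≡ = spread≡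
  ; sorted⁺ = λ { xs (_ ∷ s) → sorted⁺ xs s } ; sorted⁻ = λ xs s → [] ∷ sorted⁻ xs s }
  where open Compressed (compress I cs (ℕ.suc-injective eq))
compress (suc k ∷ I) (c ∷ cs) eq = record
  { positive = s≤s z≤n ∷ positive ; aligned = cong suc aligned
  ; sum≡ = cong (suc k +_) sum≡ ; spread≡ = cong (replicate (suc k) c ++_) spread≡
  ; sorted⁺ = λ { xs (s ∷ ss) → s ∷ sorted⁺ _ ss }
  ; sorted⁻ = λ { xs (s ∷ ss) → s ∷ sorted⁻ _ ss } }
  where open Compressed (compress I cs (ℕ.suc-injective eq))

module DescentClasses (l : ℕ) .{{l≢0 : NonZero l}} where

  open ColoredPermutations l
  open ColoredWords l
  open BlockIncreasing

  descentClass-↭ : ∀ I cs J ds → (∀ {h} → BlockIncreasing I cs h → BlockIncreasing J ds h) →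
                   (∀ {h} → BlockIncreasing J ds h → BlockIncreasing I cs h) →
                   descentClass I cs ↭ descentClass J ds
  descentClass-↭ I cs J ds to from = unique-↭ (descentClass-unique I cs) (descentClass-unique J ds)
    (λ h∈ → ∈-descentClass⁺ (to (∈-descentClass⁻ I cs h∈)))
    (λ h∈ → ∈-descentClass⁺ (from (∈-descentClass⁻ J ds h∈)))

  descentClass-zero : ∀ I c cs → descentClass (0 ∷ I) (c ∷ cs) ↭ descentClass I cs
  descentClass-zero I c cs = descentClass-↭ (0 ∷ I) (c ∷ cs) I cs
    (λ { (blockIncreasing s c (_ ∷ i)) → blockIncreasing s c i })
    (λ { (blockIncreasing s c i) → blockIncreasing s c ([] ∷ i) })

  descentClass-empty : (0 , idPerm 0 , []) ∷ [] ↭ descentClass [] []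
  descentClass-empty = unique-↭ ([] ∷ []) (descentClass-unique [] [])
    (λ { (here refl) → ∈-descentClass⁺ {[]} {[]} (blockIncreasing refl refl []) })
    (λ h∈ → here (only _ (size≡ (∈-descentClass⁻ [] [] h∈))))
    where
    only : ∀ h → size h ≡ 0 → h ≡ (0 , idPerm 0 , [])
    only (0 , perm [] _ , []) refl = refl

  descentClass-compress : ∀ I cs (len : length I ≡ length cs) →
                          let open Compressed (compress I cs len) in
                          descentClass I⁺ cs⁺ ↭ descentClass I cs
  descentClass-compress I cs len = descentClass-↭ I⁺ cs⁺ I cs
    (λ { {h} (blockIncreasing s c i) →
      blockIncreasing (trans s sum≡) (trans c spread≡) (sorted⁻ (word h) i) })
    (λ { {h} (blockIncreasing s c i) →
      blockIncreasing (trans s (sym sum≡)) (trans c (sym spread≡)) (sorted⁺ (word h) i) })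
    where open Compressed (compress I cs len)

  -- `N` is kept apart from `n` because the size of the terms of `S⟨ c ⟩ n` is the sum of a vector,
  -- which equals `n` only through `sum-single`.
  monochromatic : ∀ c {n N} → N ≡ n → {u : Vec Color N} → toList u ≡ replicate N c →
                  BlockIncreasing (n ∷ []) (c ∷ []) (N , idPerm N , u)
  monochromatic c {n} refl {u} eq =
    blockIncreasing (sym (ℕ.+-identityʳ n)) (trans eq (sym (List.++-identityʳ _)))
    (subst Sorted
      (sym (trans (List.take-all n _ (ℕ.≤-reflexive (length-wordᴺ (letters (idPerm n))))) (wordᴺ-idPerm n)))
      (upTo-sorted n) ∷ [])

  -- With a single block the whole word is sorted, and the only sorted rearrangement of `upTo n` is
  -- `upTo n` itself.
  monochromatic⁻ : ∀ {c n h} → BlockIncreasing (n ∷ []) (c ∷ []) h → ∀ {N} → N ≡ n →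
                   h ≡ (N , idPerm N , Vec.replicate N c)
  monochromatic⁻ {c} {n} {h@(_ , σ , _)} (blockIncreasing s col (i ∷ [])) refl = basis-ext h _
    (trans (sorted-↭⇒≡ (subst Sorted all i) (upTo-sorted n)
             (subst (λ k → word h ↭ upTo k) size≡n (wordᴺ-↭ σ)))
           (sym (wordᴺ-idPerm n)))
    (trans col (trans (List.++-identityʳ _) (sym (Vec.toList-replicate n c))))
    where
    size≡n = trans s (ℕ.+-identityʳ n)
    all : take n (word h) ≡ word h
    all = List.take-all n (word h) (ℕ.≤-reflexive (trans (length-word h) size≡n))

  aligned-vec : ∀ {k} (cs : List A) → k ≡ length cs → ∃ λ (v : Vec A k) → toList v ≡ cs
  aligned-vec cs refl = Vec.fromList cs , Vec.toList∘fromList cs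

-- Products of descent classes

module DescentClassProducts {c ℓ} (K : CommutativeRing c ℓ) (l : ℕ) .{{l≢0 : NonZero l}} where

  open FreeQuasiSymmetric K l
  open FreeModules K
  open FreeModuleProperties K
  open ColoredPermutations l
  open ColoredWords l
  open DescentClasses l
  open BlockIncreasing

  productTerms : Basis × Basis → List Basis
  productTerms ((m , σ′ , u′) , (n , σ″ , u″)) =
    map (λ σ → m + n , σ , u′ Vec.++ u″) (convolution σ′ σ″)

  -- The defining condition of the product read on lists. The length of `prefix` fixes the place of
  -- the cut, so `α` and `β` are determined by `h` and the size of `α`.
  record IsProductTerm (α β h : Basis) : Set where
    constructor isProductTerm
    field
      prefix suffix : List ℕ
      length-prefix : length prefix ≡ size α
      word≡         : word h ≡ prefix ++ suffix
      std-prefix    : map (rankᴸ prefix) prefix ≡ word α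
      std-suffix    : map (rankᴸ suffix) suffix ≡ word β
      colors≡′      : colors h ≡ colors α ++ colors β

  wordᴺ-take-drop : ∀ m (w : Vec (Fin k) (m + n)) →
                    wordᴺ w ≡ wordᴺ (Vec.take m w) ++ wordᴺ (Vec.drop m w)
  wordᴺ-take-drop m w = trans
    (cong (map toℕ) (trans (cong toList (sym (Vec.take++drop≡id m w))) (Vec.toList-++ (Vec.take m w) (Vec.drop m w))))
    (List.map-++ toℕ (toList (Vec.take m w)) _)

  ∈-productTerms⁻ : ∀ α β {h} → h ∈ₗ productTerms (α , β) → IsProductTerm α β h
  ∈-productTerms⁻ α@(m , σ′ , u′) β@(n , σ″ , u″) h∈ with ∈.∈-map⁻ _ h∈
  ... | σ , σ∈ , refl with ∈.∈-filter⁻ _ {xs = permutations (m + n)} σ∈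
  ...   | _ , eq′ , eq″ = isProductTerm _ _ (length-wordᴺ (Vec.take m w)) (wordᴺ-take-drop m w)
      (trans (sym (wordᴺ-stdWord (Vec.take m w))) (cong wordᴺ eq′))
      (trans (sym (wordᴺ-stdWord (Vec.drop m w))) (cong wordᴺ eq″))
      (Vec.toList-++ u′ u″)
    where w = letters σ

  -- Together with `IsProductTerm-injective` this says that the words of size `m + n` are
  -- partitioned by their pairs of standardized factors: no word is missed and none occurs in two
  -- products.
  ∈-productTerms-split : ∀ m n (h : Basis) → size h ≡ m + n →
    ∃₂ λ α β → size α ≡ m × size β ≡ n × h ∈ₗ productTerms (α , β)
  ∈-productTerms-split m n (_ , perm w d , u) refl =
    (m , Std (Vec.take m w) (VecUnique.take⁺ m d) , Vec.take m u) ,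
    (n , Std (Vec.drop m w) (VecUnique.drop⁺ m d) , Vec.drop m u) , refl , refl ,
    subst (λ v → (m + n , perm w d , v) ∈ₗ map (λ σ → m + n , σ , Vec.take m u Vec.++ Vec.drop m u) _)
      (Vec.take++drop≡id m u)
      (∈.∈-map⁺ (λ σ → m + n , σ , Vec.take m u Vec.++ Vec.drop m u)
        (∈.∈-filter⁺ _ (∈-permutations (perm w d)) (refl , refl)))

  productTerms-unique : ∀ x → Unique (productTerms x)
  productTerms-unique ((m , σ′ , u′) , (n , σ″ , u″)) =
    Unique.map⁺ (λ { refl → refl }) (Unique.filter⁺ _ (permutations-unique (m + n)))

  IsProductTerm-injective : ∀ {α β α′ β′ h} → IsProductTerm α β h → IsProductTerm α′ β′ h →
                            size α ≡ size α′ → (α , β) ≡ (α′ , β′)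
  IsProductTerm-injective {α} {β} {α′} {β′} p q size≡
    with ++-cancel-length (trans P.length-prefix (trans size≡ (sym Q.length-prefix)))
                          (trans (sym P.word≡) Q.word≡)
       | ++-cancel-length (trans (length-colors α) (trans size≡ (sym (length-colors α′))))
                          (trans (sym P.colors≡′) Q.colors≡′)
    where module P = IsProductTerm p
          module Q = IsProductTerm q
  ... | prefix≡ , suffix≡ | colorsα , colorsβ = cong₂ _,_
    (basis-ext α α′
      (trans (sym P.std-prefix) (trans (cong (λ xs → map (rankᴸ xs) xs) prefix≡) Q.std-prefix)) colorsα)
    (basis-ext β β′
      (trans (sym P.std-suffix) (trans (cong (λ xs → map (rankᴸ xs) xs) suffix≡) Q.std-suffix)) colorsβ)
    where module P = IsProductTerm p
          module Q = IsProductTerm q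

  sorted-std⁺ : ∀ I xs → length xs ≡ sum I → All Sorted (blocks I xs) →
                All Sorted (blocks I (map (rankᴸ xs) xs))
  sorted-std⁺ I xs len s = subst (All Sorted) (sym (blocks-map (rankᴸ xs) I xs)) (All.map⁺
    (All.map (λ { (b∈ , sb) → rank-sorted⁺ b∈ sb }) (All.zip (inside , s))))
    where
    inside : All (All (_∈ₗ xs)) (blocks I xs)
    inside = All.concat⁻ (subst (All (_∈ₗ xs)) (sym (concat-blocks I xs len)) (All.tabulate id))

  sorted-std⁻ : ∀ I xs → All Sorted (blocks I (map (rankᴸ xs) xs)) → All Sorted (blocks I xs)
  sorted-std⁻ I xs s =
    All.map (rank-sorted⁻ xs) (All.map⁻ (subst (All Sorted) (blocks-map (rankᴸ xs) I xs) s))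

  module _ {I J : List ℕ} {cs ds : List Color} {α β h : Basis}
           (term : IsProductTerm α β h) (len : length I ≡ length cs) where

    open IsProductTerm term

    private
      length-suffix : length suffix ≡ size β
      length-suffix =
        trans (sym (List.length-map _ suffix)) (trans (cong length std-suffix) (length-word β))

      size-h : size h ≡ size α + size β
      size-h = trans (sym (length-word h)) (trans (cong length word≡)
        (trans (List.length-++ prefix) (cong₂ _+_ length-prefix length-suffix)))

      blocks≡ : size α ≡ sum I → blocks (I ++ J) (word h) ≡ blocks I prefix ++ blocks J suffix
      blocks≡ eq =
        trans (cong (blocks (I ++ J)) word≡) (blocks-++ I J prefix suffix (trans length-prefix eq))

    product-blockIncreasing : BlockIncreasing I cs α → BlockIncreasing J ds β →
                              BlockIncreasing (I ++ J) (cs ++ ds) h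
    product-blockIncreasing a b = blockIncreasing
      (trans size-h (trans (cong₂ _+_ (size≡ a) (size≡ b)) (sym (Sum.sum-++ I J))))
      (trans colors≡′ (trans (cong₂ _++_ (colors≡ a) (colors≡ b)) (sym (spread-++ I J cs ds len))))
      (subst (All Sorted) (sym (blocks≡ (size≡ a))) (All.++⁺
        (sorted-std⁻ I prefix (subst (All Sorted ∘ blocks I) (sym std-prefix) (sorted a)))
        (sorted-std⁻ J suffix (subst (All Sorted ∘ blocks J) (sym std-suffix) (sorted b)))))

    product-blockIncreasing⁻ : size α ≡ sum I → size β ≡ sum J →
                               BlockIncreasing (I ++ J) (cs ++ ds) h →
                               BlockIncreasing I cs α × BlockIncreasing J ds β
    product-blockIncreasing⁻ sizeα sizeβ b =
      blockIncreasing sizeα (proj₁ colors₂)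
        (subst (All Sorted ∘ blocks I) std-prefix
          (sorted-std⁺ I prefix (trans length-prefix sizeα) (proj₁ sorted₂))) ,
      blockIncreasing sizeβ (proj₂ colors₂)
        (subst (All Sorted ∘ blocks J) std-suffix
          (sorted-std⁺ J suffix (trans length-suffix sizeβ) (proj₂ sorted₂)))
      where
      colors₂ =
        ++-cancel-length (trans (length-colors α) (trans sizeα (sym (length-spread I cs len))))
        (trans (sym colors≡′) (trans (colors≡ b) (spread-++ I J cs ds len)))
      sorted₂ = All.++⁻ (blocks I prefix) (subst (All Sorted) (blocks≡ sizeα) (sorted b))

  product-↭ : ∀ I J cs ds → length I ≡ length cs →
              concatMap productTerms (cartesianProduct (descentClass I cs) (descentClass J ds)) ↭
              descentClass (I ++ J) (cs ++ ds)
  product-↭ I J cs ds len = unique-↭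
    (concatMap-unique productTerms
      (Unique.cartesianProduct⁺ (descentClass-unique I cs) (descentClass-unique J ds))
      (λ {x} _ → productTerms-unique x)
      -- All left factors have the size `sum I`, so a common term is cut at the same place and
      -- determines both factors.
      (λ { {α , β} {α′ , β′} x∈ x∈′ h∈ h∈′ →
         IsProductTerm-injective (∈-productTerms⁻ α β h∈) (∈-productTerms⁻ α′ β′ h∈′)
         (trans (size≡ (proj₁ (factors x∈))) (sym (size≡ (proj₁ (factors x∈′))))) }))
    (descentClass-unique (I ++ J) (cs ++ ds))
    to from
    where
    pairs = cartesianProduct (descentClass I cs) (descentClass J ds)
    factors : ∀ {α β} → (α , β) ∈ₗ pairs → BlockIncreasing I cs α × BlockIncreasing J ds β
    factors x∈ with ∈.∈-cartesianProduct⁻ (descentClass I cs) (descentClass J ds) x∈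
    ... | α∈ , β∈ = ∈-descentClass⁻ I cs α∈ , ∈-descentClass⁻ J ds β∈
    to : ∀ {h} → h ∈ₗ concatMap productTerms pairs → h ∈ₗ descentClass (I ++ J) (cs ++ ds)
    to h∈ with ∈-concatMap-∃⁻ productTerms pairs h∈
    ... | (α , β) , x∈ , h∈′ =
      ∈-descentClass⁺ (product-blockIncreasing {I} {J} (∈-productTerms⁻ α β h∈′) len
        (proj₁ (factors x∈)) (proj₂ (factors x∈)))
    from : ∀ {h} → h ∈ₗ descentClass (I ++ J) (cs ++ ds) → h ∈ₗ concatMap productTerms pairs
    from {h} h∈ with ∈-descentClass⁻ (I ++ J) (cs ++ ds) h∈
    ... | b with ∈-productTerms-split (sum I) (sum J) h (trans (size≡ b) (Sum.sum-++ I J))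
    ...   | α , β , sizeα , sizeβ , h∈′
      with product-blockIncreasing⁻ {I} {J} (∈-productTerms⁻ α β h∈′) len sizeα sizeβ b
    ...     | a , b′ = ∈-concatMap-∃⁺ productTerms
      (∈.∈-cartesianProduct⁺ (∈-descentClass⁺ a) (∈-descentClass⁺ b′)) h∈′

  completeTerms : Vec ℕ l → List Basis
  completeTerms 𝐧 = map (λ u → Vec.sum 𝐧 , idPerm (Vec.sum 𝐧) , u)
    (List.filter (λ u → Vec.≡-dec ℕ._≟_ (occurrences u) 𝐧) (words (List.allFin l) (Vec.sum 𝐧)))

  single : Color → ℕ → Vec ℕ l
  single i n = Vec.replicate l 0 Vec.[ i ]≔ n

  occurrences-single : ∀ i n {N} → N ≡ n → occurrences (Vec.replicate N i) ≡ single i n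
  occurrences-single i n refl = trans (Vec.tabulate-cong counts) (Vec.tabulate∘lookup (single i n))
    where
    counts : ∀ j → Vec.count (j Fin.≟_) (Vec.replicate n i) ≡ lookup (single i n) j
    counts j with j Fin.≟ i
    ... | yes refl = trans (count-replicate j n) (sym (Vec.lookup∘update j (Vec.replicate l 0) n))
    ... | no  j≢i  = trans (count-replicate-≢ j≢i n)
                           (sym (trans (Vec.lookup∘update′ j≢i (Vec.replicate l 0) n) (Vec.lookup-replicate j 0)))

  -- Both lists have exactly one element: `n` occurrences of `i` in a word of length `n` leave no
  -- room for another color, and one increasing block leaves only the identity.
  completeTerms-single : ∀ i n → completeTerms (single i n) ↭ descentClass (n ∷ []) (i ∷ [])
  completeTerms-single i n = unique-↭
    (Unique.map⁺ (λ { refl → refl }) (Unique.filter⁺ _ (words-unique (Unique.allFin⁺ l) _)))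
    (descentClass-unique (n ∷ []) (i ∷ []))
    (λ h∈ → case ∈.∈-map⁻ _ h∈ of λ { (u , u∈ , refl) →
      ∈-descentClass⁺ (monochromatic i (sum-single i n) (count-full i u
        (trans (count≡ u (proj₂ (∈.∈-filter⁻ _ {xs = words (List.allFin l) _} u∈)))
               (sym (sum-single i n))))) })
    (λ h∈ → subst (_∈ₗ completeTerms (single i n))
      (sym (monochromatic⁻ (∈-descentClass⁻ (n ∷ []) (i ∷ []) h∈) (sum-single i n)))
      (∈.∈-map⁺ _ (∈.∈-filter⁺ _ (∈-words _ ∈.∈-allFin _) (occurrences-single i n (sum-single i n)))))
    where
    count≡ : ∀ {N} (u : Vec Color N) → occurrences u ≡ single i n → Vec.count (i Fin.≟_) u ≡ n
    count≡ u eq = trans (sym (Vec.lookup∘tabulate _ i))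
      (trans (cong (λ v → lookup v i) eq) (Vec.lookup∘update i (Vec.replicate l 0) n))

-- The algebra `MR` as the span of the descent sums

module MantaciReutenauer {c ℓ} (K : CommutativeRing c ℓ) (l : ℕ) .{{l≢0 : NonZero l}} where

  open FreeQuasiSymmetric K l hiding (_≈_)
  open FreeModules K
  open FreeModuleProperties K
  open SpanProperties K
  open ColoredPermutations l
  open ColoredWords l
  open DescentClasses l
  open DescentClassProducts K l
  open BlockIncreasing
  private module K = CommutativeRing K
  open K using () renaming (_≈_ to _≈ᴷ_; _+_ to _⊹_; _*_ to _✶_)
  open SetoidReasoning K.setoid

  𝔻 : List ℕ → List Color → FQSym
  𝔻 I cs = Σ[ descentClass I cs ]

  IsDescentSum : Pred FQSym c
  IsDescentSum x = ∃₂ λ I cs → length I ≡ length cs × x ≡ 𝔻 I cs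

  DescentSpan : Pred FQSym (c ⊔ ℓ)
  DescentSpan = Span _≟_ IsDescentSum

  𝔻∈ : ∀ I cs → length I ≡ length cs → 𝔻 I cs ∈ DescentSpan
  𝔻∈ I cs len = gen (I , cs , len , refl)

  MR-resp : ∀ {x y} → x ≋ y → x ∈ MR → y ∈ MR
  MR-resp {x} {y} x≋y = resp {x = x} {y} (≋⇒Equal _≟_ x≋y)

  ⟦⟧-product : ∀ x y ψ → ⟦ x * y ⟧ ψ ≈ᴷ ⟦ x ⟧ (λ a → ⟦ y ⟧ (λ b → ⟦ product (a , b) ⟧ ψ))
  ⟦⟧-product x y ψ = K.trans (⟦⟧-linear product (x ⊗ y) ψ) (⟦⟧-⊗ x y _)

  𝔻-* : ∀ I J cs ds → length I ≡ length cs → 𝔻 I cs * 𝔻 J ds ≋ 𝔻 (I ++ J) (cs ++ ds)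
  𝔻-* I J cs ds len =
    ≋-intro λ ψ → let pairs = cartesianProduct (descentClass I cs) (descentClass J ds) in begin
    ⟦ 𝔻 I cs * 𝔻 J ds ⟧ ψ                        ≈⟨ ⟦⟧-product (𝔻 I cs) (𝔻 J ds) ψ ⟩
    ⟦ 𝔻 I cs ⟧ (λ a → ⟦ 𝔻 J ds ⟧ (λ b → ⟦ product (a , b) ⟧ ψ))
      ≈⟨ Σ-cartesianProduct (descentClass I cs) (descentClass J ds) _ ⟨
    ⟦ Σ[ pairs ] ⟧ (λ x → ⟦ product x ⟧ ψ)       ≈⟨ Σ-concatMap productTerms pairs ψ ⟨
    ⟦ Σ[ concatMap productTerms pairs ] ⟧ ψ      ≈⟨ ⟦Σ⟧-↭ (product-↭ I J cs ds len) ψ ⟩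
    ⟦ 𝔻 (I ++ J) (cs ++ ds) ⟧ ψ                  ∎

  S⟨⟩-𝔻 : ∀ i n → S⟨ i ⟩ n ≋ 𝔻 (n ∷ []) (i ∷ [])
  S⟨⟩-𝔻 i n = Σ-↭ (completeTerms-single i n)

  𝟙-𝔻 : 𝟙 ≋ 𝔻 [] []
  𝟙-𝔻 = Σ-↭ descentClass-empty

  -- A nonempty first block splits off as a factor `S⟨ c ⟩ (suc k)`. An empty one is deleted, the
  -- generators being of positive degree.
  𝔻∈MR : ∀ I cs → length I ≡ length cs → 𝔻 I cs ∈ MR
  𝔻∈MR []          []       len = MR-resp 𝟙-𝔻 1∈
  𝔻∈MR (zero  ∷ I) (c ∷ cs) len =
    MR-resp (≋-sym (Σ-↭ (descentClass-zero I c cs))) (𝔻∈MR I cs (ℕ.suc-injective len))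
  𝔻∈MR (suc k ∷ I) (c ∷ cs) len = MR-resp (𝔻-* (suc k ∷ []) I (c ∷ []) cs refl)
    (*∈ (MR-resp (S⟨⟩-𝔻 c (suc k)) (gen (suc k , c , s≤s z≤n , refl))) (𝔻∈MR I cs (ℕ.suc-injective len)))

  DescentSpan⊆MR : DescentSpan ⊆ MR
  DescentSpan⊆MR (gen (I , cs , len , refl)) = 𝔻∈MR I cs len
  DescentSpan⊆MR 0∈            = 0∈
  DescentSpan⊆MR (+∈ x∈ y∈)    = +∈ (DescentSpan⊆MR x∈) (DescentSpan⊆MR y∈)
  DescentSpan⊆MR (·∈ k x∈)     = ·∈ k (DescentSpan⊆MR x∈)
  DescentSpan⊆MR (resp {x} {y} x≈y x∈) = resp {x = x} {y} x≈y (DescentSpan⊆MR x∈)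

  -- For fixed `x`, the product `x * y` is the linear extension of `b ↦ x * [ b ]`, so `span-linear`
  -- applies. `DescentSpan-*` uses this and `span-*ˡ` in succession to reduce both factors to
  -- generators.
  span-*ʳ : ∀ x → (∀ I cs → length I ≡ length cs → x * 𝔻 I cs ∈ DescentSpan) →
            ∀ {y} → y ∈ DescentSpan → x * y ∈ DescentSpan
  span-*ʳ x x*𝔻∈ {y} y∈ = span-resp _≟_ (≋-sym (expand y))
    (span-linear _≟_ _≟_ (λ b → x * [ b ])
      (λ { (I , cs , len , refl) → span-resp _≟_ (expand (𝔻 I cs)) (x*𝔻∈ I cs len) }) y∈)
    where
    expand : ∀ y → x * y ≋ linear (λ b → x * [ b ]) y
    expand y = ≋-intro λ ψ → begin
      ⟦ x * y ⟧ ψ                                              ≈⟨ ⟦⟧-product x y ψ ⟩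
      ⟦ x ⟧ (λ a → ⟦ y ⟧ (λ b → ⟦ product (a , b) ⟧ ψ))        ≈⟨ ⟦⟧-swap x y _ ⟩
      ⟦ y ⟧ (λ b → ⟦ x ⟧ (λ a → ⟦ product (a , b) ⟧ ψ))
        ≈⟨ ⟦⟧-cong y (λ b → K.trans (⟦⟧-product x [ b ] ψ)
             (⟦⟧-cong x λ a → ⟦⟧-[] b (λ b → ⟦ product (a , b) ⟧ ψ))) ⟨
      ⟦ y ⟧ (λ b → ⟦ x * [ b ] ⟧ ψ)                            ≈⟨ ⟦⟧-linear (λ b → x * [ b ]) y ψ ⟨
      ⟦ linear (λ b → x * [ b ]) y ⟧ ψ                         ∎

  span-*ˡ : ∀ y → (∀ I cs → length I ≡ length cs → 𝔻 I cs * y ∈ DescentSpan) →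
            ∀ {x} → x ∈ DescentSpan → x * y ∈ DescentSpan
  span-*ˡ y 𝔻*y∈ {x} x∈ = span-resp _≟_ (≋-sym (expand x))
    (span-linear _≟_ _≟_ (λ a → [ a ] * y)
      (λ { (I , cs , len , refl) → span-resp _≟_ (expand (𝔻 I cs)) (𝔻*y∈ I cs len) }) x∈)
    where
    expand : ∀ x → x * y ≋ linear (λ a → [ a ] * y) x
    expand x = ≋-intro λ ψ → begin
      ⟦ x * y ⟧ ψ                                              ≈⟨ ⟦⟧-product x y ψ ⟩
      ⟦ x ⟧ (λ a → ⟦ y ⟧ (λ b → ⟦ product (a , b) ⟧ ψ))
        ≈⟨ ⟦⟧-cong x (λ a → K.trans (⟦⟧-product [ a ] y ψ)
             (⟦⟧-[] a (λ a → ⟦ y ⟧ (λ b → ⟦ product (a , b) ⟧ ψ)))) ⟨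
      ⟦ x ⟧ (λ a → ⟦ [ a ] * y ⟧ ψ)                            ≈⟨ ⟦⟧-linear (λ a → [ a ] * y) x ψ ⟨
      ⟦ linear (λ a → [ a ] * y) x ⟧ ψ                         ∎

  DescentSpan-* : ∀ {x y} → x ∈ DescentSpan → y ∈ DescentSpan → x * y ∈ DescentSpan
  DescentSpan-* {x} {y} x∈ y∈ = span-*ˡ y
    (λ I cs len → span-*ʳ (𝔻 I cs)
      (λ J ds len′ → span-resp _≟_ (≋-sym (𝔻-* I J cs ds len))
        (𝔻∈ (I ++ J) (cs ++ ds) (trans (List.length-++ I)
          (trans (cong₂ _+_ len len′) (sym (List.length-++ cs)))))) y∈) x∈

  MR⊆DescentSpan : MR ⊆ DescentSpan
  MR⊆DescentSpan (gen (n , i , _ , refl)) =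
    span-resp _≟_ (≋-sym (S⟨⟩-𝔻 i n)) (𝔻∈ (n ∷ []) (i ∷ []) refl)
  MR⊆DescentSpan (resp {x} {y} x≈y x∈) = resp {x = x} {y} x≈y (MR⊆DescentSpan x∈)
  MR⊆DescentSpan 0∈            = 0∈
  MR⊆DescentSpan (+∈ x∈ y∈)    = +∈ (MR⊆DescentSpan x∈) (MR⊆DescentSpan y∈)
  MR⊆DescentSpan (·∈ k x∈)     = ·∈ k (MR⊆DescentSpan x∈)
  MR⊆DescentSpan 1∈            = span-resp _≟_ (≋-sym 𝟙-𝔻) (𝔻∈ [] [] refl)
  MR⊆DescentSpan (*∈ x∈ y∈)    = DescentSpan-* (MR⊆DescentSpan x∈) (MR⊆DescentSpan y∈)

  MR⊆Sym : MR ⊆ Sym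
  MR⊆Sym (gen (n , i , _ , refl)) U hopf X⊆U = X⊆U (single i n , refl)
  MR⊆Sym (resp {x} {y} x≈y x∈) U hopf X⊆U = ≈-closed {x} {y} x≈y (MR⊆Sym x∈ U hopf X⊆U)
    where open IsSubalgebra (IsHopfSubalgebra.isSubalgebra hopf)
  MR⊆Sym 0∈ U hopf X⊆U = 0-closed
    where open IsSubalgebra (IsHopfSubalgebra.isSubalgebra hopf)
  MR⊆Sym (+∈ x∈ y∈) U hopf X⊆U = +-closed (MR⊆Sym x∈ U hopf X⊆U) (MR⊆Sym y∈ U hopf X⊆U)
    where open IsSubalgebra (IsHopfSubalgebra.isSubalgebra hopf)
  MR⊆Sym (·∈ k x∈) U hopf X⊆U = ·-closed k (MR⊆Sym x∈ U hopf X⊆U)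
    where open IsSubalgebra (IsHopfSubalgebra.isSubalgebra hopf)
  MR⊆Sym 1∈ U hopf X⊆U = 1-closed
    where open IsSubalgebra (IsHopfSubalgebra.isSubalgebra hopf)
  MR⊆Sym (*∈ x∈ y∈) U hopf X⊆U = *-closed (MR⊆Sym x∈ U hopf X⊆U) (MR⊆Sym y∈ U hopf X⊆U)
    where open IsSubalgebra (IsHopfSubalgebra.isSubalgebra hopf)

  -- Grading

  projection : ℕ → Basis → FQSym
  projection n h = if does (size h ℕ.≟ n) then [ h ] else []

  -- `component` filters the terms of a list. Written as a linear extension it becomes accessible to
  -- `⟦⟧-linear` and `span-linear`.
  component-linear : ∀ n x → component n x ≋ linear (projection n) x
  component-linear n x = ≋-intro (terms x)
    where
    terms : ∀ x ψ → ⟦ component n x ⟧ ψ ≈ᴷ ⟦ linear (projection n) x ⟧ ψ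
    terms []            ψ = K.refl
    terms ((k , h) ∷ x) ψ with does (size h ℕ.≟ n)
    ... | true  = K.+-cong (K.*-congʳ (K.sym (K.*-identityʳ k))) (terms x ψ)
    ... | false = terms x ψ

  component-cong : ∀ n {x y} → x ≋ y → component n x ≋ component n y
  component-cong n {x} {y} x≋y = ≋-intro λ ψ → begin
    ⟦ component n x ⟧ ψ                     ≈⟨ at (component-linear n x) ψ ⟩
    ⟦ linear (projection n) x ⟧ ψ           ≈⟨ ⟦⟧-linear (projection n) x ψ ⟩
    ⟦ x ⟧ (λ h → ⟦ projection n h ⟧ ψ)      ≈⟨ at x≋y _ ⟩
    ⟦ y ⟧ (λ h → ⟦ projection n h ⟧ ψ)      ≈⟨ ⟦⟧-linear (projection n) y ψ ⟨
    ⟦ linear (projection n) y ⟧ ψ           ≈⟨ at (component-linear n y) ψ ⟨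
    ⟦ component n y ⟧ ψ                     ∎

  component-Σ-all : ∀ n (hs : List Basis) → All (λ h → size h ≡ n) hs → component n Σ[ hs ] ≡ Σ[ hs ]
  component-Σ-all n hs all = List.filter-all _ (All.map⁺ all)

  component-Σ-none : ∀ n (hs : List Basis) → All (λ h → size h ≢ n) hs → component n Σ[ hs ] ≡ []
  component-Σ-none n hs none = List.filter-none _ (All.map⁺ none)

  sizes : ∀ I cs → All (λ h → size h ≡ sum I) (descentClass I cs)
  sizes I cs = All.tabulate λ h∈ → size≡ (∈-descentClass⁻ I cs h∈)

  component-𝔻 : ∀ I cs → component (sum I) (𝔻 I cs) ≡ 𝔻 I cs
  component-𝔻 I cs = component-Σ-all (sum I) (descentClass I cs) (sizes I cs)

  component-𝔻-≢ : ∀ {n} I cs → sum I ≢ n → component n (𝔻 I cs) ≡ []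
  component-𝔻-≢ {n} I cs I≢n =
    component-Σ-none n (descentClass I cs) (All.map (λ eq eq′ → I≢n (trans (sym eq) eq′)) (sizes I cs))

  DescentSpan-component : ∀ n {x} → x ∈ DescentSpan → component n x ∈ DescentSpan
  DescentSpan-component n {x} x∈ = span-resp _≟_ (≋-sym (component-linear n x))
    (span-linear _≟_ _≟_ (projection n) (λ { (I , cs , len , refl) → homogeneous I cs len }) x∈)
    where
    homogeneous : ∀ I cs → length I ≡ length cs → linear (projection n) (𝔻 I cs) ∈ DescentSpan
    homogeneous I cs len with sum I ℕ.≟ n
    ... | yes refl = span-resp _≟_
      (≋-trans (≋-reflexive (sym (component-𝔻 I cs))) (component-linear n (𝔻 I cs))) (𝔻∈ I cs len)
    ... | no I≢n   = span-resp _≟_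
      (≋-trans (≋-reflexive (sym (component-𝔻-≢ I cs I≢n))) (component-linear n (𝔻 I cs))) 0∈

  -- Coproduct

  cut : ℕ → Basis → Basis × Basis
  cut i h = lower i h , upper i h

  cutTerms : List ℕ → List Color → ℕ → FQSym²
  cutTerms I cs i = concatMap (λ { (J , K) → 𝔻 J cs ⊗ 𝔻 K cs }) (splitsAt I i)

  cut-𝔻 : ∀ I cs → length I ≡ length cs → ∀ {i} → i ≤ sum I →
          Σ[ map (cut i) (descentClass I cs) ] ≋ cutTerms I cs i
  cut-𝔻 I cs len {i} i≤n = ≋-intro λ ψ → begin
    ⟦ Σ[ map (cut i) (descentClass I cs) ] ⟧ ψ       ≈⟨ ⟦Σ⟧-↭ cut-↭ ψ ⟩
    ⟦ Σ[ map proj₂ halves ] ⟧ ψ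
      ≡⟨ cong (λ xs → ⟦ Σ[ xs ] ⟧ ψ) halves-concatMap ⟩
    ⟦ Σ[ concatMap pairs (splitsAt I i) ] ⟧ ψ        ≈⟨ Σ-concatMap pairs (splitsAt I i) ψ ⟩
    ⟦ Σ[ splitsAt I i ] ⟧ (λ JK → ⟦ Σ[ pairs JK ] ⟧ ψ)
      ≈⟨ ⟦⟧-cong Σ[ splitsAt I i ] (λ { (J , K) → K.trans (Σ-cartesianProduct (descentClass J cs) (descentClass K cs) ψ)
                                                         (K.sym (⟦⟧-⊗ (𝔻 J cs) (𝔻 K cs) ψ)) }) ⟩
    ⟦ Σ[ splitsAt I i ] ⟧ (λ JK → ⟦ terms JK ⟧ ψ)    ≈⟨ ⟦⟧-concatMap terms (splitsAt I i) ψ ⟨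
    ⟦ cutTerms I cs i ⟧ ψ                            ∎
    where
    open Cut I cs len i≤n
    pairs : List ℕ × List ℕ → List (Basis × Basis)
    pairs = λ { (J , K) → cartesianProduct (descentClass J cs) (descentClass K cs) }
    terms : List ℕ × List ℕ → FQSym²
    terms = λ { (J , K) → 𝔻 J cs ⊗ 𝔻 K cs }

  Δᴮ : Basis → FQSym²
  Δᴮ h = Σ[ map (λ i → cut i h) (upTo (suc (size h))) ]

  -- The range of the cuts in the coproduct depends on the word. On a descent class all words have
  -- size `sum I`, so the range is constant and the sum over words can be exchanged with the sum
  -- over cuts; each cut is then `cut-𝔻`.
  Δ-𝔻 : ∀ I cs → length I ≡ length cs → Δ (𝔻 I cs) ≋ concatMap (cutTerms I cs) (upTo (suc (sum I)))
  Δ-𝔻 I cs len = ≋-intro λ ψ → begin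
    ⟦ Δ (𝔻 I cs) ⟧ ψ                                 ≈⟨ ⟦⟧-linear Δᴮ (𝔻 I cs) ψ ⟩
    ⟦ 𝔻 I cs ⟧ (λ h → ⟦ Δᴮ h ⟧ ψ)
      ≈⟨ Σ-cong-∈ hs (λ h h∈ → K.reflexive (cong (λ n → ⟦ Σ[ map (λ i → cut i h) (upTo (suc n)) ] ⟧ ψ)
                                                 (All.lookup (sizes I cs) h∈))) ⟩
    ⟦ 𝔻 I cs ⟧ (λ h → ⟦ Σ[ map (λ i → cut i h) is ] ⟧ ψ)
      ≈⟨ Σ-concatMap (λ h → map (λ i → cut i h) is) hs ψ ⟨
    ⟦ Σ[ concatMap (λ h → map (λ i → cut i h) is) hs ] ⟧ ψ
      ≈⟨ ⟦Σ⟧-↭ (concatMap-swap (λ h i → cut i h) hs is) ψ ⟩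
    ⟦ Σ[ concatMap (λ i → map (cut i) hs) is ] ⟧ ψ   ≈⟨ Σ-concatMap (λ i → map (cut i) hs) is ψ ⟩
    ⟦ Σ[ is ] ⟧ (λ i → ⟦ Σ[ map (cut i) hs ] ⟧ ψ)
      ≈⟨ Σ-cong-∈ is (λ i i∈ → at (cut-𝔻 I cs len (ℕ.≤-pred (∈.∈-upTo⁻ i∈))) ψ) ⟩
    ⟦ Σ[ is ] ⟧ (λ i → ⟦ cutTerms I cs i ⟧ ψ)        ≈⟨ ⟦⟧-concatMap (cutTerms I cs) is ψ ⟨
    ⟦ concatMap (cutTerms I cs) is ⟧ ψ               ∎
    where hs = descentClass I cs
          is = upTo (suc (sum I))

  splitsAt-aligned : ∀ I (cs : List Color) → length I ≡ length cs → ∀ {i J K} →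
                     (J , K) ∈ₗ splitsAt I i →
                     length J ≡ length cs × length K ≡ length cs × sum J ≡ i
  splitsAt-aligned I cs len JK∈ with ∈.∈-filter⁻ _ {xs = splits I} JK∈
  ... | JK∈splits , sumJ with ∈-splits⁻ I JK∈splits
  ...   | _ , lenJ , lenK = trans lenJ len , trans lenK len , sumJ

  MR-Δ : ∀ {x} → x ∈ MR → Δ x ∈ TensorSquare MR
  MR-Δ x∈ = span-linear _≟_ _≟²_ Δᴮ (λ { (I , cs , len , refl) → Δ𝔻∈ I cs len }) (MR⊆DescentSpan x∈)
    where
    _≟²_ = Product.≡-dec _≟_ _≟_
    Δ𝔻∈ : ∀ I cs → length I ≡ length cs → Δ (𝔻 I cs) ∈ TensorSquare MR
    Δ𝔻∈ I cs len = span-resp _≟²_ (≋-sym (Δ-𝔻 I cs len))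
      (span-concatMap _≟²_ (cutTerms I cs) (upTo (suc (sum I))) λ {i} _ →
        span-concatMap _≟²_ _ (splitsAt I i) λ { {J , K} JK∈ →
          let lenJ , lenK , _ = splitsAt-aligned I cs len JK∈ in
          gen (𝔻 J cs , 𝔻 K cs , 𝔻∈MR J cs lenJ , 𝔻∈MR K cs lenK , refl) })

  -- Antipode

  antipodeᴮ : Basis → FQSym
  antipodeᴮ h = antipodeᵇ (size h) h

  -- The recursive calls are at elements of size `i ≤ n`, so fuel that bounds the size keeps doing
  -- so. Hence the fuelled recursion of `antipodeᵇ` can be read as a recursion of the antipode
  -- itself, which is `antipode-suc`.
  antipode-fuel : ∀ f g h → size h ≤ f → size h ≤ g → antipodeᵇ f h ≡ antipodeᵇ g h
  antipode-fuel zero    zero    h           _         _         = refl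
  antipode-fuel zero    (suc g) (zero , _)  _         _         = refl
  antipode-fuel (suc f) zero    (zero , _)  _         _         = refl
  antipode-fuel (suc f) (suc g) (zero , _)  _         _         = refl
  antipode-fuel (suc f) (suc g) h@(suc n , _) (s≤s n≤f) (s≤s n≤g) =
    cong (λ xs → -ᶠ List.concat xs) (List.map-cong-local (All.map step (upTo-< (suc n))))
    where
    step : ∀ {i} → i < suc n → antipodeᵇ f (restrict h 1 i) * [ restrict h (suc i) (suc n) ] ≡
                               antipodeᵇ g (restrict h 1 i) * [ restrict h (suc i) (suc n) ]
    step {i} (s≤s i≤n) = cong (_* [ restrict h (suc i) (suc n) ])
      (antipode-fuel f g (restrict h 1 i) (bound n≤f) (bound n≤g))
      where
      bound : ∀ {m} → n ≤ m → size (restrict h 1 i) ≤ m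
      bound n≤m = subst (_≤ _) (sym (size-lower h (ℕ.m≤n⇒m≤1+n i≤n))) (ℕ.≤-trans i≤n n≤m)

  antipodeStep : Basis × Basis → FQSym
  antipodeStep (α , β) = antipodeᴮ α * [ β ]

  antipode-suc : ∀ {n} h → size h ≡ suc n →
                 antipodeᴮ h ≡ -ᶠ concatMap (λ i → antipodeStep (cut i h)) (upTo (suc n))
  antipode-suc {n} h@(_ , _) refl =
    cong (λ xs → -ᶠ List.concat xs) (List.map-cong-local (All.map step (upTo-< (suc n))))
    where
    step : ∀ {i} → i < suc n → antipodeᵇ n (lower i h) * [ upper i h ] ≡ antipodeStep (cut i h)
    step {i} (s≤s i≤n) = cong (_* [ upper i h ]) (antipode-fuel n (size (lower i h)) (lower i h)
      (subst (_≤ n) (sym (size-lower h (ℕ.m≤n⇒m≤1+n i≤n))) i≤n) ℕ.≤-refl)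

  -- The map `linear antipodeStep` is μ ∘ (S ⊗ id). This turns the tensors `𝔻 J cs ⊗ 𝔻 K cs`
  -- produced by a cut into products to which induction applies.
  antipodeStep-⊗ : ∀ x y → linear antipodeStep (x ⊗ y) ≋ antipode x * y
  antipodeStep-⊗ x y = ≋-intro λ ψ → begin
    ⟦ linear antipodeStep (x ⊗ y) ⟧ ψ                      ≈⟨ ⟦⟧-linear antipodeStep (x ⊗ y) ψ ⟩
    ⟦ x ⊗ y ⟧ (λ p → ⟦ antipodeStep p ⟧ ψ)                 ≈⟨ ⟦⟧-⊗ x y _ ⟩
    ⟦ x ⟧ (λ a → ⟦ y ⟧ (λ b → ⟦ antipodeᴮ a * [ b ] ⟧ ψ))
      ≈⟨ ⟦⟧-cong x (λ a → ⟦⟧-cong y λ b → K.trans (⟦⟧-product (antipodeᴮ a) [ b ] ψ)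
           (⟦⟧-cong (antipodeᴮ a) λ c → ⟦⟧-[] b (λ b → ⟦ product (c , b) ⟧ ψ))) ⟩
    ⟦ x ⟧ (λ a → ⟦ y ⟧ (λ b → ⟦ antipodeᴮ a ⟧ (λ c → ⟦ product (c , b) ⟧ ψ)))
      ≈⟨ ⟦⟧-cong x (λ a → ⟦⟧-swap y (antipodeᴮ a) (λ b c → ⟦ product (c , b) ⟧ ψ)) ⟩
    ⟦ x ⟧ (λ a → ⟦ antipodeᴮ a ⟧ (λ c → ⟦ y ⟧ (λ b → ⟦ product (c , b) ⟧ ψ)))
      ≈⟨ ⟦⟧-linear antipodeᴮ x _ ⟨
    ⟦ antipode x ⟧ (λ c → ⟦ y ⟧ (λ b → ⟦ product (c , b) ⟧ ψ)) ≈⟨ ⟦⟧-product (antipode x) y ψ ⟨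
    ⟦ antipode x * y ⟧ ψ                                   ∎

  antipode-𝔻 : ∀ {n} I cs → length I ≡ length cs → sum I ≡ suc n →
    antipode (𝔻 I cs) ≋ -ᶠ concatMap (λ i → linear antipodeStep (cutTerms I cs i)) (upTo (suc n))
  antipode-𝔻 {n} I cs len eq = ≋-intro λ ψ → begin
    ⟦ antipode (𝔻 I cs) ⟧ ψ                         ≈⟨ ⟦⟧-linear antipodeᴮ (𝔻 I cs) ψ ⟩
    ⟦ 𝔻 I cs ⟧ (λ h → ⟦ antipodeᴮ h ⟧ ψ)            ≈⟨ Σ-cong-∈ hs (expand ψ) ⟩
    ⟦ 𝔻 I cs ⟧ (λ h → -1# ✶ ⟦ Σ[ is ] ⟧ (λ i → ⟦ antipodeStep (cut i h) ⟧ ψ))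
      ≈⟨ ⟦⟧-* -1# (𝔻 I cs) _ ⟩
    -1# ✶ ⟦ 𝔻 I cs ⟧ (λ h → ⟦ Σ[ is ] ⟧ (λ i → ⟦ antipodeStep (cut i h) ⟧ ψ))
      ≈⟨ K.*-congˡ (⟦⟧-swap (𝔻 I cs) Σ[ is ] _) ⟩
    -1# ✶ ⟦ Σ[ is ] ⟧ (λ i → ⟦ 𝔻 I cs ⟧ (λ h → ⟦ antipodeStep (cut i h) ⟧ ψ))
      ≈⟨ K.*-congˡ (Σ-cong-∈ is (regroup ψ)) ⟩
    -1# ✶ ⟦ Σ[ is ] ⟧ (λ i → ⟦ linear antipodeStep (cutTerms I cs i) ⟧ ψ)
      ≈⟨ K.*-congˡ (⟦⟧-concatMap (λ i → linear antipodeStep (cutTerms I cs i)) is ψ) ⟨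
    -1# ✶ ⟦ concatMap (λ i → linear antipodeStep (cutTerms I cs i)) is ⟧ ψ
      ≈⟨ ⟦⟧-· -1# (concatMap (λ i → linear antipodeStep (cutTerms I cs i)) is) ψ ⟨
    ⟦ -ᶠ concatMap (λ i → linear antipodeStep (cutTerms I cs i)) is ⟧ ψ ∎
    where
    hs = descentClass I cs
    -- One cut fewer than in `Δ-𝔻`: the cut at `suc n` would give S(h) times the unit, which is the
    -- term being solved for.
    is = upTo (suc n)
    -1# = K.- K.1#
    expand : ∀ ψ h → h ∈ₗ hs →
             ⟦ antipodeᴮ h ⟧ ψ ≈ᴷ -1# ✶ ⟦ Σ[ is ] ⟧ (λ i → ⟦ antipodeStep (cut i h) ⟧ ψ)
    expand ψ h h∈ = begin
      ⟦ antipodeᴮ h ⟧ ψ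
        ≡⟨ cong (λ x → ⟦ x ⟧ ψ) (antipode-suc h (trans (All.lookup (sizes I cs) h∈) eq)) ⟩
      ⟦ -ᶠ steps ⟧ ψ    ≈⟨ ⟦⟧-· -1# steps ψ ⟩
      -1# ✶ ⟦ steps ⟧ ψ ≈⟨ K.*-congˡ (⟦⟧-concatMap (λ i → antipodeStep (cut i h)) is ψ) ⟩
      -1# ✶ ⟦ Σ[ is ] ⟧ (λ i → ⟦ antipodeStep (cut i h) ⟧ ψ) ∎
      where steps = concatMap (λ i → antipodeStep (cut i h)) is
    regroup : ∀ ψ i → i ∈ₗ is →
              ⟦ 𝔻 I cs ⟧ (λ h → ⟦ antipodeStep (cut i h) ⟧ ψ) ≈ᴷ ⟦ linear antipodeStep (cutTerms I cs i) ⟧ ψ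
    regroup ψ i i∈ = begin
      ⟦ 𝔻 I cs ⟧ (λ h → ⟦ antipodeStep (cut i h) ⟧ ψ)
        ≈⟨ Σ-map (cut i) hs (λ p → ⟦ antipodeStep p ⟧ ψ) ⟨
      ⟦ Σ[ map (cut i) hs ] ⟧ (λ p → ⟦ antipodeStep p ⟧ ψ)
        ≈⟨ at (cut-𝔻 I cs len (subst (i ≤_) (sym eq) (ℕ.<⇒≤ (∈.∈-upTo⁻ i∈)))) _ ⟩
      ⟦ cutTerms I cs i ⟧ (λ p → ⟦ antipodeStep p ⟧ ψ)
        ≈⟨ ⟦⟧-linear antipodeStep (cutTerms I cs i) ψ ⟨
      ⟦ linear antipodeStep (cutTerms I cs i) ⟧ ψ      ∎

  linear-concatMap : ∀ {A B C : Set} (φ : B → Free C) (F : A → Free B) (xs : List A) →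
                     linear φ (concatMap F xs) ≋ concatMap (λ x → linear φ (F x)) xs
  linear-concatMap φ F xs = ≋-intro λ ψ → begin
    ⟦ linear φ (concatMap F xs) ⟧ ψ                  ≈⟨ ⟦⟧-linear φ (concatMap F xs) ψ ⟩
    ⟦ concatMap F xs ⟧ (λ y → ⟦ φ y ⟧ ψ)             ≈⟨ ⟦⟧-concatMap F xs _ ⟩
    ⟦ Σ[ xs ] ⟧ (λ x → ⟦ F x ⟧ (λ y → ⟦ φ y ⟧ ψ))
      ≈⟨ ⟦⟧-cong Σ[ xs ] (λ x → ⟦⟧-linear φ (F x) ψ) ⟨
    ⟦ Σ[ xs ] ⟧ (λ x → ⟦ linear φ (F x) ⟧ ψ)         ≈⟨ ⟦⟧-concatMap (λ x → linear φ (F x)) xs ψ ⟨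
    ⟦ concatMap (λ x → linear φ (F x)) xs ⟧ ψ        ∎

  antipode-𝔻-zero : ∀ I cs → sum I ≡ 0 → antipode (𝔻 I cs) ≋ concatMap (λ _ → 𝟙) (descentClass I cs)
  antipode-𝔻-zero I cs eq = ≋-intro λ ψ → begin
    ⟦ antipode (𝔻 I cs) ⟧ ψ               ≈⟨ ⟦⟧-linear antipodeᴮ (𝔻 I cs) ψ ⟩
    ⟦ 𝔻 I cs ⟧ (λ h → ⟦ antipodeᴮ h ⟧ ψ)
      ≈⟨ Σ-cong-∈ hs (λ h h∈ → K.reflexive (cong (λ x → ⟦ x ⟧ ψ)
           (unit h (trans (All.lookup (sizes I cs) h∈) eq)))) ⟩
    ⟦ 𝔻 I cs ⟧ (λ _ → ⟦ 𝟙 ⟧ ψ)            ≈⟨ ⟦⟧-concatMap (λ _ → 𝟙) hs ψ ⟨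
    ⟦ concatMap (λ _ → 𝟙) hs ⟧ ψ          ∎
    where
    hs = descentClass I cs
    unit : ∀ h → size h ≡ 0 → antipodeᴮ h ≡ 𝟙
    unit (_ , _) refl = refl

  -- Strong induction on the degree: in S(x) = - Σ S(x₍₁₎) x₍₂₎ only components
  -- x₍₁₎ of smaller degree occur.
  antipode-𝔻∈ : ∀ N {n} I cs → length I ≡ length cs → sum I ≡ n → n ≤ N →
                antipode (𝔻 I cs) ∈ DescentSpan
  antipode-𝔻∈ N       {zero}  I cs len eq _         =
    span-resp _≟_ (≋-sym (antipode-𝔻-zero I cs eq))
    (span-concatMap _≟_ (λ _ → 𝟙) (descentClass I cs) λ _ → span-resp _≟_ (≋-sym 𝟙-𝔻) (𝔻∈ [] [] refl))
  antipode-𝔻∈ (suc N) {suc n} I cs len eq (s≤s n≤N) = span-resp _≟_ (≋-sym (antipode-𝔻 I cs len eq))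
    (·∈ (K.- K.1#) (span-concatMap _≟_ _ (upTo (suc n)) λ {i} i∈ →
      span-resp _≟_ (≋-sym (linear-concatMap antipodeStep _ (splitsAt I i)))
        (span-concatMap _≟_ _ (splitsAt I i) λ { {J , K} JK∈ →
          let lenJ , lenK , sumJ = splitsAt-aligned I cs len JK∈ in
          span-resp _≟_ (≋-sym (antipodeStep-⊗ (𝔻 J cs) (𝔻 K cs)))
            (DescentSpan-* (antipode-𝔻∈ N J cs lenJ sumJ (ℕ.≤-trans (ℕ.≤-pred (∈.∈-upTo⁻ i∈)) n≤N))
                           (𝔻∈ K cs lenK)) })))

  MR-antipode : ∀ {x} → x ∈ MR → antipode x ∈ MR
  MR-antipode x∈ = DescentSpan⊆MR (span-linear _≟_ _≟_ antipodeᴮ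
    (λ { (I , cs , len , refl) → antipode-𝔻∈ (sum I) I cs len refl ℕ.≤-refl }) (MR⊆DescentSpan x∈))

  MR-isHopfSubalgebra : IsHopfSubalgebra MR
  MR-isHopfSubalgebra = record
    { isSubalgebra = record
      { ≈-closed = λ {x} {y} → resp {x = x} {y}
      ; 0-closed = 0∈ ; +-closed = +∈ ; ·-closed = ·∈ ; 1-closed = 1∈ ; *-closed = *∈ }
    ; Δ-closed = MR-Δ
    ; antipode-closed = MR-antipode
    }

  MR-isGraded : IsGraded MR
  MR-isGraded n x∈ = DescentSpan⊆MR (DescentSpan-component n (MR⊆DescentSpan x∈))

  -- Comparison with the descent algebras

  embed-⟦⟧ : ∀ {n} (z : GroupAlgebra n) ψ → ⟦ embed n z ⟧ ψ ≈ᴷ ⟦ z ⟧ (λ h → ψ (n , h))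
  embed-⟦⟧ {n} z ψ = K.trans (⟦⟧-linear G z ψ) (⟦⟧-cong z λ h → ⟦⟧-[] (n , h) ψ)

  embed-D : ∀ {n} (I : Composition n) v → embed n (D I v) ≋ 𝔻 (Composition.parts I) (toList v)
  -- Matching on `sums` turns `n` into `sum parts`, after which both sides filter the same list of
  -- colored permutations.
  embed-D I@(record { parts = parts ; sums = refl }) v = ≋-intro λ ψ → begin
    ⟦ embed _ (D I v) ⟧ ψ                   ≈⟨ embed-⟦⟧ (D I v) ψ ⟩
    ⟦ Σ[ filter _ hs ] ⟧ (λ h → ψ (_ , h))  ≈⟨ Σ-map (_ ,_) (filter _ hs) ψ ⟨
    ⟦ Σ[ map (_ ,_) (filter _ hs) ] ⟧ ψ     ≡⟨ cong (λ xs → ⟦ Σ[ map (_ ,_) xs ] ⟧ ψ)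
                                                 (List.filter-≐ _ (descentClass? parts (toList v)) (id , id) hs) ⟩
    ⟦ 𝔻 parts (toList v) ⟧ ψ ∎
    where hs = coloredPermutations (sum parts)

  component-embed : ∀ {n} (z : GroupAlgebra n) → component n (embed n z) ≋ embed n z
  component-embed {n} z = ≋-intro λ ψ → begin
    ⟦ component n (embed n z) ⟧ ψ               ≈⟨ at (component-linear n (embed n z)) ψ ⟩
    ⟦ linear (projection n) (embed n z) ⟧ ψ     ≈⟨ ⟦⟧-linear (projection n) (embed n z) ψ ⟩
    ⟦ embed n z ⟧ (λ h → ⟦ projection n h ⟧ ψ)  ≈⟨ embed-⟦⟧ z _ ⟩
    ⟦ z ⟧ (λ h → ⟦ projection n (n , h) ⟧ ψ)
      ≈⟨ ⟦⟧-cong z (λ h → K.trans (K.reflexive (cong (λ x → ⟦ x ⟧ ψ) (fixed h))) (⟦⟧-[] (n , h) ψ)) ⟩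
    ⟦ z ⟧ (λ h → ψ (n , h))                     ≈⟨ embed-⟦⟧ z ψ ⟨
    ⟦ embed n z ⟧ ψ                             ∎
    where
    fixed : ∀ h → projection n (n , h) ≡ [ n , h ]
    fixed h = cong (λ b → if b then [ n , h ] else []) (dec-true (n ℕ.≟ n) refl)

  -- Stated for `component n x` with arbitrary `x`, because a derivation of membership in the span
  -- of a homogeneous element may pass through inhomogeneous ones. For a generator of degree `n`,
  -- `compress` supplies the positive parts that a `Composition` requires.
  descent-component : ∀ n {x} → x ∈ DescentSpan → ∃ λ z → z ∈ DescentAlgebra n × component n x ≋ embed n z
  descent-component n (gen (I , cs , len , refl)) with sum I ℕ.≟ n
  ... | no I≢n   = 0ᶠ , 0∈ , ≋-reflexive (component-𝔻-≢ I cs I≢n)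
  ... | yes refl with aligned-vec (Compressed.cs⁺ (compress I cs len)) (Compressed.aligned (compress I cs len))
  ...   | v , v≡ = D composition v , gen (composition , v , refl) ,
      ≋-trans (≋-reflexive (component-𝔻 I cs)) (≋-trans (≋-sym (Σ-↭ (descentClass-compress I cs len)))
        (≋-trans (≋-reflexive (cong (𝔻 I⁺) (sym v≡))) (≋-sym (embed-D composition v))))
    where
    open Compressed (compress I cs len)
    composition : Composition (sum I)
    composition = record { parts = I⁺ ; positive = positive ; sums = sum≡ }
  descent-component n 0∈ = 0ᶠ , 0∈ , ≋-reflexive refl
  descent-component n (+∈ {x} {y} x∈ y∈) with descent-component n x∈ | descent-component n y∈
  ... | z , z∈ , x≋z | w , w∈ , y≋w = z +ᶠ w , +∈ z∈ w∈ , ≋-intro λ ψ → begin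
    ⟦ component n (x +ᶠ y) ⟧ ψ                   ≡⟨ cong (λ x → ⟦ x ⟧ ψ) (List.filter-++ _ x y) ⟩
    ⟦ component n x +ᶠ component n y ⟧ ψ         ≈⟨ ⟦⟧-++ (component n x) _ ψ ⟩
    ⟦ component n x ⟧ ψ ⊹ ⟦ component n y ⟧ ψ    ≈⟨ K.+-cong (at x≋z ψ) (at y≋w ψ) ⟩
    ⟦ embed n z ⟧ ψ ⊹ ⟦ embed n w ⟧ ψ            ≈⟨ ⟦⟧-++ (embed n z) _ ψ ⟨
    ⟦ embed n z +ᶠ embed n w ⟧ ψ                 ≡⟨ cong (λ x → ⟦ x ⟧ ψ) (List.concatMap-++ _ z w) ⟨
    ⟦ embed n (z +ᶠ w) ⟧ ψ                       ∎
  descent-component n (·∈ k {x} x∈) with descent-component n x∈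
  ... | z , z∈ , x≋z = k · z , ·∈ k z∈ , ≋-intro λ ψ → begin
    ⟦ component n (k · x) ⟧ ψ          ≈⟨ at (component-linear n (k · x)) ψ ⟩
    ⟦ linear (projection n) (k · x) ⟧ ψ ≈⟨ at (linear-· (projection n) k x) ψ ⟨
    ⟦ k · linear (projection n) x ⟧ ψ  ≈⟨ ⟦⟧-· k (linear (projection n) x) ψ ⟩
    k ✶ ⟦ linear (projection n) x ⟧ ψ  ≈⟨ K.*-congˡ (at (component-linear n x) ψ) ⟨
    k ✶ ⟦ component n x ⟧ ψ            ≈⟨ K.*-congˡ (at x≋z ψ) ⟩
    k ✶ ⟦ embed n z ⟧ ψ                ≈⟨ ⟦⟧-· k (embed n z) ψ ⟨
    ⟦ k · embed n z ⟧ ψ                ≈⟨ at (linear-· G k z) ψ ⟩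
    ⟦ embed n (k · z) ⟧ ψ              ∎
  descent-component n (resp {x} {y} x≈y x∈) with descent-component n x∈
  ... | z , z∈ , x≋z = z , z∈ , ≋-trans (≋-sym (component-cong n {x} {y} (Equal⇒≋ _≟_ {x} {y} x≈y))) x≋z

  embed-descent : ∀ n {z} → z ∈ DescentAlgebra n → embed n z ∈ DescentSpan
  embed-descent n = span-linear _≟ₙ_ _≟_ G λ { (I , v , refl) →
    span-resp _≟_ (≋-sym (embed-D I v)) (𝔻∈ (Composition.parts I) (toList v) (sym (Vec.length-toList v))) }

  degree-MR : ∀ n → degree n MR ≐ embed⟨ DescentAlgebra n ⟩
  degree-MR n = to , from
    where
    to : degree n MR ⊆ embed⟨ DescentAlgebra n ⟩
    -- Homogeneity identifies `x` with `component n x`, which is what `descent-component` describes.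
    to {x} (x∈ , homogeneous) with descent-component n (MR⊆DescentSpan x∈)
    ... | z , z∈ , eq = z , z∈ ,
      ≋⇒Equal _≟_ {x} {embed n z} (≋-trans (≋-sym (Equal⇒≋ _≟_ {component n x} {x} homogeneous)) eq)
    from : embed⟨ DescentAlgebra n ⟩ ⊆ degree n MR
    from {x} (z , z∈ , x≈z) = MR-resp (≋-sym x≋z) (DescentSpan⊆MR (embed-descent n z∈)) ,
      ≋⇒Equal _≟_ {component n x} {x} (≋-trans (component-cong n x≋z) (≋-trans (component-embed z) (≋-sym x≋z)))
      where x≋z = Equal⇒≋ _≟_ {x} {embed n z} x≈z

proposition5p1 : ∀ {c ℓ} (K : CommutativeRing c ℓ) (l : ℕ) .{{_ : NonZero l}} →
    let open FreeQuasiSymmetric K l in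
    IsHopfSubalgebra MR × MR ⊆ Sym × IsGraded MR ×
    (∀ n → degree n MR ≐ embed⟨ DescentAlgebra n ⟩)
proposition5p1 K l = MR-isHopfSubalgebra , MR⊆Sym , MR-isGraded , degree-MR
  where
  open MantaciReutenauer K l
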